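{- Let $q$ be a prime power and $\varepsilon\in\{ -1,+1\}$. Then, as formal power series in $x$, $$1+\sum_{n\geq1}\Big[\sum_{\lambda\vdash n}\prod_{d\in B(\lambda)}\sum_{1\leq i\leq E(\lambda,d)}2^i\binom{E(\lambda,d)-1}{\varepsilon(E(\lambda,d)-i)}\binom{\mathrm{SDIM}^-_d(q)}{\varepsilon i}\Big]x^n=\Big(\frac{(1+x)(1+qx)}{(1-x)(1-qx)}\Big)^{\varepsilon}$$ and $$1+\sum_{n\geq1}\Big[\sum_{\lambda\vdash n}\prod_{d\in B(\lambda)}\sum_{1\leq i\leq E(\lambda,d)}2^i\binom{E(\lambda,d)-1}{\varepsilon(E(\lambda,d)-i)}\binom{\mathrm{SRIM}^-_d(q)}{\varepsilon i}\Big]x^n=\begin{cases}\big(\frac{1-x}{1-qx}\big)^{\varepsilon} & q\text{ odd}\\ \big(\frac{1}{1-qx}\big)^{\varepsilon} & q\text{ even.}\end{cases}$$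
   Context: For a monic $f(x)=\sum_{i=0}^d a_ix^i\in\mathbf{F}_{q^2}[x]$ of degree $d$ with $a_0\neq0$, its dual is $\tilde f(x)=\bar a_0^{ -1}x^d\bar f(x^{ -1})$ where $\bar f$ applies $a\mapsto a^q$ to coefficients; $f$ is self-dual if $\tilde f=f$. $\mathrm{SDIM}^-_d(q)$ is the number of self-dual irreducible monic polynomials of degree $d$ over $\mathbf{F}_{q^2}$. For $f\in\mathbf{F}_q[x]$ of degree $k$ with $f(0)\neq0$, $f$ is self-reciprocal if $x^kf(x^{ -1})=f(x)$; $\mathrm{SRIM}^-_d(q)$ is the number of self-reciprocal irreducible monic polynomials of degree $2d$ over $\mathbf{F}_q$. For a partition $\lambda$, $B(\lambda)$ is its set of distinct parts and $E(\lambda,d)$ the multiplicity of $d$. For $m\in\mathbf{Q}$ and $k\geq0$, $\binom{m}{k}=m(m-1)\cdots(m-k+1)/k!$ and $\binom{m}{ -k}=(-1)^k\binom{m}{k}$. -}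

module Defs where

open import Level using (0ℓ)
open import Data.Nat as ℕ using (ℕ; zero; suc; _≤_; _≥_; _∸_; _%_)
import Data.Nat.Properties as ℕₚ
open import Data.Nat.Combinatorics using (_C_)
open import Data.Nat.ListAction using (sum)
open import Data.Integer as ℤ using (ℤ; +_; -[1+_])
open import Data.List using (List; []; _∷_; _++_; [_]; map; reverse; length; filter; deduplicate; upTo; foldr; zipWith; replicate)
open import Data.List.Membership.Propositional using (_∈_)
open import Data.List.Relation.Unary.Unique.Propositional using (Unique)
open import Data.List.Relation.Unary.All using (All)
open import Data.List.Relation.Unary.AllPairs using (AllPairs)
open import Data.Vec as Vec using (Vec; toList)
open import Data.Product using (Σ; _×_; ∃; ∃-syntax)
open import Relation.Binary.PropositionalEquality using (_≡_; _≢_)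
open import Relation.Nullary using (¬_)
open import Algebra.Structures using (IsCommutativeRing)

record FiniteField : Set₁ where
  infixl 7 _*_
  infixl 6 _+_
  field
    Carrier   : Set
    _+_ _*_   : Carrier → Carrier → Carrier
    -_        : Carrier → Carrier
    0# 1#     : Carrier
    _⁻¹       : Carrier → Carrier
    isCommutativeRing : IsCommutativeRing _≡_ _+_ _*_ -_ 0# 1#
    0≢1       : 0# ≢ 1#
    ⁻¹-inverse : ∀ x → x ≢ 0# → x ⁻¹ * x ≡ 1#
    elements  : List Carrier
    elements-unique   : Unique elements
    elements-complete : ∀ x → x ∈ elements

  card : ℕ
  card = length elements

  _^_ : Carrier → ℕ → Carrier
  x ^ zero  = 1#
  x ^ suc n = x * (x ^ n)

  -- Polynomials as coefficient lists [a₀, a₁, …] (lowest degree first)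

  addP : List Carrier → List Carrier → List Carrier
  addP [] ys = ys
  addP (x ∷ xs) [] = x ∷ xs
  addP (x ∷ xs) (y ∷ ys) = (x + y) ∷ addP xs ys

  mulP : List Carrier → List Carrier → List Carrier
  mulP [] ys = []
  mulP (x ∷ xs) ys = addP (map (x *_) ys) (0# ∷ mulP xs ys)

  monic : ∀ {d} → Vec Carrier d → List Carrier
  monic f = toList f ++ [ 1# ]

  const : List Carrier → Carrier
  const [] = 0#
  const (a ∷ _) = a

  -- f is a product of two polynomials of positive degree
  -- (a polynomial of degree k ≥ 1 is written g ++ [c] with c ≠ 0, length g = k)
  Reducible : List Carrier → Set
  Reducible f = ∃[ g ] ∃[ c ] ∃[ h ] ∃[ e ]
    (1 ≤ length g × c ≢ 0# × 1 ≤ length h × e ≢ 0# ×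
     mulP (g ++ [ c ]) (h ++ [ e ]) ≡ f)

  IrreducibleMonic : ∀ d → Vec Carrier d → Set
  IrreducibleMonic d f = 1 ≤ d × ¬ Reducible (monic f)

  -- self-reciprocal: f(0) ≠ 0 and x^k f(1/x) = f(x)
  SelfReciprocal : List Carrier → Set
  SelfReciprocal f = const f ≢ 0# × reverse f ≡ f

  -- dual over F_{q²} (here the field is F_{q²} and conj a = a^q):
  -- f̃(x) = ā₀⁻¹ x^d f̄(1/x)
  conj : ℕ → Carrier → Carrier
  conj q a = a ^ q

  dual : ℕ → List Carrier → List Carrier
  dual q f = map ((conj q (const f)) ⁻¹ *_) (reverse (map (conj q) f))

  SelfDual : ℕ → List Carrier → Set
  SelfDual q f = const f ≢ 0# × dual q f ≡ f

  -- SDIM⁻_d(q) predicate (field of order q²), SRIM⁻_d(q) predicate (degree 2d)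
  SelfDualIrr : ℕ → ∀ d → Vec Carrier d → Set
  SelfDualIrr q d f = IrreducibleMonic d f × SelfDual q (monic f)

  SelfRecipIrr : ∀ d → Vec Carrier (2 ℕ.* d) → Set
  SelfRecipIrr d f = IrreducibleMonic (2 ℕ.* d) f × SelfReciprocal (monic f)

Enumerates : {A : Set} → (A → Set) → List A → Set
Enumerates {A} P xs = Unique xs × (∀ (x : A) → (x ∈ xs → P x) × (P x → x ∈ xs))

HasCount : {A : Set} → (A → Set) → ℕ → Set
HasCount P n = ∃[ xs ] (Enumerates P xs × length xs ≡ n)

IsPartition : ℕ → List ℕ → Set
IsPartition n λs = All (1 ≤_) λs × AllPairs _≥_ λs × sum λs ≡ n

B : List ℕ → List ℕ
B λs = deduplicate ℕ._≟_ λs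

E : List ℕ → ℕ → ℕ
E λs d = length (filter (d ℕ.≟_) λs)

sumℤ : List ℤ → ℤ
sumℤ = foldr ℤ._+_ (+ 0)

prodℤ : List ℤ → ℤ
prodℤ = foldr ℤ._*_ (+ 1)

binom : ℕ → ℤ → ℤ
binom m (+ k) = + (m C k)
binom m -[1+ k ] = (ℤ.- (+ 1)) ℤ.^ (suc k) ℤ.* (+ (m C suc k))

oneTo : ℕ → List ℕ
oneTo n = map suc (upTo n)

inner : ℤ → ℕ → ℕ → ℤ
inner ε e s = sumℤ (map (λ i → (+ 2) ℤ.^ i ℤ.* binom (e ∸ 1) (ε ℤ.* (+ e ℤ.- + i)) ℤ.* binom s (ε ℤ.* + i)) (oneTo e))

partTerm : ℤ → (ℕ → ℕ) → List ℕ → ℤ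
partTerm ε s λs = prodℤ (map (λ d → inner ε (E λs d) (s d)) (B λs))

Series : Set
Series = ℕ → ℤ

_⋆_ : Series → Series → Series
(f ⋆ g) n = sumℤ (map (λ k → f k ℤ.* g (n ∸ k)) (upTo (suc n)))

poly : List ℤ → Series
poly [] n = + 0
poly (a ∷ as) zero = a
poly (a ∷ as) (suc n) = poly as n

-- the left-hand side: 1 + Σ_{n≥1} [Σ_{λ⊢n} …] xⁿ, where ps n enumerates partitions of n
lhs : ℤ → (ℕ → List (List ℕ)) → (ℕ → ℕ) → Series
lhs ε ps s zero = + 1
lhs ε ps s (suc n) = sumℤ (map (partTerm ε s) (ps (suc n)))

-- F = (N / D)^ε, for series N, D with constant term 1 (hence invertible):
-- ε = 1 : F·D = N ;  ε = -1 : F·N = D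
RatPowEq : ℤ → Series → Series → Series → Set
RatPowEq ε F N D = (ε ≡ + 1 → ∀ n → (F ⋆ D) n ≡ N n)
                 × (ε ≡ ℤ.- (+ 1) → ∀ n → (F ⋆ N) n ≡ D n)

-- (1+x)(1+qx) and (1-x)(1-qx)
sdNum : ℕ → Series
sdNum q = poly (+ 1 ∷ (+ 1 ℤ.+ + q) ∷ + q ∷ [])

sdDen : ℕ → Series
sdDen q = poly (+ 1 ∷ ℤ.- (+ 1 ℤ.+ + q) ∷ + q ∷ [])

srNum : ℕ → Series
srNum q with q % 2
... | zero  = poly (+ 1 ∷ [])
... | suc _ = poly (+ 1 ∷ ℤ.- (+ 1) ∷ [])

srDen : ℕ → Series
srDen q = poly (+ 1 ∷ ℤ.- (+ q) ∷ [])

{-# OPTIONS --safe #-}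

-- Σ_{1≤i≤e} 2^i C(e-1, e-i) C(s, i) is the coefficient of y^e in ((1 + y) / (1 - y))^s, so the left-hand sides are the
-- products over d of ((1 + ε x^d) / (1 - ε x^d))^(s_d).
--
-- Let σ be an involutive automorphism of a finite field with Q elements (a ↦ a^q on F_{q²}, or the identity on F_q), and
-- let f ↦ f~ be the dual twisted by σ on the monic polynomials with f(0) ≠ 0.  Write A(x) = Σ_{f~=f} x^(deg f),
-- Z(x) = Σ_f x^(deg f) and let P run over the irreducibles with P~ = P.  Unique factorisation gives
--   A(x)² Π_P (1 - x^(deg P)) = Z(x²) Π_P (1 + x^(deg P)),
-- an irreducible with P~ = P and a pair {P, P~} with P~ ≠ P both contributing equally to the two sides.  It is obtained
-- by sieving out one orbit {P, P~} at a time, which needs only Euclid's lemma.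
--
-- Counting coefficients directly, (1 - Q x²) Z(x²) = 1 - x² and (1 - Q x²) A(x) = (1 + x)(1 + κ x), where κ + 1 is the
-- number of c with c σ(c) = 1.  For a ↦ a^q, Hilbert 90 gives κ = q.  For the identity, κ is 0 or 1, the P of odd degree
-- are the x + c with c² = 1, and the P of even degree are the self-reciprocal irreducibles.
module Submission where

-- The square and the substitution x² are forced by the pairs. A pair {P, P~} of degree d puts one
-- factor 1/(1 - x^(2d)) into A and two factors 1/(1 - x^d) into Z, so A(x)² and Z(x²) agree on it.
-- A self-dual P leaves the quotient (1 + x^d)/(1 - x^d), exactly the factor of the left-hand side.
-- The products are infinite. Every identity is therefore stated with denominators cleared and only
-- up to degree n, where the factors of degree at most n suffice. The fields K and L are given by
-- their cardinalities alone, with no embedding and no prime. That a ↦ a^q is additive on L thus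
-- needs its own argument: the inner binomial coefficients of q vanish in K, because a polynomial of
-- degree less than q with q roots is zero, and this vanishing is carried to L through common
-- divisors with q. Likewise the statement separates q odd from q even, whereas κ depends on whether
-- 2 = 0 in K. The two distinctions are matched only at the end, by a coefficient of the identity
-- itself.

open import Defs
open import Level using (0ℓ)
open import Algebra.Bundles using (CommutativeRing)
open import Algebra.Structures using (IsCommutativeRing)
open import Data.Empty using (⊥; ⊥-elim)
open import Data.List using (List; []; _∷_; _++_; [_]; _∷ʳ_; _∷ʳ′_; initLast; map; filter; foldr; length; reverse; replicate; concatMap; upTo; applyUpTo)
open import Data.List.Membership.Propositional using (_∈_; _∉_; lose; find)
open import Data.List.Membership.Propositional.Properties using (∈-map⁺; ∈-map⁻; ∈-++⁺ˡ; ∈-++⁺ʳ; ∈-++⁻; ∈-filter⁺; ∈-filter⁻; ∈-upTo⁺; ∈-upTo⁻; ∈-length)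
open import Data.List.Membership.Propositional.Properties.WithK using (unique∧set⇒bag)
open import Data.List.Properties using (length-++; length-map; length-reverse; unfold-reverse; reverse-++; map-++; map-∘; map-id; map-cong; map-cong-local; ∷-injective; ∷-injectiveˡ; ∷-injectiveʳ; ∷ʳ-injective; ≡-dec; filter-all; filter-none; filter-accept; filter-reject)
open import Data.List.Relation.Binary.BagAndSetEquality using (∼bag⇒↭)
open import Data.List.Relation.Binary.Permutation.Propositional as ↭ using (_↭_)
open import Data.List.Relation.Binary.Permutation.Propositional.Properties using (↭-length)
open import Data.List.Relation.Unary.All as All using (All; []; _∷_; all?)
import Data.List.Relation.Unary.All.Properties as All
open import Data.List.Relation.Unary.AllPairs using (AllPairs; []; _∷_)
open import Data.List.Relation.Unary.Any using (here; there; any?)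
open import Data.List.Relation.Unary.Unique.Propositional using (Unique)
open import Data.List.Relation.Unary.Unique.Propositional.Properties using (++⁺; filter⁺; upTo⁺)
open import Data.Nat as ℕ using (ℕ; zero; suc; z≤n; s≤s; _≤_; _<_; _≥_; _%_)
import Data.Nat.Properties as ℕ
open import Data.Nat.Coprimality using (gcd≡1⇒coprime; coprime-Bézout)
open import Data.Nat.Divisibility using (divides)
open import Data.Nat.GCD using (gcd; gcd[m,n]∣m; gcd[m,n]∣n; module Bézout)
open import Data.Nat.Induction using (<-wellFounded)
open import Data.Nat.Tactic.RingSolver using () renaming (solve-∀ to ℕ-solve-∀)
open import Data.Product using (_×_; _,_; ∃-syntax; proj₁; proj₂)
open import Data.Sum as Sum using (_⊎_; inj₁; inj₂; [_,_]′)
open import Data.Vec as Vec using (Vec; toList)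
open import Data.Vec.Properties using (toList∘fromList; toList-injective; length-toList; cast-is-id)
open import Function.Base using (_∘_; id)
open import Function.Bundles using (mk⇔)
open import Induction.WellFounded using (Acc; acc)
open import Relation.Binary.Definitions using (DecidableEquality; Tri; tri<; tri≈; tri>)
open import Relation.Binary.PropositionalEquality hiding ([_])
open import Relation.Binary.Structures using (IsEquivalence)
open import Relation.Nullary using (¬_; Dec; yes; no; ¬?)
open import Relation.Nullary.Decidable using (recompute; map′; _×-dec_)
open import Relation.Unary using (Decidable)

-- Power series

module PowerSeries {A : Set} {_+_ _*_ : A → A → A} { -_ : A → A} {0# 1# : A}
    (isCR : IsCommutativeRing _≡_ _+_ _*_ -_ 0# 1#) where

  infixl 6 _+′_
  infixl 7 _*′_
  _+′_ _*′_ : A → A → A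
  _+′_ = _+_
  _*′_ = _*_

  R : CommutativeRing 0ℓ 0ℓ
  R = record { isCommutativeRing = isCR }

  open IsCommutativeRing isCR public using (+-assoc; +-comm; +-identityˡ; +-identityʳ; *-assoc; *-comm; *-identityˡ; *-identityʳ; distribˡ; distribʳ; zeroˡ; zeroʳ; -‿inverseˡ; -‿inverseʳ)
  open import Algebra.Properties.Ring (CommutativeRing.ring R) public using (-‿distribˡ-*; -‿distribʳ-*; -‿involutive; -0#≈0#; -‿+-comm; x∙y⁻¹≈ε⇒x≈y; +-cancelˡ; +-cancelʳ)
  module AS where
    open import Algebra.Solver.Ring.NaturalCoefficients.Default (CommutativeRing.commutativeSemiring R) public

  Ser : Set
  Ser = ℕ → A

  infix 4 _≈_ _≈[_]_
  infixl 6 _⊕_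
  infixl 7 _⊛_ _·_
  infixr 5 _◂_

  _≈_ : Ser → Ser → Set
  f ≈ g = ∀ n → f n ≡ g n

  _≈[_]_ : Ser → ℕ → Ser → Set
  f ≈[ n ] g = ∀ k → k ℕ.≤ n → f k ≡ g k

  tl : Ser → Ser
  tl f n = f (suc n)

  _◂_ : A → Ser → Ser
  (a ◂ f) zero = a
  (a ◂ f) (suc n) = f n

  𝟘 : Ser
  𝟘 _ = 0#

  con : A → Ser
  con c = c ◂ 𝟘

  𝟙 : Ser
  𝟙 = con 1#

  _⊕_ : Ser → Ser → Ser
  (f ⊕ g) n = f n +′ g n

  ⊖_ : Ser → Ser
  (⊖ f) n = - f n

  _·_ : A → Ser → Ser
  (c · f) n = c *′ f n

  -- The Cauchy product, unfolded along the tail of the left factor so that proofs go by induction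
  -- on the index.
  _⊛_ : Ser → Ser → Ser
  (f ⊛ g) zero = f 0 *′ g 0
  (f ⊛ g) (suc n) = f 0 *′ g (suc n) +′ (tl f ⊛ g) n

  shift : ℕ → Ser → Ser
  shift zero f = f
  shift (suc d) f = 0# ◂ shift d f

  X^ : ℕ → Ser
  X^ d = shift d 𝟙

  ⊛-cong-at : ∀ n {f f′ g g′} → f ≈[ n ] f′ → g ≈[ n ] g′ → (f ⊛ g) n ≡ (f′ ⊛ g′) n
  ⊛-cong-at zero p q = cong₂ _*_ (p 0 z≤n) (q 0 z≤n)
  ⊛-cong-at (suc n) p q = cong₂ _+_ (cong₂ _*_ (p 0 z≤n) (q (suc n) ℕ.≤-refl))
    (⊛-cong-at n (λ k k≤n → p (suc k) (s≤s k≤n)) (λ k k≤n → q k (ℕ.m≤n⇒m≤1+n k≤n)))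

  ⊛-cong[] : ∀ {n f f′ g g′} → f ≈[ n ] f′ → g ≈[ n ] g′ → f ⊛ g ≈[ n ] f′ ⊛ g′
  ⊛-cong[] p q k k≤n = ⊛-cong-at k (λ j j≤k → p j (ℕ.≤-trans j≤k k≤n)) (λ j j≤k → q j (ℕ.≤-trans j≤k k≤n))

  ⊛-cong : ∀ {f f′ g g′} → f ≈ f′ → g ≈ g′ → f ⊛ g ≈ f′ ⊛ g′
  ⊛-cong p q n = ⊛-cong-at n (λ k _ → p k) (λ k _ → q k)

  -- The mirror image of the defining recursion, peeling the right factor; commutativity compares
  -- the two.
  ⊛-suc : ∀ f g n → (f ⊛ g) (suc n) ≡ (f ⊛ tl g) n +′ f (suc n) *′ g 0
  ⊛-suc f g zero = refl
  ⊛-suc f g (suc n) = trans (cong (f 0 *′ g (suc (suc n)) +′_) (⊛-suc (tl f) g n)) (sym (+-assoc _ _ _))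

  ⊛-comm : ∀ f g → f ⊛ g ≈ g ⊛ f
  ⊛-comm f g zero = *-comm _ _
  ⊛-comm f g (suc n) = trans (+-comm _ _)
    (trans (cong₂ _+_ (⊛-comm (tl f) g n) (*-comm _ _)) (sym (⊛-suc g f n)))

  ⊛-distribʳ : ∀ h f g → (f ⊕ g) ⊛ h ≈ f ⊛ h ⊕ g ⊛ h
  ⊛-distribʳ h f g zero = distribʳ _ _ _
  ⊛-distribʳ h f g (suc n) = trans (cong ((f 0 +′ g 0) *′ h (suc n) +′_) (⊛-distribʳ h (tl f) (tl g) n))
    (AS.solve 5 (λ a b c x y → ((a AS.:+ b) AS.:* c) AS.:+ (x AS.:+ y) AS.:= (a AS.:* c AS.:+ x) AS.:+ (b AS.:* c AS.:+ y)) refl (f 0) (g 0) (h (suc n)) _ _)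

  ·-⊛ : ∀ c f g → (c · f) ⊛ g ≈ c · (f ⊛ g)
  ·-⊛ c f g zero = *-assoc _ _ _
  ·-⊛ c f g (suc n) = trans (cong₂ _+_ (*-assoc _ _ _) (·-⊛ c (tl f) g n)) (sym (distribˡ _ _ _))

  ⊛-assoc : ∀ f g h → (f ⊛ g) ⊛ h ≈ f ⊛ (g ⊛ h)
  ⊛-assoc f g h zero = *-assoc _ _ _
  ⊛-assoc f g h (suc n) = trans
    (cong (f 0 *′ g 0 *′ h (suc n) +′_) (trans (⊛-distribʳ h (f 0 · tl g) (tl f ⊛ g) n)
      (cong₂ _+_ (·-⊛ (f 0) (tl g) h n) (⊛-assoc (tl f) g h n))))
    (AS.solve 5 (λ a b c x y → ((a AS.:* b) AS.:* c) AS.:+ (a AS.:* x AS.:+ y) AS.:= (a AS.:* (b AS.:* c AS.:+ x)) AS.:+ y) refl (f 0) (g 0) (h (suc n)) _ _)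

  𝟘-⊛ : ∀ f → 𝟘 ⊛ f ≈ 𝟘
  𝟘-⊛ f zero = zeroˡ _
  𝟘-⊛ f (suc n) = trans (cong₂ _+_ (zeroˡ _) (𝟘-⊛ f n)) (+-identityˡ _)

  con-⊛ : ∀ c f → con c ⊛ f ≈ c · f
  con-⊛ c f zero = refl
  con-⊛ c f (suc n) = trans (cong (c *′ f (suc n) +′_) (𝟘-⊛ f n)) (+-identityʳ _)

  ⊛-identityˡ : ∀ f → 𝟙 ⊛ f ≈ f
  ⊛-identityˡ f n = trans (con-⊛ 1# f n) (*-identityˡ _)

  ⊛-identityʳ : ∀ f → f ⊛ 𝟙 ≈ f
  ⊛-identityʳ f n = trans (⊛-comm f 𝟙 n) (⊛-identityˡ f n)

  ≈-isEquivalence : IsEquivalence _≈_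
  ≈-isEquivalence = record { refl = λ n → refl ; sym = λ p n → sym (p n) ; trans = λ p q n → trans (p n) (q n) }

  serCR : IsCommutativeRing _≈_ _⊕_ _⊛_ ⊖_ 𝟘 𝟙
  serCR = record
    { isRing = record
      { +-isAbelianGroup = record
        { isGroup = record
          { isMonoid = record
            { isSemigroup = record
              { isMagma = record { isEquivalence = ≈-isEquivalence ; ∙-cong = λ p q n → cong₂ _+_ (p n) (q n) }
              ; assoc = λ f g h n → +-assoc _ _ _ }
            ; identity = (λ f n → +-identityˡ _) , (λ f n → +-identityʳ _) }
          ; inverse = (λ f n → -‿inverseˡ _) , (λ f n → -‿inverseʳ _)
          ; ⁻¹-cong = λ p n → cong -_ (p n) }
        ; comm = λ f g n → +-comm _ _ }
      ; *-cong = ⊛-cong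
      ; *-assoc = ⊛-assoc
      ; *-identity = ⊛-identityˡ , ⊛-identityʳ
      ; distrib = (λ h f g n → trans (⊛-comm h (f ⊕ g) n) (trans (⊛-distribʳ h f g n) (cong₂ _+_ (⊛-comm f h n) (⊛-comm g h n))))
                , ⊛-distribʳ }
    ; *-comm = ⊛-comm }

  serRing : CommutativeRing 0ℓ 0ℓ
  serRing = record { isCommutativeRing = serCR }

  module SS where
    open import Algebra.Solver.Ring.NaturalCoefficients.Default (CommutativeRing.commutativeSemiring serRing) public

  open IsCommutativeRing serCR public using () renaming (refl to ≈-refl; sym to ≈-sym; trans to ≈-trans; +-cong to ⊕-cong; distribˡ to ⊛-distribˡ)
  module SerRingProps where
    open import Algebra.Properties.Ring (CommutativeRing.ring serRing) public

  ·-⊛ʳ : ∀ c f g → f ⊛ (c · g) ≈ c · (f ⊛ g)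
  ·-⊛ʳ c f g n = trans (⊛-comm f (c · g) n) (trans (·-⊛ c g f n) (cong (c *′_) (⊛-comm g f n)))

  ◂-⊛ : ∀ f g → (0# ◂ f) ⊛ g ≈ 0# ◂ (f ⊛ g)
  ◂-⊛ f g zero = zeroˡ _
  ◂-⊛ f g (suc n) = trans (cong (_+′ (f ⊛ g) n) (zeroˡ _)) (+-identityˡ _)

  ◂-cong : ∀ {a f g} → f ≈ g → a ◂ f ≈ a ◂ g
  ◂-cong p zero = refl
  ◂-cong p (suc n) = p n

  shift-cong : ∀ d {f g} → f ≈ g → shift d f ≈ shift d g
  shift-cong zero p = p
  shift-cong (suc d) p = ◂-cong (shift-cong d p)

  shift-⊛ : ∀ d f g → shift d f ⊛ g ≈ shift d (f ⊛ g)
  shift-⊛ zero f g = ≈-refl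
  shift-⊛ (suc d) f g = ≈-trans (◂-⊛ (shift d f) g) (◂-cong (shift-⊛ d f g))

  X^-⊛ : ∀ d f → X^ d ⊛ f ≈ shift d f
  X^-⊛ d f = ≈-trans (shift-⊛ d 𝟙 f) (shift-cong d (⊛-identityˡ f))

  shift-+ : ∀ d f n → shift d f (d ℕ.+ n) ≡ f n
  shift-+ zero f n = refl
  shift-+ (suc d) f n = shift-+ d f n

  shift-shift : ∀ a b f → shift (a ℕ.+ b) f ≈ shift a (shift b f)
  shift-shift zero b f = ≈-refl
  shift-shift (suc a) b f = ◂-cong (shift-shift a b f)

  X^-+ : ∀ a b → X^ (a ℕ.+ b) ≈ X^ a ⊛ X^ b
  X^-+ a b = ≈-trans (shift-shift a b 𝟙) (≈-sym (X^-⊛ a (X^ b)))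

  shift-< : ∀ d f n → n ℕ.< d → shift d f n ≡ 0#
  shift-< (suc d) f zero _ = refl
  shift-< (suc d) f (suc n) (s≤s p) = shift-< d f n p

  shift-≥ : ∀ d f n → d ℕ.≤ n → shift d f n ≡ f (n ℕ.∸ d)
  shift-≥ zero f n _ = refl
  shift-≥ (suc d) f (suc n) (s≤s p) = shift-≥ d f n p

  -- The coefficients of `k` fall from the bottom: `k 0 * f 0 = 0` kills `k 0`, and then `tl k ⊛ f`
  -- vanishes up to one degree less. Division of series is always such a cancellation, so inverse
  -- series never occur.
  ⊛-vanish : ∀ {u f k} → u *′ f 0 ≡ 1# → ∀ n → k ⊛ f ≈[ n ] 𝟘 → k n ≡ 0#
  ⊛-vanish {u} {f} {k} inv n p = last n k p
    where
    head : ∀ k → k 0 *′ f 0 ≡ 0# → k 0 ≡ 0#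
    head k e = trans (sym (*-identityʳ _)) (trans (cong (k 0 *′_) (trans (sym inv) (*-comm _ _)))
      (trans (sym (*-assoc _ _ _)) (trans (cong (_*′ u) e) (zeroˡ _))))
    last : ∀ n k → k ⊛ f ≈[ n ] 𝟘 → k n ≡ 0#
    last zero k p = head k (p 0 z≤n)
    last (suc n) k p = last n (tl k) λ j j≤n →
      trans (sym (trans (cong (_+′ (tl k ⊛ f) j) (trans (cong (_*′ f (suc j)) (head k (p 0 z≤n))) (zeroˡ _))) (+-identityˡ _)))
            (p (suc j) (s≤s j≤n))

  ⊛-cancelʳ[] : ∀ {u f g h n} → u *′ f 0 ≡ 1# → g ⊛ f ≈[ n ] h ⊛ f → g ≈[ n ] h
  ⊛-cancelʳ[] {u} {f} {g} {h} inv p k k≤n = x∙y⁻¹≈ε⇒x≈y _ _ (⊛-vanish {u} {f} {g ⊕ ⊖ h} inv k λ j j≤k →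
    trans (⊛-distribʳ f g (⊖ h) j)
      (trans (cong₂ _+_ (p j (ℕ.≤-trans j≤k k≤n)) (sym (SerRingProps.-‿distribˡ-* h f j))) (-‿inverseʳ _)))

  ⊛-cancelʳ : ∀ {u f g h} → u *′ f 0 ≡ 1# → g ⊛ f ≈ h ⊛ f → g ≈ h
  ⊛-cancelʳ {f = f} inv p n = ⊛-cancelʳ[] {f = f} inv (λ k _ → p k) n ℕ.≤-refl

-- Counting

module _ {A : Set} where

  enum-resp : {P Q : A → Set} {xs : List A} → (∀ a → P a → Q a) → (∀ a → Q a → P a) → Enumerates P xs → Enumerates Q xs
  enum-resp to from (u , e) = u , λ a → (λ m → to a (proj₁ (e a) m)) , (λ q → proj₂ (e a) (from a q))

  -- Duplicate-free lists with the same members are permutations of each other. This makes counts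
  -- and sums independent of the enumeration, in particular of the given list of partitions.
  enum-↭ : {P : A → Set} {xs ys : List A} → Enumerates P xs → Enumerates P ys → xs ↭ ys
  enum-↭ (u , e) (u′ , e′) = ∼bag⇒↭ (unique∧set⇒bag u u′ λ {a} →
    mk⇔ (λ m → proj₂ (e′ a) (proj₁ (e a) m)) (λ m → proj₂ (e a) (proj₁ (e′ a) m)))

  enum-[] : {P : A → Set} → (∀ a → ¬ P a) → Enumerates P []
  enum-[] none = [] , λ a → (λ ()) , (λ p → ⊥-elim (none a p))

  enum-++ : {P Q : A → Set} {xs ys : List A} → Enumerates P xs → Enumerates Q ys → (∀ a → P a → Q a → ⊥) →
    Enumerates (λ a → P a ⊎ Q a) (xs ++ ys)
  enum-++ {xs = xs} (u , e) (u′ , e′) disj =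
    ++⁺ u u′ (λ {a} (m , m′) → disj a (proj₁ (e a) m) (proj₁ (e′ a) m′)) ,
    λ a → (λ m → [ inj₁ ∘ proj₁ (e a) , inj₂ ∘ proj₁ (e′ a) ]′ (∈-++⁻ xs m)) ,
          [ ∈-++⁺ˡ ∘ proj₂ (e a) , ∈-++⁺ʳ xs ∘ proj₂ (e′ a) ]′

  enum-filter : {P Q : A → Set} (Q? : Decidable Q) {xs : List A} → Enumerates P xs → Enumerates (λ a → P a × Q a) (filter Q? xs)
  enum-filter Q? {xs} (u , e) = filter⁺ Q? u , λ a →
    (λ m → proj₁ (e a) (proj₁ (∈-filter⁻ Q? m)) , proj₂ (∈-filter⁻ Q? {xs = xs} m)) ,
    (λ (p , q) → ∈-filter⁺ Q? (proj₂ (e a) p) q)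

  unique-map : {B : Set} (φ : A → B) (xs : List A) → (∀ {a b} → a ∈ xs → b ∈ xs → φ a ≡ φ b → a ≡ b) → Unique xs → Unique (map φ xs)
  unique-map φ [] inj [] = []
  unique-map φ (x ∷ xs) inj (x∉ ∷ u) = All.tabulate fresh ∷ unique-map φ xs (λ m m′ → inj (there m) (there m′)) u
    where
    fresh : ∀ {b} → b ∈ map φ xs → φ x ≢ b
    fresh m eq with ∈-map⁻ φ m
    ... | a , a∈ , refl = All.lookup x∉ a∈ (inj (here refl) (there a∈) eq)

  enum-map : {B : Set} {P : A → Set} {Q : B → Set} (φ : A → B) {xs : List A} → Enumerates P xs →
    (∀ a → P a → Q (φ a)) → (∀ {a b} → P a → P b → φ a ≡ φ b → a ≡ b) → (∀ b → Q b → ∃[ a ] (P a × φ a ≡ b)) →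
    Enumerates Q (map φ xs)
  enum-map {Q = Q} φ {xs} (u , e) sound inj onto =
    unique-map φ xs (λ m m′ → inj (proj₁ (e _) m) (proj₁ (e _) m′)) u ,
    λ b → (λ m → let a , a∈ , eq = ∈-map⁻ φ m in subst Q (sym eq) (sound a (proj₁ (e a) a∈))) ,
          (λ q → let a , p , eq = onto b q in subst (_∈ _) eq (∈-map⁺ φ (proj₂ (e a) p)))

  count-unique : {P : A → Set} {m n : ℕ} → HasCount P m → HasCount P n → m ≡ n
  count-unique (xs , e , refl) (ys , e′ , refl) = ↭-length (enum-↭ e e′)

  count-resp : {P Q : A → Set} {n : ℕ} → (∀ a → P a → Q a) → (∀ a → Q a → P a) → HasCount P n → HasCount Q n
  count-resp to from (xs , e , l) = xs , enum-resp to from e , l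

  count-map : {B : Set} {P : A → Set} {Q : B → Set} {n : ℕ} (φ : A → B) → HasCount P n →
    (∀ a → P a → Q (φ a)) → (∀ {a b} → P a → P b → φ a ≡ φ b → a ≡ b) → (∀ b → Q b → ∃[ a ] (P a × φ a ≡ b)) → HasCount Q n
  count-map φ (xs , e , l) sound inj onto = map φ xs , enum-map φ e sound inj onto , trans (length-map φ xs) l

  count-⊎ : {P Q : A → Set} {m n : ℕ} → HasCount P m → HasCount Q n → (∀ a → P a → Q a → ⊥) → HasCount (λ a → P a ⊎ Q a) (m ℕ.+ n)
  count-⊎ (xs , e , refl) (ys , e′ , refl) disj = xs ++ ys , enum-++ e e′ disj , length-++ xs

  count-zero : {P : A → Set} → (∀ a → ¬ P a) → HasCount P 0
  count-zero none = [] , enum-[] none , refl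

  count-one : {P : A → Set} (c : A) → P c → (∀ a → P a → a ≡ c) → HasCount P 1
  count-one c pc only = c ∷ [] , ([] ∷ [] , λ a → (λ { (here refl) → pc }) , (λ p → here (only a p))) , refl

  count-filter : {P Q : A → Set} (Q? : Decidable Q) {n : ℕ} → HasCount P n → ∃[ m ] HasCount (λ a → P a × Q a) m
  count-filter Q? (xs , e , _) = length (filter Q? xs) , filter Q? xs , enum-filter Q? e , refl

  length-split : {Q : A → Set} (Q? : Decidable Q) (xs : List A) →
    length xs ≡ length (filter Q? xs) ℕ.+ length (filter (¬? ∘ Q?) xs)
  length-split Q? [] = refl
  length-split Q? (x ∷ xs) with Q? x
  ... | yes _ = cong suc (length-split Q? xs)
  ... | no _ = trans (cong suc (length-split Q? xs)) (sym (ℕ.+-suc _ _))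

  count-split : {P Q : A → Set} (Q? : Decidable Q) {n i j : ℕ} → HasCount P n → HasCount (λ a → P a × Q a) i →
    HasCount (λ a → P a × ¬ Q a) j → n ≡ i ℕ.+ j
  count-split Q? (xs , e , refl) ci cj = trans (length-split Q? xs)
    (cong₂ ℕ._+_ (count-unique (_ , enum-filter Q? e , refl) ci) (count-unique (_ , enum-filter (¬? ∘ Q?) e , refl) cj))

  -- Bounds an image from below: if all fibres have at most m elements, a domain of size N has at
  -- least N / m values. It is the counting half of both forms of Hilbert 90.
  fibre-bound : {B : Set} (_≟_ : DecidableEquality B) (φ : A → B) (m : ℕ) →
    (∀ b zs → Unique zs → (∀ z → z ∈ zs → φ z ≡ b) → length zs ≤ m) →
    ∀ ys xs → Unique xs → (∀ x → x ∈ xs → φ x ∈ ys) → length xs ≤ length ys ℕ.* m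
  fibre-bound _≟_ φ m small [] [] _ _ = z≤n
  fibre-bound _≟_ φ m small [] (x ∷ xs) _ into with into x (here refl)
  ... | ()
  fibre-bound {B} _≟_ φ m small (y ∷ ys) xs u into = ℕ.≤-trans (ℕ.≤-reflexive (length-split P? xs))
    (ℕ.+-mono-≤ (small y _ (filter⁺ P? u) (λ z m → proj₂ (∈-filter⁻ P? {xs = xs} m)))
      (fibre-bound _≟_ φ m small ys _ (filter⁺ (¬? ∘ P?) u)
        (λ x m → rest (proj₂ (∈-filter⁻ (¬? ∘ P?) {xs = xs} m)) (into x (proj₁ (∈-filter⁻ (¬? ∘ P?) m))))))
    where
    P? : Decidable (λ x → φ x ≡ y)
    P? x = φ x ≟ y
    rest : ∀ {b} → b ≢ y → b ∈ y ∷ ys → b ∈ ys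
    rest ne (here eq) = ⊥-elim (ne eq)
    rest ne (there m) = m

enum-⋃ : {I A : Set} (is : List I) → Unique is → (h : I → List A) (P : I → A → Set) →
  (∀ i → i ∈ is → Enumerates (P i) (h i)) → (∀ {i j a} → P i a → P j a → i ≡ j) →
  Enumerates (λ a → ∃[ i ] (i ∈ is × P i a)) (concatMap h is)
enum-⋃ [] _ h P e disj = enum-[] λ { a (_ , () , _) }
enum-⋃ (i ∷ is) (i∉ ∷ u) h P e disj = enum-resp
  (λ { a (inj₁ p) → i , here refl , p ; a (inj₂ (j , j∈ , p)) → j , there j∈ , p })
  (λ { a (_ , here refl , p) → inj₁ p ; a (j , there j∈ , p) → inj₂ (j , j∈ , p) })
  (enum-++ (e i (here refl)) (enum-⋃ is u h P (λ j j∈ → e j (there j∈)) disj)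
    (λ { a p (j , j∈ , p′) → All.lookup i∉ j∈ (disj p p′) }))

count-Σ : {A B : Set} {P : A → Set} {Q : A → B → Set} {n m : ℕ} → HasCount P n → (∀ a → P a → HasCount (Q a) m) →
  HasCount (λ (a , b) → P a × Q a b) (n ℕ.* m)
count-Σ {A} {B} {P} {Q} {m = m} (xs , (u , e) , refl) fibre =
  count-resp (λ (a , _) (a∈ , q) → proj₁ (e a) a∈ , q) (λ (a , _) (p , q) → proj₂ (e a) p , q)
    (go xs u λ a a∈ → fibre a (proj₁ (e a) a∈))
  where
  go : ∀ ys → Unique ys → (∀ a → a ∈ ys → HasCount (Q a) m) → HasCount (λ ((a , b) : A × B) → a ∈ ys × Q a b) (length ys ℕ.* m)
  go [] _ _ = count-zero λ { _ (() , _) }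
  go (y ∷ ys) (y∉ ∷ u) f = count-resp
    (λ { _ (inj₁ (refl , q)) → here refl , q ; _ (inj₂ (a∈ , q)) → there a∈ , q })
    (λ { _ (here refl , q) → inj₁ (refl , q) ; _ (there a∈ , q) → inj₂ (a∈ , q) })
    (count-⊎
      (count-map {Q = λ ((a , b) : A × B) → a ≡ y × Q a b} (y ,_) (f y (here refl)) (λ b q → refl , q) (λ { _ _ refl → refl }) (λ { (_ , b) (refl , q) → b , q , refl }))
      (go ys u (λ a a∈ → f a (there a∈)))
      (λ { _ (refl , _) (a∈ , _) → All.lookup y∉ a∈ refl }))

-- Graded monoids with an involution

-- Everything that the sieve knows about polynomials; Euclid's lemma stands in for unique
-- factorisation.
record GradedMonoid : Set₁ where
  infixl 7 _∙_
  infix 4 _∣_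
  field
    M : Set
    _≟_ : DecidableEquality M
    one : M
    _∙_ : M → M → M
    ∙-comm : ∀ f g → f ∙ g ≡ g ∙ f
    ∙-assoc : ∀ f g h → (f ∙ g) ∙ h ≡ f ∙ (g ∙ h)
    ∙-identityʳ : ∀ f → f ∙ one ≡ f
    ∙-cancelˡ : ∀ f {g h} → f ∙ g ≡ f ∙ h → g ≡ h
    deg : M → ℕ
    deg-∙ : ∀ f g → deg (f ∙ g) ≡ deg f ℕ.+ deg g
    deg-one : deg one ≡ 0
    deg≡0⇒one : ∀ f → deg f ≡ 0 → f ≡ one
    size : ℕ → ℕ
    level : ∀ m → HasCount (λ f → deg f ≡ m) (size m)
    _~ : M → M
    ~-involutive : ∀ f → (f ~) ~ ≡ f
    ~-∙ : ∀ f g → (f ∙ g) ~ ≡ f ~ ∙ g ~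
    deg-~ : ∀ f → deg (f ~) ≡ deg f

  _∣_ : M → M → Set
  f ∣ g = ∃[ h ] f ∙ h ≡ g

  Irr : M → Set
  Irr f = 1 ≤ deg f × (∀ g h → g ∙ h ≡ f → deg g ≡ 0 ⊎ deg h ≡ 0)

  field
    euclid : ∀ {p} → Irr p → ∀ f g → p ∣ f ∙ g → p ∣ f ⊎ p ∣ g

-- Polynomials over a finite field

-- Members of a duplicate-free list are equal exactly when their positions are, so the enumeration
-- of a finite field decides its equality.
unique⇒dec : {A : Set} {xs : List A} → Unique xs → ∀ {x y} → x ∈ xs → y ∈ xs → Dec (x ≡ y)
unique⇒dec u (here refl) (here refl) = yes refl
unique⇒dec (x∉ ∷ u) (here refl) (there m) = no (All.lookup x∉ m)
unique⇒dec (x∉ ∷ u) (there m) (here refl) = no λ e → All.lookup x∉ m (sym e)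
unique⇒dec (_ ∷ u) (there m) (there m′) = unique⇒dec u m m′

module FieldSeries (K : FiniteField) where
  open FiniteField K public
  open PowerSeries isCommutativeRing public
  open AS public using (_:+_; _:*_; _:=_)

  _≟_ : DecidableEquality Carrier
  x ≟ y = unique⇒dec elements-unique (elements-complete x) (elements-complete y)

  1≢0 : 1# ≢ 0#
  1≢0 e = 0≢1 (sym e)

  no-zero-divisors : ∀ {x y} → x * y ≡ 0# → x ≢ 0# → y ≡ 0#
  no-zero-divisors {x} {y} e x≢0 = begin
    y              ≡⟨ sym (*-identityˡ y) ⟩
    1# * y         ≡⟨ cong (_* y) (sym (⁻¹-inverse x x≢0)) ⟩
    (x ⁻¹ * x) * y ≡⟨ *-assoc _ _ _ ⟩
    x ⁻¹ * (x * y) ≡⟨ cong (x ⁻¹ *_) e ⟩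
    x ⁻¹ * 0#      ≡⟨ zeroʳ _ ⟩
    0# ∎
    where open ≡-Reasoning

  *-nonzero : ∀ {x y} → x ≢ 0# → y ≢ 0# → x * y ≢ 0#
  *-nonzero x≢0 y≢0 e = y≢0 (no-zero-divisors e x≢0)

  factorˡ-nonzero : ∀ {x y} → x * y ≢ 0# → x ≢ 0#
  factorˡ-nonzero {y = y} ne e = ne (trans (cong (_* y) e) (zeroˡ y))

  factorʳ-nonzero : ∀ {x y} → x * y ≢ 0# → y ≢ 0#
  factorʳ-nonzero {x} ne e = ne (trans (cong (x *_) e) (zeroʳ x))

  *≡1⇒nonzero : ∀ {x y} → x * y ≡ 1# → x ≢ 0#
  *≡1⇒nonzero e = factorˡ-nonzero λ z → 1≢0 (trans (sym e) z)

  ⁻¹-nonzero : ∀ {x} → x ≢ 0# → x ⁻¹ ≢ 0#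
  ⁻¹-nonzero {x} x≢0 = *≡1⇒nonzero (⁻¹-inverse x x≢0)

  *-cancelˡ-nonzero : ∀ {x y z} → x ≢ 0# → x * y ≡ x * z → y ≡ z
  *-cancelˡ-nonzero {x} {y} {z} x≢0 e = x∙y⁻¹≈ε⇒x≈y y z (no-zero-divisors
    (trans (distribˡ x y (- z)) (trans (cong (x * y +_) (sym (-‿distribʳ-* x z))) (trans (cong (_+ - (x * z)) e) (-‿inverseʳ _)))) x≢0)

  -- Below n f: the series f is a polynomial of degree less than n.
  Below : ℕ → Ser → Set
  Below n f = ∀ k → n ≤ k → f k ≡ 0#

  Monic : ℕ → Ser → Set
  Monic n f = f n ≡ 1# × Below (suc n) f

  below-mono : ∀ {m n f} → m ≤ n → Below m f → Below n f
  below-mono m≤n b k n≤k = b k (ℕ.≤-trans m≤n n≤k)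

  below-resp : ∀ {n f g} → f ≈ g → Below n f → Below n g
  below-resp e b k le = trans (sym (e k)) (b k le)

  monic-resp : ∀ {n f g} → f ≈ g → Monic n f → Monic n g
  monic-resp e (t , b) = trans (sym (e _)) t , below-resp e b

  below0 : ∀ {f} → Below 0 f → f ≈ 𝟘
  below0 b k = b k z≤n

  monic0 : ∀ {f} → Monic 0 f → f ≈ 𝟙
  monic0 (t , b) zero = t
  monic0 (t , b) (suc k) = b (suc k) (s≤s z≤n)

  below-tl : ∀ {n f} → Below (suc n) f → Below n (tl f)
  below-tl b k le = b (suc k) (s≤s le)

  below-⊛ : ∀ m {n f g} → Below m f → Below (suc n) g → Below (m ℕ.+ n) (f ⊛ g)
  below-⊛ zero {g = g} bf bg k _ = trans (⊛-cong {g = g} (below0 bf) ≈-refl k) (𝟘-⊛ g k)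
  below-⊛ (suc m) {f = f} {g} bf bg (suc k) (s≤s le) = trans (cong₂ _+_
    (trans (cong (f 0 *_) (bg (suc k) (s≤s (ℕ.≤-trans (ℕ.m≤n+m _ m) le)))) (zeroʳ _))
    (below-⊛ m (below-tl bf) bg k le)) (+-identityˡ _)

  ⊛-top : ∀ m {n f g} → Below (suc m) f → Below (suc n) g → (f ⊛ g) (m ℕ.+ n) ≡ f m * g n
  ⊛-top zero {n} {f} {g} bf bg = trans (⊛-cong {f′ = con (f 0)} {g = g} (λ { zero → refl ; (suc k) → bf (suc k) (s≤s z≤n) }) ≈-refl n) (con-⊛ (f 0) g n)
  ⊛-top (suc m) {n} {f} {g} bf bg = trans (cong₂ _+_
    (trans (cong (f 0 *_) (bg (suc (m ℕ.+ n)) (s≤s (ℕ.m≤n+m n m)))) (zeroʳ _)) (⊛-top m (below-tl bf) bg)) (+-identityˡ _)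

  monic-⊛ : ∀ {m n f g} → Monic m f → Monic n g → Monic (m ℕ.+ n) (f ⊛ g)
  monic-⊛ {m} (t , b) (t′ , b′) = trans (⊛-top m b b′) (trans (cong₂ _*_ t t′) (*-identityˡ 1#)) , below-⊛ (suc m) b b′

  Poly : Ser → Set
  Poly f = ∃[ n ] Below n f

  poly-⊕ : ∀ {f g} → Poly f → Poly g → Poly (f ⊕ g)
  poly-⊕ (m , b) (n , c) = m ℕ.⊔ n , λ k le →
    trans (cong₂ _+_ (b k (ℕ.≤-trans (ℕ.m≤m⊔n m n) le)) (c k (ℕ.≤-trans (ℕ.m≤n⊔m m n) le))) (+-identityˡ _)

  poly-⊖ : ∀ {f} → Poly f → Poly (⊖ f)
  poly-⊖ (m , b) = m , λ k le → trans (cong -_ (b k le)) -0#≈0#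

  poly-· : ∀ {f} c → Poly f → Poly (c · f)
  poly-· c (m , b) = m , λ k le → trans (cong (c *_) (b k le)) (zeroʳ c)

  poly-⊛ : ∀ {f g} → Poly f → Poly g → Poly (f ⊛ g)
  poly-⊛ {f} {g} (m , b) (n , c) = m ℕ.+ n , below-⊛ m b (below-mono (ℕ.n≤1+n n) c)

  monic⇒poly : ∀ {n f} → Monic n f → Poly f
  monic⇒poly {n} (_ , b) = suc n , b

  X^-monic : ∀ n → Monic n (X^ n)
  X^-monic n = trans (cong (X^ n) (sym (ℕ.+-identityʳ n))) (shift-+ n 𝟙 0) ,
    λ k n<k → trans (shift-≥ n 𝟙 k (ℕ.<⇒≤ n<k)) (𝟙-pos (ℕ.m<n⇒0<n∸m n<k))
    where
    𝟙-pos : ∀ {j} → 0 < j → 𝟙 j ≡ 0#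
    𝟙-pos (s≤s _) = refl

  -- Long division by induction on the number of coefficients: subtracting a multiple of x^(N-d) P
  -- clears the top one.
  divide : ∀ {d P} → Monic d P → ∀ N {f} → Below N f → ∃[ s ] ∃[ r ] (Poly s × Below d r × f ≈ s ⊛ P ⊕ r)
  divide {d} {P} mP N {f} b with N ℕ.≤? d
  ... | yes N≤d = 𝟘 , f , (0 , λ _ _ → refl) , below-mono N≤d b , λ n → sym (trans (cong (_+ f n) (𝟘-⊛ P n)) (+-identityˡ _))
  divide {d} {P} mP zero {f} b | no N≰d = ⊥-elim (N≰d z≤n)
  divide {d} {P} mP (suc N) {f} b | no N≰d =
      let s , r , ps , br , e = divide mP N b′ in
      s ⊕ c · X^ e′ , r , poly-⊕ ps (poly-· c (monic⇒poly (X^-monic e′))) , br , λ n → begin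
        f n ≡⟨ split (f n) ((c · T) n) ⟩
        f′ n + (c · T) n ≡⟨ cong (_+ (c · T) n) (e n) ⟩
        (s ⊛ P) n + r n + (c · T) n ≡⟨ AS.solve 3 (λ x y z → (x :+ y) :+ z := (x :+ z) :+ y) refl _ _ _ ⟩
        (s ⊛ P) n + (c · T) n + r n ≡⟨ cong (λ z → (s ⊛ P) n + z + r n) (sym (·-⊛ c (X^ e′) P n)) ⟩
        (s ⊛ P) n + ((c · X^ e′) ⊛ P) n + r n ≡⟨ cong (_+ r n) (sym (⊛-distribʳ P s (c · X^ e′) n)) ⟩
        ((s ⊕ c · X^ e′) ⊛ P) n + r n ∎
    where
    open ≡-Reasoning
    d≤N : d ≤ N
    d≤N = ℕ.<⇒≤pred (ℕ.≰⇒> N≰d)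
    e′ : ℕ
    e′ = N ℕ.∸ d
    c : Carrier
    c = f N
    T f′ : Ser
    T = X^ e′ ⊛ P
    f′ = f ⊕ ⊖ (c · T)
    split : ∀ x y → x ≡ x + - y + y
    split x y = sym (trans (+-assoc x (- y) y) (trans (cong (x +_) (-‿inverseˡ y)) (+-identityʳ x)))
    mT : Monic N T
    mT = subst (λ n → Monic n T) (ℕ.m∸n+n≡m d≤N) (monic-⊛ (X^-monic e′) mP)
    b′ : Below N f′
    b′ k N≤k with k ℕ.≟ N
    ... | yes refl = trans (cong (λ z → f N + - (f N * z)) (proj₁ mT)) (trans (cong (λ z → f N + - z) (*-identityʳ _)) (-‿inverseʳ _))
    ... | no k≢N = trans (cong₂ (λ x y → x + - (f N * y)) (b k N<k) (proj₂ mT k N<k))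
        (trans (+-identityˡ _) (trans (cong -_ (zeroʳ _)) -0#≈0#))
      where
      N<k : N < k
      N<k = ℕ.≤∧≢⇒< N≤k (λ e → k≢N (sym e))

  normalise : ∀ d {r} → Below d r → r ≈ 𝟘 ⊎ ∃[ m ] ∃[ c ] ∃[ u ] (m < d × c ≢ 0# × Monic m u × r ≈ c · u)
  normalise zero b = inj₁ (below0 b)
  normalise (suc d) {r} b with r d ≟ 0#
  ... | no c≢0 = inj₂ (d , r d , r d ⁻¹ · r , ℕ.≤-refl , c≢0 ,
      (⁻¹-inverse _ c≢0 , λ k le → trans (cong (r d ⁻¹ *_) (b k le)) (zeroʳ _)) ,
      λ n → sym (trans (sym (*-assoc _ _ _)) (trans (cong (_* r n) (trans (*-comm _ _) (⁻¹-inverse _ c≢0))) (*-identityˡ _))))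
  ... | yes c≡0 with normalise d {r} (λ k d≤k → low k d≤k)
    where
    low : Below d r
    low k d≤k with k ℕ.≟ d
    ... | yes refl = c≡0
    ... | no k≢d = b k (ℕ.≤∧≢⇒< d≤k (λ e → k≢d (sym e)))
  ...   | inj₁ z = inj₁ z
  ...   | inj₂ (m , c , u , m<d , rest) = inj₂ (m , c , u , ℕ.m≤n⇒m≤1+n m<d , rest)

  -- Write h = c u with u monic. Then P u is monic of degree d + m, and comparing leading terms with
  -- f forces d + m = n and c = 1.
  monic-quotient : ∀ {n d P f h} → Monic d P → Monic n f → Poly h → P ⊛ h ≈ f → ∃[ m ] (Monic m h × d ℕ.+ m ≡ n)
  monic-quotient {n} {d} {P} {f} {h} mP mf (N , b) e with normalise N b
  ... | inj₁ z = ⊥-elim (1≢0 (trans (sym (proj₁ mf)) (trans (sym (e n)) (trans (⊛-comm P h n) (trans (⊛-cong {g = P} z ≈-refl n) (𝟘-⊛ P n))))))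
  ... | inj₂ (m , c , u , _ , c≢0 , mu , eq) = compare (ℕ.<-cmp (d ℕ.+ m) n)
    where
    mPu : Monic (d ℕ.+ m) (P ⊛ u)
    mPu = monic-⊛ mP mu
    pt : ∀ k → c * (P ⊛ u) k ≡ f k
    pt k = trans (sym (·-⊛ʳ c P u k)) (trans (⊛-cong {f = P} ≈-refl (≈-sym eq) k) (e k))
    c≡f : c ≡ f (d ℕ.+ m)
    c≡f = trans (sym (*-identityʳ c)) (trans (cong (c *_) (sym (proj₁ mPu))) (pt (d ℕ.+ m)))
    compare : Tri (d ℕ.+ m < n) (d ℕ.+ m ≡ n) (n < d ℕ.+ m) → ∃[ m ] (Monic m h × d ℕ.+ m ≡ n)
    compare (tri≈ _ refl _) = m , monic-resp (λ k → trans (sym (*-identityˡ _)) (trans (cong (_* u k) (sym (trans c≡f (proj₁ mf)))) (sym (eq k)))) mu , refl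
    compare (tri< lt _ _) = ⊥-elim (1≢0 (trans (sym (proj₁ mf)) (trans (sym (pt n)) (trans (cong (c *_) (proj₂ mPu n lt)) (zeroʳ c)))))
    compare (tri> _ _ gt) = ⊥-elim (c≢0 (trans c≡f (proj₂ mf _ gt)))

  -- Divisibility of polynomials and Euclid's lemma

  Div : Ser → Ser → Set
  Div P f = ∃[ h ] (Poly h × P ⊛ h ≈ f)

  div-resp : ∀ {P f g} → f ≈ g → Div P f → Div P g
  div-resp e (h , p , q) = h , p , ≈-trans q e

  div-remainder : ∀ {P h k c w} → Poly h → Poly k → c ≢ 0# → P ⊛ h ≈ P ⊛ k ⊕ c · w → Div P w
  div-remainder {P} {h} {k} {c} {w} ph pk c≢0 e = c ⁻¹ · (h ⊕ ⊖ k) , poly-· (c ⁻¹) (poly-⊕ ph (poly-⊖ pk)) , λ n → begin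
    (P ⊛ (c ⁻¹ · (h ⊕ ⊖ k))) n ≡⟨ ·-⊛ʳ (c ⁻¹) P (h ⊕ ⊖ k) n ⟩
    c ⁻¹ * (P ⊛ (h ⊕ ⊖ k)) n ≡⟨ cong (c ⁻¹ *_) (trans (⊛-distribˡ P h (⊖ k) n) (cong₂ _+_ (e n) (sym (SerRingProps.-‿distribʳ-* P k n)))) ⟩
    c ⁻¹ * ((P ⊛ k) n + c * w n + - (P ⊛ k) n) ≡⟨ cong (c ⁻¹ *_) (trans (cong (_+ - (P ⊛ k) n) (+-comm _ _)) (trans (+-assoc _ _ _) (trans (cong (c * w n +_) (-‿inverseʳ _)) (+-identityʳ _)))) ⟩
    c ⁻¹ * (c * w n) ≡⟨ trans (sym (*-assoc _ _ _)) (cong (_* w n) (⁻¹-inverse c c≢0)) ⟩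
    1# * w n ≡⟨ *-identityˡ _ ⟩
    w n ∎
    where open ≡-Reasoning

  IrrSeries : ℕ → Ser → Set
  IrrSeries d P = 1 ≤ d × Monic d P × (∀ {a b u v} → Monic a u → Monic b v → u ⊛ v ≈ P → a ≡ 0 ⊎ b ≡ 0)

  -- Euclid's algorithm: u is replaced by the remainder of u modulo P, or of P modulo u.
  euclid-series : ∀ {d P} → IrrSeries d P → ∀ {g} → Poly g → ∀ {m u} → Monic m u → Div P (u ⊛ g) → Div P u ⊎ Div P g
  euclid-series {d} {P} (1≤d , mP , irr) {g} pg {m} mu = go (<-wellFounded m) mu
    where
    go : ∀ {m u} → Acc _<_ m → Monic m u → Div P (u ⊛ g) → Div P u ⊎ Div P g
    go {zero} {u} _ mu D = inj₂ (div-resp (≈-trans (⊛-cong {g = g} (monic0 mu) ≈-refl) (⊛-identityˡ g)) D)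
    go {suc m} {u} (acc rec) mu (h , ph , e) with d ℕ.≤? suc m
    ... | yes d≤m with divide mP (suc (suc m)) (proj₂ mu)
    ...   | s , r , ps , br , eq with normalise d br
    ...     | inj₁ z = inj₁ (s , ps , λ n → trans (⊛-comm P s n) (sym (trans (eq n) (trans (cong ((s ⊛ P) n +_) (z n)) (+-identityʳ _)))))
    ...     | inj₂ (m′ , c , v , m′<d , c≢0 , mv , rv) with go (rec (ℕ.<-≤-trans m′<d d≤m)) mv
                (div-remainder {k = s ⊛ g} {w = v ⊛ g} ph (poly-⊛ ps pg) c≢0 (≈-trans e (≈-trans (⊛-cong {g = g} (≈-trans eq (⊕-cong {x = s ⊛ P} ≈-refl rv)) ≈-refl)
                  (≈-trans (⊛-distribʳ g (s ⊛ P) (c · v)) (⊕-cong (SS.solve 3 (λ s p g → (s SS.:* p) SS.:* g SS.:= p SS.:* (s SS.:* g)) ≈-refl s P g) (·-⊛ c v g))))))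
    ...       | inj₂ D = inj₂ D
    ...       | inj₁ (k , pk , ek) = inj₁ (s ⊕ c · k , poly-⊕ ps (poly-· c pk) , λ n → trans (⊛-distribˡ P s (c · k) n)
                (trans (cong₂ _+_ (⊛-comm P s n) (trans (·-⊛ʳ c P k n) (cong (c *_) (ek n)))) (sym (trans (eq n) (cong ((s ⊛ P) n +_) (rv n))))))
    go {suc m} {u} (acc rec) mu (h , ph , e) | no d≰m with divide mu (suc d) (proj₂ mP)
    ...   | s , r , ps , br , eq with normalise (suc m) br
    -- Here u divides P, so irreducibility makes the cofactor constant and deg u = d, against deg u
    -- < d.
    ...     | inj₁ z with monic-quotient mu mP ps (λ n → trans (⊛-comm u s n) (sym (trans (eq n) (trans (cong ((s ⊛ u) n +_) (z n)) (+-identityʳ _)))))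
    ...       | j , ms , sum with irr mu ms (λ n → trans (⊛-comm u s n) (sym (trans (eq n) (trans (cong ((s ⊛ u) n +_) (z n)) (+-identityʳ _)))))
    ...         | inj₂ refl = ⊥-elim (d≰m (ℕ.≤-reflexive (trans (sym sum) (ℕ.+-identityʳ (suc m)))))
    -- From P = s u + c v it follows that c v g = P g - s u g is again divisible by P.
    go {suc m} {u} (acc rec) mu (h , ph , e) | no d≰m
          | s , r , ps , br , eq | inj₂ (m′ , c , v , m′<m , c≢0 , mv , rv) with go (rec m′<m) mv
                (div-remainder {h = g} {k = s ⊛ h} {w = v ⊛ g} pg (poly-⊛ ps ph) c≢0 (≈-trans (⊛-cong {g = g} (≈-trans eq (⊕-cong {x = s ⊛ u} ≈-refl rv)) ≈-refl)
                  (≈-trans (⊛-distribʳ g (s ⊛ u) (c · v)) (⊕-cong (≈-trans (⊛-assoc s u g) (≈-trans (⊛-cong {f = s} ≈-refl (≈-sym e))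
                    (SS.solve 3 (λ s p h → s SS.:* (p SS.:* h) SS.:= p SS.:* (s SS.:* h)) ≈-refl s P h))) (·-⊛ c v g)))))
    ...       | inj₂ D = inj₂ D
    -- P cannot divide v, whose degree is below that of u and hence below d.
    ...       | inj₁ (k , pk , ek) = let j , _ , sum = monic-quotient mP mv pk ek in
                ⊥-elim (d≰m (ℕ.≤-trans (ℕ.≤-trans (ℕ.m≤m+n d j) (ℕ.≤-reflexive sum)) (ℕ.<⇒≤ m′<m)))

  -- The monic polynomial with lower coefficients as.
  mon : List Carrier → Ser
  mon [] = 𝟙
  mon (a ∷ as) = a ◂ mon as

  mon-monic : ∀ as → Monic (length as) (mon as)
  mon-monic [] = refl , λ { (suc k) _ → refl }
  mon-monic (a ∷ as) = proj₁ (mon-monic as) , λ { (suc k) (s≤s le) → proj₂ (mon-monic as) k le }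

  mon-injective : ∀ as bs → mon as ≈ mon bs → as ≡ bs
  mon-injective [] [] e = refl
  mon-injective [] (b ∷ bs) e = ⊥-elim (1≢0 (trans (sym (proj₁ (mon-monic bs))) (sym (e (suc (length bs))))))
  mon-injective (a ∷ as) [] e = ⊥-elim (1≢0 (trans (sym (proj₁ (mon-monic as))) (e (suc (length as)))))
  mon-injective (a ∷ as) (b ∷ bs) e = cong₂ _∷_ (e 0) (mon-injective as bs (λ n → e (suc n)))

  tab : ℕ → Ser → List Carrier
  tab zero f = []
  tab (suc n) f = f 0 ∷ tab n (tl f)

  length-tab : ∀ n f → length (tab n f) ≡ n
  length-tab zero f = refl
  length-tab (suc n) f = cong suc (length-tab n (tl f))

  mon-tab : ∀ n {f} → Monic n f → mon (tab n f) ≈ f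
  mon-tab zero m = ≈-sym (monic0 m)
  mon-tab (suc n) (t , b) zero = refl
  mon-tab (suc n) (t , b) (suc k) = mon-tab n (t , below-tl b) k

module ListCount (K : FiniteField) where
  open FieldSeries K

  count-all : HasCount {Carrier} (λ _ → 1# ≡ 1#) card
  count-all = elements , (elements-unique , λ x → (λ _ → refl) , (λ _ → elements-complete x)) , refl

  count-lists : ∀ m → HasCount {List Carrier} (λ w → length w ≡ m) (card ℕ.^ m)
  count-lists zero = count-one [] refl λ { [] _ → refl }
  count-lists (suc m) = count-map (λ (a , w) → a ∷ w) (count-Σ count-all (λ _ _ → count-lists m))
    (λ (a , w) (_ , l) → cong suc l) (λ { _ _ refl → refl }) (λ { (a ∷ w) refl → (a , w) , (refl , refl) , refl })

  count-nonzero : ∃[ k ] (HasCount {Carrier} (_≢ 0#) k × card ≡ suc k)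
  count-nonzero with count-filter (λ x → ¬? (x ≟ 0#)) count-all
  ... | k , c = k , count-resp (λ _ → proj₂) (λ _ p → refl , p) c ,
    count-split (_≟ 0#) count-all (count-one 0# (refl , refl) (λ _ → proj₂)) c

reverse-ends : {A : Set} (x y : A) (ws : List A) → reverse (x ∷ (ws ++ [ y ])) ≡ y ∷ (reverse ws ++ [ x ])
reverse-ends x y ws = trans (unfold-reverse x (ws ++ [ y ])) (cong (_++ [ x ]) (reverse-++ ws [ y ]))

record Involution (K : FiniteField) : Set where
  open FiniteField K
  field
    σ : Carrier → Carrier
    σ-+ : ∀ x y → σ (x + y) ≡ σ x + σ y
    σ-* : ∀ x y → σ (x * y) ≡ σ x * σ y
    σ-1 : σ 1# ≡ 1#
    σ-involutive : ∀ x → σ (σ x) ≡ x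

-- Monic polynomials with nonzero constant term and the twisted dual

module MonicMonoid (K : FiniteField) (I : Involution K) where
  open FieldSeries K
  open ListCount K
  open Involution I

  σ-0 : σ 0# ≡ 0#
  σ-0 = +-cancelˡ (σ 0#) (σ 0#) 0# (trans (sym (σ-+ 0# 0#)) (trans (cong σ (+-identityˡ 0#)) (sym (+-identityʳ (σ 0#)))))

  σ-nonzero : ∀ {x} → x ≢ 0# → σ x ≢ 0#
  σ-nonzero {x} x≢0 e = x≢0 (trans (sym (σ-involutive x)) (trans (cong σ e) σ-0))

  σˢ : Ser → Ser
  σˢ f n = σ (f n)

  σˢ-⊛ : ∀ f g → σˢ (f ⊛ g) ≈ σˢ f ⊛ σˢ g
  σˢ-⊛ f g zero = σ-* _ _
  σˢ-⊛ f g (suc n) = trans (σ-+ _ _) (cong₂ _+_ (σ-* _ _) (σˢ-⊛ (tl f) g n))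

  -- rv n f is x^(n-1) f(1/x), for f of degree less than n.
  rv : ℕ → Ser → Ser
  rv zero f = 𝟘
  rv (suc n) f = f 0 · X^ n ⊕ rv n (tl f)

  rv-cong : ∀ n {f g} → f ≈ g → rv n f ≈ rv n g
  rv-cong zero e k = refl
  rv-cong (suc n) e k = cong₂ (λ x y → x * X^ n k + y) (e 0) (rv-cong n (λ j → e (suc j)) k)

  rv-𝟘 : ∀ n → rv n 𝟘 ≈ 𝟘
  rv-𝟘 zero k = refl
  rv-𝟘 (suc n) k = trans (cong₂ _+_ (zeroˡ _) (rv-𝟘 n k)) (+-identityˡ _)

  rv-⊕ : ∀ n f g → rv n (f ⊕ g) ≈ rv n f ⊕ rv n g
  rv-⊕ zero f g k = sym (+-identityˡ _)
  rv-⊕ (suc n) f g k = trans (cong ((f 0 + g 0) * X^ n k +_) (rv-⊕ n (tl f) (tl g) k))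
    (AS.solve 5 (λ a b x y z → ((a :+ b) :* x) :+ (y :+ z) := (a :* x :+ y) :+ (b :* x :+ z)) refl (f 0) (g 0) _ _ _)

  rv-· : ∀ n c f → rv n (c · f) ≈ c · rv n f
  rv-· zero c f k = sym (zeroʳ c)
  rv-· (suc n) c f k = trans (cong₂ _+_ (*-assoc _ _ _) (rv-· n c (tl f) k)) (sym (distribˡ _ _ _))

  rv-below : ∀ n f → Below n (rv n f)
  rv-below zero f k _ = refl
  rv-below (suc n) f k n<k = trans (cong₂ _+_ (trans (cong (f 0 *_) (proj₂ (X^-monic n) k n<k)) (zeroʳ _)) (rv-below n (tl f) k (ℕ.<⇒≤ n<k))) (+-identityˡ _)

  rv-coeff : ∀ n f i → i ≤ n → rv (suc n) f i ≡ f (n ℕ.∸ i)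
  rv-coeff zero f zero z≤n = trans (+-identityʳ _) (*-identityʳ _)
  rv-coeff (suc n) f i i≤n with i ℕ.≤? n
  ... | yes i≤n′ = trans (cong₂ _+_ (trans (cong (f 0 *_) (shift-< (suc n) 𝟙 i (s≤s i≤n′))) (zeroʳ _)) (rv-coeff n (tl f) i i≤n′))
      (trans (+-identityˡ _) (cong f (sym (ℕ.+-∸-assoc 1 i≤n′))))
  ... | no i≰n with ℕ.≤-antisym i≤n (ℕ.≰⇒> i≰n)
  ...   | refl = trans (cong₂ _+_ (trans (cong (f 0 *_) (proj₁ (X^-monic (suc n)))) (*-identityʳ _)) (rv-below (suc n) (tl f) (suc n) ℕ.≤-refl))
      (trans (+-identityʳ _) (cong f (sym (ℕ.n∸n≡0 n))))

  rv-pad : ∀ k n {g} → Below n g → rv (k ℕ.+ n) g ≈ X^ k ⊛ rv n g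
  rv-pad k zero {g} b = ≈-trans (rv-cong (k ℕ.+ 0) (below0 b)) (≈-trans (rv-𝟘 (k ℕ.+ 0)) (λ n → sym (trans (⊛-comm (X^ k) 𝟘 n) (𝟘-⊛ (X^ k) n))))
  rv-pad k (suc n) {g} b = subst (λ m → rv m g ≈ X^ k ⊛ rv (suc n) g) (sym (ℕ.+-suc k n)) λ j → begin
    g 0 * X^ (k ℕ.+ n) j + rv (k ℕ.+ n) (tl g) j ≡⟨ cong₂ (λ x y → g 0 * x + y) (X^-+ k n j) (rv-pad k n (below-tl b) j) ⟩
    g 0 * (X^ k ⊛ X^ n) j + (X^ k ⊛ rv n (tl g)) j ≡⟨ cong (_+ (X^ k ⊛ rv n (tl g)) j) (sym (·-⊛ʳ (g 0) (X^ k) (X^ n) j)) ⟩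
    (X^ k ⊛ (g 0 · X^ n)) j + (X^ k ⊛ rv n (tl g)) j ≡⟨ sym (⊛-distribˡ (X^ k) (g 0 · X^ n) (rv n (tl g)) j) ⟩
    (X^ k ⊛ rv (suc n) g) j ∎
    where open ≡-Reasoning

  -- Reversal is multiplicative because x^(a+b) (F G)(1/x) = x^a F(1/x) · x^b G(1/x). The argument
  -- of `rv` counts coefficients, not the degree: m and n + 1 of them give m + n for the product.
  rv-⊛ : ∀ m {n f g} → Below m f → Below (suc n) g → rv (m ℕ.+ n) (f ⊛ g) ≈ rv m f ⊛ rv (suc n) g
  rv-⊛ zero {n} {f} {g} bf bg = ≈-trans (rv-cong n (≈-trans (⊛-cong {g = g} (below0 bf) ≈-refl) (𝟘-⊛ g)))
    (≈-trans (rv-𝟘 n) (≈-sym (𝟘-⊛ (rv (suc n) g))))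
  rv-⊛ (suc m) {n} {f} {g} bf bg k = begin
    f 0 * g 0 * X^ (m ℕ.+ n) k + rv (m ℕ.+ n) (f 0 · tl g ⊕ tl f ⊛ g) k
      ≡⟨ cong (f 0 * g 0 * X^ (m ℕ.+ n) k +_) (trans (rv-⊕ (m ℕ.+ n) (f 0 · tl g) (tl f ⊛ g) k)
           (cong₂ _+_ (rv-· (m ℕ.+ n) (f 0) (tl g) k) (rv-⊛ m (below-tl bf) bg k))) ⟩
    f 0 * g 0 * X^ (m ℕ.+ n) k + (f 0 * rv (m ℕ.+ n) (tl g) k + (rv m (tl f) ⊛ rv (suc n) g) k)
      ≡⟨ AS.solve 5 (λ a b x y z → ((a :* b) :* x) :+ (a :* y :+ z) := (a :* (b :* x :+ y)) :+ z) refl (f 0) (g 0) _ _ _ ⟩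
    f 0 * rv (suc (m ℕ.+ n)) g k + (rv m (tl f) ⊛ rv (suc n) g) k
      ≡⟨ cong (λ z → f 0 * z + (rv m (tl f) ⊛ rv (suc n) g) k) (trans (cong (λ j → rv j g k) (sym (ℕ.+-suc m n))) (rv-pad m (suc n) bg k)) ⟩
    f 0 * (X^ m ⊛ rv (suc n) g) k + (rv m (tl f) ⊛ rv (suc n) g) k
      ≡⟨ cong (_+ (rv m (tl f) ⊛ rv (suc n) g) k) (sym (·-⊛ (f 0) (X^ m) (rv (suc n) g) k)) ⟩
    ((f 0 · X^ m) ⊛ rv (suc n) g) k + (rv m (tl f) ⊛ rv (suc n) g) k
      ≡⟨ sym (⊛-distribʳ (rv (suc n) g) (f 0 · X^ m) (rv m (tl f)) k) ⟩
    (rv (suc m) f ⊛ rv (suc n) g) k ∎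
    where open ≡-Reasoning

  rv-σ : ∀ n f → rv n (σˢ f) ≈ σˢ (rv n f)
  rv-σ zero f k = sym σ-0
  rv-σ (suc n) f k = sym (trans (σ-+ _ _) (cong₂ _+_ (trans (σ-* _ _) (cong (σ (f 0) *_) (σ-X n k))) (sym (rv-σ n (tl f) k))))
    where
    σ-X : ∀ n k → σ (X^ n k) ≡ X^ n k
    σ-X zero zero = σ-1
    σ-X zero (suc k) = σ-0
    σ-X (suc n) zero = σ-0
    σ-X (suc n) (suc k) = σ-X n k

  rv-involutive : ∀ n {f} → Below (suc n) f → rv (suc n) (rv (suc n) f) ≈ f
  rv-involutive n {f} b k with k ℕ.≤? n
  ... | yes k≤n = trans (rv-coeff n (rv (suc n) f) k k≤n) (trans (rv-coeff n f (n ℕ.∸ k) (ℕ.m∸n≤m n k)) (cong f (ℕ.m∸[m∸n]≡n k≤n)))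
  ... | no k≰n = trans (rv-below (suc n) (rv (suc n) f) k (ℕ.≰⇒> k≰n)) (sym (b k (ℕ.≰⇒> k≰n)))

  -- The condition on the constant term is irrelevant, so elements with the same coefficient list
  -- are equal; decidability of the condition recovers a proof where one is wanted.
  record Mon : Set where
    constructor mk
    field
      body : List Carrier
      .const≢0 : mon body 0 ≢ 0#
  open Mon using (body)

  S : Mon → Ser
  S f = mon (body f)

  const-nonzero : ∀ f → S f 0 ≢ 0#
  const-nonzero (mk as nz) = recompute (¬? (mon as 0 ≟ 0#)) nz

  body-injective : ∀ {f g} → body f ≡ body g → f ≡ g
  body-injective {mk _ _} {mk _ _} refl = refl

  S-injective : ∀ {f g} → S f ≈ S g → f ≡ g
  S-injective {f} {g} e = body-injective (mon-injective (body f) (body g) e)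

  -- Junk value one when the constant term vanishes.
  fromBody : List Carrier → Mon
  fromBody w with mon w 0 ≟ 0#
  ... | yes _ = mk [] 1≢0
  ... | no nz = mk w nz

  body-fromBody : ∀ {w} → mon w 0 ≢ 0# → body (fromBody w) ≡ w
  body-fromBody {w} nz with mon w 0 ≟ 0#
  ... | yes z = ⊥-elim (nz z)
  ... | no _ = refl

  deg : Mon → ℕ
  deg f = length (body f)

  S-monic : ∀ f → Monic (deg f) (S f)
  S-monic f = mon-monic (body f)

  fromSeries : ∀ n s → Monic n s → s 0 ≢ 0# → Mon
  fromSeries n s m nz = mk (tab n s) λ e → nz (trans (sym (mon-tab n m 0)) e)

  S-fromSeries : ∀ n {s} (m : Monic n s) (nz : s 0 ≢ 0#) → S (fromSeries n s m nz) ≈ s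
  S-fromSeries n m nz = mon-tab n m

  _∙_ : Mon → Mon → Mon
  f ∙ g = fromSeries (deg f ℕ.+ deg g) (S f ⊛ S g) (monic-⊛ (S-monic f) (S-monic g)) (*-nonzero (const-nonzero f) (const-nonzero g))

  S-∙ : ∀ f g → S (f ∙ g) ≈ S f ⊛ S g
  S-∙ f g = S-fromSeries (deg f ℕ.+ deg g) (monic-⊛ (S-monic f) (S-monic g)) (*-nonzero (const-nonzero f) (const-nonzero g))

  one : Mon
  one = mk [] 1≢0

  deg-∙ : ∀ f g → deg (f ∙ g) ≡ deg f ℕ.+ deg g
  deg-∙ f g = length-tab (deg f ℕ.+ deg g) (S f ⊛ S g)

  deg≡0⇒one : ∀ f → deg f ≡ 0 → f ≡ one
  deg≡0⇒one (mk [] _) _ = refl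

  ∙-comm : ∀ f g → f ∙ g ≡ g ∙ f
  ∙-comm f g = S-injective (≈-trans (S-∙ f g) (≈-trans (⊛-comm (S f) (S g)) (≈-sym (S-∙ g f))))

  ∙-assoc : ∀ f g h → (f ∙ g) ∙ h ≡ f ∙ (g ∙ h)
  ∙-assoc f g h = S-injective (≈-trans (S-∙ (f ∙ g) h) (≈-trans (⊛-cong {g = S h} (S-∙ f g) ≈-refl) (≈-trans (⊛-assoc (S f) (S g) (S h))
    (≈-sym (≈-trans (S-∙ f (g ∙ h)) (⊛-cong {f = S f} ≈-refl (S-∙ g h)))))))

  ∙-identityʳ : ∀ f → f ∙ one ≡ f
  ∙-identityʳ f = S-injective (≈-trans (S-∙ f one) (⊛-identityʳ (S f)))

  ∙-cancelˡ : ∀ f {g h} → f ∙ g ≡ f ∙ h → g ≡ h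
  ∙-cancelˡ f {g} {h} e = S-injective (⊛-cancelʳ {f = S f} (⁻¹-inverse _ (const-nonzero f))
    (≈-trans (⊛-comm (S g) (S f)) (≈-trans (≈-sym (S-∙ f g)) (≈-trans (λ n → cong (λ z → S z n) e) (≈-trans (S-∙ f h) (⊛-comm (S f) (S h)))))))

  Mon-≟ : DecidableEquality Mon
  Mon-≟ f g = map′ body-injective (cong body) (≡-dec _≟_ (body f) (body g))

  ∷-pair : ∀ {a b : Carrier} {v w : List Carrier} → a ∷ v ≡ b ∷ w → (a , v) ≡ (b , w)
  ∷-pair refl = refl

  size : ℕ → ℕ
  size zero = 1
  size (suc m) = proj₁ count-nonzero ℕ.* card ℕ.^ m

  level : ∀ m → HasCount (λ f → deg f ≡ m) (size m)
  level zero = count-one one refl deg≡0⇒one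
  level (suc m) = count-map (λ (a , w) → fromBody (a ∷ w)) (count-Σ (proj₁ (proj₂ count-nonzero)) (λ _ _ → count-lists m))
    (λ (a , w) (nz , l) → trans (cong length (body-fromBody nz)) (cong suc l))
    (λ (nz , _) (nz′ , _) e → ∷-pair (trans (sym (body-fromBody nz)) (trans (cong body e) (body-fromBody nz′))))
    (λ { f@(mk (a ∷ w) _) refl → (a , w) , (const-nonzero f , refl) , body-injective (body-fromBody (const-nonzero f)) })

  dualScale : Mon → Carrier
  dualScale f = σ (S f 0) ⁻¹

  dualSeries : Mon → Ser
  dualSeries f = dualScale f · σˢ (rv (suc (deg f)) (S f))

  dual-monic : ∀ f → Monic (deg f) (dualSeries f)
  dual-monic f = trans (cong (λ z → dualScale f * σ z) (trans (rv-coeff (deg f) (S f) (deg f) ℕ.≤-refl) (cong (S f) (ℕ.n∸n≡0 (deg f)))))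
      (⁻¹-inverse _ (σ-nonzero (const-nonzero f))) ,
    λ k le → trans (cong (dualScale f *_) (trans (cong σ (rv-below (suc (deg f)) (S f) k le)) σ-0)) (zeroʳ _)

  dual-const : ∀ f → dualSeries f 0 ≡ dualScale f
  dual-const f = trans (cong (λ z → dualScale f * σ z) (trans (rv-coeff (deg f) (S f) 0 z≤n) (proj₁ (S-monic f))))
    (trans (cong (dualScale f *_) σ-1) (*-identityʳ _))

  dual-nonzero : ∀ f → dualSeries f 0 ≢ 0#
  dual-nonzero f e = ⁻¹-nonzero (σ-nonzero (const-nonzero f)) (trans (sym (dual-const f)) e)

  _~ : Mon → Mon
  f ~ = fromSeries (deg f) (dualSeries f) (dual-monic f) (dual-nonzero f)

  S-~ : ∀ f → S (f ~) ≈ dualSeries f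
  S-~ f = S-fromSeries (deg f) (dual-monic f) (dual-nonzero f)

  deg-~ : ∀ f → deg (f ~) ≡ deg f
  deg-~ f = length-tab (deg f) (dualSeries f)

  -- The leading coefficient determines the scalar. The dual is thereby shown to be multiplicative
  -- and involutive without any calculation with the inverses in `dualScale`.
  monic-proportional : ∀ {n c d h} → Monic n (c · h) → Monic n (d · h) → c · h ≈ d · h
  monic-proportional {n} {c} {d} {h} (t , _) (t′ , _) k = cong (_* h k) (begin
    c ≡⟨ sym (*-identityʳ c) ⟩
    c * 1# ≡⟨ cong (c *_) (sym t′) ⟩
    c * (d * h n) ≡⟨ AS.solve 3 (λ x y z → x :* (y :* z) := y :* (x :* z)) refl c d (h n) ⟩
    d * (c * h n) ≡⟨ cong (d *_) t ⟩
    d * 1# ≡⟨ *-identityʳ d ⟩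
    d ∎)
    where open ≡-Reasoning

  ~-∙ : ∀ f g → (f ∙ g) ~ ≡ (f ~) ∙ (g ~)
  ~-∙ f g = S-injective (≈-trans (S-~ (f ∙ g)) (≈-trans (monic-proportional (dual-monic (f ∙ g)) m′) (≈-trans eq (≈-sym (≈-trans (S-∙ (f ~) (g ~)) (⊛-cong (S-~ f) (S-~ g)))))))
    where
    F G H : Ser
    F = σˢ (rv (suc (deg f)) (S f))
    G = σˢ (rv (suc (deg g)) (S g))
    H = σˢ (rv (suc (deg (f ∙ g))) (S (f ∙ g)))
    H≈ : H ≈ F ⊛ G
    H≈ k = trans (cong σ (trans (cong (λ n → rv (suc n) (S (f ∙ g)) k) (deg-∙ f g))
      (trans (rv-cong (suc (deg f ℕ.+ deg g)) (S-∙ f g) k) (rv-⊛ (suc (deg f)) (proj₂ (S-monic f)) (proj₂ (S-monic g)) k))))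
      (σˢ-⊛ (rv (suc (deg f)) (S f)) (rv (suc (deg g)) (S g)) k)
    eq : (dualScale f * dualScale g) · H ≈ dualSeries f ⊛ dualSeries g
    eq k = trans (cong (dualScale f * dualScale g *_) (H≈ k)) (trans (*-assoc _ _ _)
      (sym (trans (·-⊛ (dualScale f) F (dualScale g · G) k) (cong (dualScale f *_) (·-⊛ʳ (dualScale g) F G k)))))
    m′ : Monic (deg (f ∙ g)) ((dualScale f * dualScale g) · H)
    m′ = monic-resp (≈-sym eq) (subst (λ n → Monic n (dualSeries f ⊛ dualSeries g)) (sym (deg-∙ f g)) (monic-⊛ (dual-monic f) (dual-monic g)))

  ~-involutive : ∀ f → (f ~) ~ ≡ f
  ~-involutive f = S-injective (≈-trans (S-~ (f ~)) (≈-trans eq (≈-trans (monic-proportional m′ (monic-resp (≈-sym (λ k → *-identityˡ _)) (S-monic f))) (λ k → *-identityˡ _))))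
    where
    c d : Carrier
    c = dualScale f
    d = dualScale (f ~)
    n : ℕ
    n = suc (deg f)
    inner≈ : σˢ (rv (suc (deg (f ~))) (S (f ~))) ≈ σ c · S f
    inner≈ k = trans (cong σ (trans (cong (λ m → rv (suc m) (S (f ~)) k) (deg-~ f)) (trans (rv-cong n (S-~ f) k)
        (trans (rv-· n c (σˢ (rv n (S f))) k) (cong (c *_) (trans (rv-σ n (rv n (S f)) k) (cong σ (rv-involutive (deg f) (proj₂ (S-monic f)) k))))))))
      (trans (σ-* _ _) (cong (σ c *_) (σ-involutive _)))
    eq : dualSeries (f ~) ≈ (d * σ c) · S f
    eq k = trans (cong (d *_) (inner≈ k)) (sym (*-assoc _ _ _))
    m′ : Monic (deg f) ((d * σ c) · S f)
    m′ = monic-resp eq (subst (λ m → Monic m (dualSeries (f ~))) (deg-~ f) (dual-monic (f ~)))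

  Irr : Mon → Set
  Irr f = 1 ≤ deg f × (∀ g h → g ∙ h ≡ f → deg g ≡ 0 ⊎ deg h ≡ 0)

  _∣_ : Mon → Mon → Set
  f ∣ g = ∃[ h ] f ∙ h ≡ g

  -- Passing from factorisations inside the monoid to all monic ones costs nothing: the constant
  -- terms of the factors multiply to p(0), so they are nonzero.
  irr⇒irrSeries : ∀ {p} → Irr p → IrrSeries (deg p) (S p)
  irr⇒irrSeries {p} (1≤ , irr) = 1≤ , S-monic p , λ {a} {b} {u} {v} mu mv e →
    let nz = λ z → const-nonzero p (trans (sym (e 0)) z)
        mv′ = fromSeries b v mv (factorʳ-nonzero nz)
        mu′ = fromSeries a u mu (factorˡ-nonzero nz) in
    Sum.map (trans (sym (length-tab a u))) (trans (sym (length-tab b v))) (irr mu′ mv′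
      (S-injective (≈-trans (S-∙ mu′ mv′) (≈-trans (⊛-cong (mon-tab a mu) (mon-tab b mv)) e))))

  div⇒∣ : ∀ {p f} → Div (S p) (S f) → p ∣ f
  div⇒∣ {p} {f} (h , ph , e) = let m , mh , _ = monic-quotient (S-monic p) (S-monic f) ph e
                                   nz = factorʳ-nonzero λ z → const-nonzero f (trans (sym (e 0)) z) in
    fromSeries m h mh nz , S-injective (≈-trans (S-∙ p (fromSeries m h mh nz)) (≈-trans (⊛-cong {f = S p} ≈-refl (mon-tab m mh)) e))

  euclid : ∀ {p} → Irr p → ∀ f g → p ∣ (f ∙ g) → p ∣ f ⊎ p ∣ g
  euclid {p} i f g (h , e) = Sum.map (div⇒∣ {p} {f}) (div⇒∣ {p} {g}) (euclid-series (irr⇒irrSeries {p} i) (monic⇒poly (S-monic g)) (S-monic f)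
    (S h , monic⇒poly (S-monic h) , ≈-trans (≈-sym (S-∙ p h)) (≈-trans (λ n → cong (λ z → S z n) e) (S-∙ f g))))

  monoid : GradedMonoid
  monoid = record
    { M = Mon ; _≟_ = Mon-≟ ; one = one ; _∙_ = _∙_ ; ∙-comm = ∙-comm ; ∙-assoc = ∙-assoc ; ∙-identityʳ = ∙-identityʳ
    ; ∙-cancelˡ = ∙-cancelˡ ; deg = deg ; deg-∙ = deg-∙ ; deg-one = refl ; deg≡0⇒one = deg≡0⇒one
    ; size = size ; level = level ; _~ = _~ ; ~-involutive = ~-involutive ; ~-∙ = ~-∙ ; deg-~ = deg-~ ; euclid = euclid }

  -- Coefficient lists and the number of self-dual polynomials

  coeffs : List Carrier → Ser
  coeffs [] = 𝟘
  coeffs (x ∷ xs) = x ◂ coeffs xs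

  coeffs-below : ∀ xs → Below (length xs) (coeffs xs)
  coeffs-below [] k _ = refl
  coeffs-below (x ∷ xs) (suc k) (s≤s le) = coeffs-below xs k le

  -- A series does not see trailing zeros of the list; the lengths rule them out.
  coeffs-injective : ∀ xs ys → length xs ≡ length ys → coeffs xs ≈ coeffs ys → xs ≡ ys
  coeffs-injective [] [] _ _ = refl
  coeffs-injective (x ∷ xs) (y ∷ ys) l e = cong₂ _∷_ (e 0) (coeffs-injective xs ys (ℕ.suc-injective l) (λ n → e (suc n)))

  coeffs-∷ʳ : ∀ xs a → coeffs (xs ∷ʳ a) ≈ coeffs xs ⊕ a · X^ (length xs)
  coeffs-∷ʳ [] a zero = sym (trans (+-identityˡ _) (*-identityʳ a))
  coeffs-∷ʳ [] a (suc k) = sym (trans (+-identityˡ _) (zeroʳ a))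
  coeffs-∷ʳ (x ∷ xs) a zero = sym (trans (cong (x +_) (zeroʳ a)) (+-identityʳ x))
  coeffs-∷ʳ (x ∷ xs) a (suc k) = coeffs-∷ʳ xs a k

  coeffs-top : ∀ xs a → coeffs (xs ∷ʳ a) (length xs) ≡ a
  coeffs-top [] a = refl
  coeffs-top (x ∷ xs) a = coeffs-top xs a

  mon≈coeffs : ∀ as → mon as ≈ coeffs (as ∷ʳ 1#)
  mon≈coeffs [] = λ { zero → refl ; (suc k) → refl }
  mon≈coeffs (a ∷ as) = ◂-cong (mon≈coeffs as)

  coeffs-reverse : ∀ xs → coeffs (reverse xs) ≈ rv (length xs) (coeffs xs)
  coeffs-reverse [] k = refl
  coeffs-reverse (x ∷ xs) k = trans (cong (λ ys → coeffs ys k) (unfold-reverse x xs)) (trans (coeffs-∷ʳ (reverse xs) x k)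
    (trans (+-comm _ _) (cong₂ _+_ (cong (λ m → x * X^ m k) (length-reverse xs)) (coeffs-reverse xs k))))

  coeffs-map : ∀ (φ : Carrier → Carrier) → φ 0# ≡ 0# → ∀ xs k → coeffs (map φ xs) k ≡ φ (coeffs xs k)
  coeffs-map φ φ0 [] k = sym φ0
  coeffs-map φ φ0 (x ∷ xs) zero = refl
  coeffs-map φ φ0 (x ∷ xs) (suc k) = coeffs-map φ φ0 xs k

  twistedReverse : Carrier → List Carrier → List Carrier
  twistedReverse c w = map (c *_) (reverse (map σ w))

  length-twistedReverse : ∀ c w → length (twistedReverse c w) ≡ length w
  length-twistedReverse c w = trans (length-map (c *_) (reverse (map σ w))) (trans (length-reverse (map σ w)) (length-map σ w))

  coeffs-twistedReverse : ∀ c w → coeffs (twistedReverse c w) ≈ c · σˢ (rv (length w) (coeffs w))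
  coeffs-twistedReverse c w k = trans (coeffs-map (c *_) (zeroʳ c) (reverse (map σ w)) k) (cong (c *_)
    (trans (coeffs-reverse (map σ w) k) (trans (cong (λ m → rv m (coeffs (map σ w)) k) (length-map σ w))
      (trans (rv-cong (length w) (coeffs-map σ σ-0 w) k) (rv-σ (length w) (coeffs w) k)))))

  dualList : Mon → List Carrier
  dualList f = twistedReverse (dualScale f) (body f ∷ʳ 1#)

  dualList-series : ∀ f → coeffs (dualList f) ≈ dualSeries f
  dualList-series f k = trans (coeffs-twistedReverse (dualScale f) (body f ∷ʳ 1#) k) (cong (λ z → dualScale f * σ z)
    (trans (cong (λ m → rv m (coeffs (body f ∷ʳ 1#)) k) (trans (length-++ (body f)) (ℕ.+-comm (length (body f)) 1)))
      (rv-cong (suc (deg f)) (≈-sym (mon≈coeffs (body f))) k)))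

  selfDual⇒list : ∀ {f} → f ~ ≡ f → dualList f ≡ body f ∷ʳ 1#
  selfDual⇒list {f} e = coeffs-injective _ _ (length-twistedReverse (dualScale f) (body f ∷ʳ 1#))
    (≈-trans (dualList-series f) (≈-trans (≈-sym (S-~ f)) (≈-trans (λ n → cong (λ z → S z n) e) (mon≈coeffs (body f)))))

  list⇒selfDual : ∀ {f} → dualList f ≡ body f ∷ʳ 1# → f ~ ≡ f
  list⇒selfDual {f} e = S-injective (≈-trans (S-~ f) (≈-trans (≈-sym (dualList-series f))
    (≈-trans (λ n → cong (λ z → coeffs z n) e) (≈-sym (mon≈coeffs (body f))))))

  -- The condition left on the inner coefficients of a self-dual polynomial once its constant term c
  -- and its leading 1 are taken off.
  Pal : Carrier → List Carrier → Set
  Pal c w = twistedReverse c w ≡ w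

  twistedReverse-ends : ∀ c x w y → twistedReverse c (x ∷ (w ∷ʳ y)) ≡ c * σ y ∷ (twistedReverse c w ∷ʳ (c * σ x))
  twistedReverse-ends c x w y = trans (cong (λ z → map (c *_) (reverse (σ x ∷ z))) (map-++ σ w [ y ]))
    (trans (cong (map (c *_)) (reverse-ends (σ x) (σ y) (map σ w))) (cong (c * σ y ∷_) (map-++ (c *_) (reverse (map σ w)) [ σ x ])))

  -- Reversal exchanges the ends a and 1. The constant term then reads σ(a)⁻¹ = a, so a has norm one
  -- and the scaling factor of the dual is a itself.
  selfDual⇒pal : ∀ {a w} .{nz} → mk (a ∷ w) nz ~ ≡ mk (a ∷ w) nz → a * σ a ≡ 1# × Pal a w
  selfDual⇒pal {a} {w} {nz} e with ∷-injective (trans (sym (twistedReverse-ends (σ a ⁻¹) a w 1#)) (selfDual⇒list e))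
  ... | p , q with ∷ʳ-injective (twistedReverse (σ a ⁻¹) w) w q
  ...   | r , t = trans (cong (_* σ a) (sym a≡)) t , trans (cong (λ c → twistedReverse c w) (sym a≡)) r
    where
    a≡ : σ a ⁻¹ ≡ a
    a≡ = trans (sym (trans (cong (σ a ⁻¹ *_) σ-1) (*-identityʳ _))) p

  pal⇒selfDual : ∀ {a w} .{nz} → a * σ a ≡ 1# → Pal a w → mk (a ∷ w) nz ~ ≡ mk (a ∷ w) nz
  pal⇒selfDual {a} {w} {nz} n p = list⇒selfDual (trans (twistedReverse-ends (σ a ⁻¹) a w 1#)
    (cong₂ _∷_ (trans (cong (σ a ⁻¹ *_) σ-1) (trans (*-identityʳ _) a≡))
      (cong₂ _∷ʳ_ (trans (cong (λ c → twistedReverse c w) a≡) p) (⁻¹-inverse _ σa≢0))))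
    where
    σa≢0 : σ a ≢ 0#
    σa≢0 = *≡1⇒nonzero (trans (*-comm _ _) n)
    a≡ : σ a ⁻¹ ≡ a
    a≡ = *-cancelˡ-nonzero σa≢0 (trans (*-comm _ _) (trans (⁻¹-inverse _ σa≢0) (sym (trans (*-comm _ _) n))))

  NormOne : Carrier → Set
  NormOne c = c * σ c ≡ 1#

  NormOneFixed : Carrier × Carrier → Set
  NormOneFixed (c , b) = NormOne c × c * σ b ≡ b

  module _ {ν τ : ℕ} (norm-count : HasCount NormOne ν) (fixed-count : HasCount NormOneFixed τ) where

    -- Each step by two adds a free outer coefficient a and its forced mirror image c σ(a). A single
    -- inner coefficient b must satisfy c σ(b) = b.
    palCount : ℕ → ℕ
    palCount zero = ν
    palCount (suc zero) = τ
    palCount (suc (suc n)) = palCount n ℕ.* card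

    pal-count : ∀ n → HasCount (λ ((c , w) : Carrier × List Carrier) → c * σ c ≡ 1# × length w ≡ n × Pal c w) (palCount n)
    pal-count zero = count-map (λ c → c , []) norm-count (λ c n → n , refl , refl) (λ { _ _ refl → refl })
      (λ { (c , []) (n , _ , _) → c , n , refl })
    pal-count (suc zero) = count-map (λ (c , b) → c , [ b ]) fixed-count (λ (c , b) (n , p) → n , refl , cong [_] p)
      (λ { _ _ refl → refl }) (λ { (c , b ∷ []) (n , _ , p) → (c , b) , (n , proj₁ (∷-injective p)) , refl })
    pal-count (suc (suc n)) = count-map (λ ((c , w) , a) → c , a ∷ (w ∷ʳ (c * σ a))) (count-Σ (pal-count n) (λ _ _ → count-all))
      (λ ((c , w) , a) ((nc , l , p) , _) → nc , cong suc (trans (length-++ w) (trans (ℕ.+-comm (length w) 1) (cong suc l))) ,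
        trans (twistedReverse-ends c a w (c * σ a)) (cong₂ (λ x y → x ∷ (y ∷ʳ (c * σ a))) (back nc) p))
      (λ { {(c , w) , a} {(c′ , w′) , a′} _ _ e → inj (cong proj₁ e) (proj₁ (∷-injective (cong proj₂ e))) (proj₂ (∷-injective (cong proj₂ e))) })
      onto
      where
      -- Mirroring twice returns a, because c has norm one.
      back : ∀ {c a} → c * σ c ≡ 1# → c * σ (c * σ a) ≡ a
      back {c} {a} nc = trans (cong (c *_) (trans (σ-* c (σ a)) (cong (σ c *_) (σ-involutive a))))
        (trans (sym (*-assoc _ _ _)) (trans (cong (_* a) nc) (*-identityˡ a)))
      inj : ∀ {c c′ a a′ w w′} → c ≡ c′ → a ≡ a′ → w ∷ʳ (c * σ a) ≡ w′ ∷ʳ (c′ * σ a′) → ((c , w) , a) ≡ ((c′ , w′) , a′)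
      inj {w = w} {w′} refl refl e with ∷ʳ-injective w w′ e
      ... | refl , _ = refl
      onto : ∀ ((c , w) : Carrier × List Carrier) → c * σ c ≡ 1# × length w ≡ suc (suc n) × Pal c w →
        ∃[ x ] (((proj₁ (proj₁ x) * σ (proj₁ (proj₁ x)) ≡ 1# × length (proj₂ (proj₁ x)) ≡ n × Pal (proj₁ (proj₁ x)) (proj₂ (proj₁ x))) × 1# ≡ 1#)
          × (proj₁ (proj₁ x) , proj₂ x ∷ (proj₂ (proj₁ x) ∷ʳ (proj₁ (proj₁ x) * σ (proj₂ x)))) ≡ (c , w))
      onto (c , a ∷ w) (nc , l , p) with initLast w
      ... | w′ ∷ʳ′ b with ∷-injective (trans (sym (twistedReverse-ends c a w′ b)) p)
      ...   | _ , q with ∷ʳ-injective (twistedReverse c w′) w′ q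
      ...     | r , t = ((c , w′) , a) , ((nc , ℕ.suc-injective (trans (sym (trans (length-++ w′) (ℕ.+-comm (length w′) 1))) (ℕ.suc-injective l)) , r) , refl) ,
                cong (λ b → c , a ∷ (w′ ∷ʳ b)) t

    selfDualCount : ℕ → ℕ
    selfDualCount zero = 1
    selfDualCount (suc n) = palCount n

    selfDual-count : ∀ m → HasCount (λ f → deg f ≡ m × f ~ ≡ f) (selfDualCount m)
    selfDual-count zero = count-one one (refl , deg≡0⇒one (one ~) (deg-~ one)) λ f (d , _) → deg≡0⇒one f d
    selfDual-count (suc n) = count-map (λ (c , w) → fromBody (c ∷ w)) (pal-count n)
      (λ (c , w) (nc , l , p) → let nz = *≡1⇒nonzero nc in
        subst (λ f → deg f ≡ suc n × f ~ ≡ f) (body-injective {mk (c ∷ w) nz} {fromBody (c ∷ w)} (sym (body-fromBody nz))) (cong suc l , pal⇒selfDual nc p))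
      (λ (nc , _) (nb , _) e → ∷-pair (trans (sym (body-fromBody (*≡1⇒nonzero nc))) (trans (cong body e) (body-fromBody (*≡1⇒nonzero nb)))))
      (λ { f@(mk (a ∷ w) nz) (refl , sd) → let nc , p = selfDual⇒pal sd in (a , w) , (nc , refl , p) , body-injective (body-fromBody (const-nonzero f)) })

  -- Irreducibility of coefficient lists

  coeffs-addP : ∀ xs ys → coeffs (addP xs ys) ≈ coeffs xs ⊕ coeffs ys
  coeffs-addP [] ys k = sym (+-identityˡ _)
  coeffs-addP (x ∷ xs) [] k = sym (+-identityʳ _)
  coeffs-addP (x ∷ xs) (y ∷ ys) zero = refl
  coeffs-addP (x ∷ xs) (y ∷ ys) (suc k) = coeffs-addP xs ys k

  coeffs-mulP : ∀ xs ys → coeffs (mulP xs ys) ≈ coeffs xs ⊛ coeffs ys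
  coeffs-mulP [] ys k = sym (𝟘-⊛ (coeffs ys) k)
  coeffs-mulP (x ∷ xs) ys k = trans (coeffs-addP (map (x *_) ys) (0# ∷ mulP xs ys) k) (split k)
    where
    split : coeffs (map (x *_) ys) ⊕ (0# ◂ coeffs (mulP xs ys)) ≈ coeffs (x ∷ xs) ⊛ coeffs ys
    split zero = trans (+-identityʳ _) (coeffs-map (x *_) (zeroʳ x) ys 0)
    split (suc k) = cong₂ _+_ (coeffs-map (x *_) (zeroʳ x) ys (suc k)) (coeffs-mulP xs ys k)

  length-addP : ∀ xs ys → length (addP xs ys) ≡ length xs ℕ.⊔ length ys
  length-addP [] ys = refl
  length-addP (x ∷ xs) [] = refl
  length-addP (x ∷ xs) (y ∷ ys) = cong suc (length-addP xs ys)

  length-mulP : ∀ x xs ys n → length ys ≡ suc n → length (mulP (x ∷ xs) ys) ≡ suc (length xs ℕ.+ n)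
  length-mulP x [] ys n l = trans (length-addP (map (x *_) ys) [ 0# ])
    (trans (cong (ℕ._⊔ 1) (trans (length-map (x *_) ys) l)) (cong suc (ℕ.⊔-identityʳ n)))
  length-mulP x (x′ ∷ xs) ys n l = trans (length-addP (map (x *_) ys) (0# ∷ mulP (x′ ∷ xs) ys))
    (trans (cong₂ ℕ._⊔_ (trans (length-map (x *_) ys) l) (cong suc (length-mulP x′ xs ys n l)))
      (cong suc (ℕ.m≤n⇒m⊔n≡n (ℕ.m≤n⇒m≤1+n (ℕ.m≤n+m n (length xs))))))

  ¬reducible⇒irr : ∀ f → 1 ≤ deg f × ¬ Reducible (body f ∷ʳ 1#) → Irr f
  ¬reducible⇒irr f (1≤ , ¬red) = 1≤ , split
    where
    split : ∀ g h → g ∙ h ≡ f → deg g ≡ 0 ⊎ deg h ≡ 0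
    split g h e with deg g ℕ.≟ 0 | deg h ℕ.≟ 0
    ... | yes z | _ = inj₁ z
    ... | no _ | yes z = inj₂ z
    ... | no g≢0 | no h≢0 = ⊥-elim (¬red (body g , 1# , body h , 1# , ℕ.n≢0⇒n>0 g≢0 , 1≢0 , ℕ.n≢0⇒n>0 h≢0 , 1≢0 ,
        coeffs-injective _ _ lengths (≈-trans (coeffs-mulP (body g ∷ʳ 1#) (body h ∷ʳ 1#))
          (≈-trans (⊛-cong (≈-sym (mon≈coeffs (body g))) (≈-sym (mon≈coeffs (body h))))
            (≈-trans (≈-sym (S-∙ g h)) (≈-trans (λ n → cong (λ z → S z n) e) (mon≈coeffs (body f))))))))
      where
      length-∷ʳ : ∀ (xs : List Carrier) → length (xs ∷ʳ 1#) ≡ suc (length xs)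
      length-∷ʳ xs = trans (length-++ xs) (ℕ.+-comm (length xs) 1)
      len : ∀ xs → length (mulP (xs ∷ʳ 1#) (body h ∷ʳ 1#)) ≡ suc (length xs ℕ.+ deg h)
      len [] = length-mulP 1# [] (body h ∷ʳ 1#) (deg h) (length-∷ʳ (body h))
      len (x ∷ xs) = trans (length-mulP x (xs ∷ʳ 1#) (body h ∷ʳ 1#) (deg h) (length-∷ʳ (body h))) (cong (λ m → suc (m ℕ.+ deg h)) (length-∷ʳ xs))
      lengths : length (mulP (body g ∷ʳ 1#) (body h ∷ʳ 1#)) ≡ length (body f ∷ʳ 1#)
      lengths = trans (len (body g)) (trans (cong suc (trans (sym (deg-∙ g h)) (cong deg e))) (sym (length-∷ʳ (body f))))

  irr⇒¬reducible : ∀ f → Irr f → 1 ≤ deg f × ¬ Reducible (body f ∷ʳ 1#)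
  irr⇒¬reducible f i = proj₁ i , λ (g , c , h , e , 1≤g , c≢0 , 1≤h , e≢0 , eq) → contra g c h e 1≤g c≢0 1≤h e≢0 eq
    where
    contra : ∀ g c h e → 1 ≤ length g → c ≢ 0# → 1 ≤ length h → e ≢ 0# → mulP (g ∷ʳ c) (h ∷ʳ e) ≡ body f ∷ʳ 1# → ⊥
    contra g c h e 1≤g c≢0 1≤h e≢0 eq = finish (monic-quotient mu (S-monic f) pv uv)
      where
      -- `Reducible` allows arbitrary leading coefficients. Moving c across makes the first factor
      -- monic, and then the second is monic because the product is.
      u v : Ser
      u = c ⁻¹ · coeffs (g ∷ʳ c)
      v = c · coeffs (h ∷ʳ e)
      below-∷ʳ : ∀ xs a → Below (suc (length xs)) (coeffs (xs ∷ʳ a))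
      below-∷ʳ xs a = subst (λ n → Below n (coeffs (xs ∷ʳ a))) (trans (length-++ xs) (ℕ.+-comm (length xs) 1)) (coeffs-below (xs ∷ʳ a))
      mu : Monic (length g) u
      mu = trans (cong (c ⁻¹ *_) (coeffs-top g c)) (⁻¹-inverse c c≢0) , λ k le → trans (cong (c ⁻¹ *_) (below-∷ʳ g c k le)) (zeroʳ _)
      pv : Poly v
      pv = poly-· c (suc (length h) , below-∷ʳ h e)
      uv : u ⊛ v ≈ S f
      uv k = begin
        (u ⊛ v) k ≡⟨ ·-⊛ (c ⁻¹) (coeffs (g ∷ʳ c)) v k ⟩
        c ⁻¹ * (coeffs (g ∷ʳ c) ⊛ v) k ≡⟨ cong (c ⁻¹ *_) (·-⊛ʳ c (coeffs (g ∷ʳ c)) (coeffs (h ∷ʳ e)) k) ⟩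
        c ⁻¹ * (c * (coeffs (g ∷ʳ c) ⊛ coeffs (h ∷ʳ e)) k) ≡⟨ trans (sym (*-assoc _ _ _)) (trans (cong (_* (coeffs (g ∷ʳ c) ⊛ coeffs (h ∷ʳ e)) k) (⁻¹-inverse c c≢0)) (*-identityˡ _)) ⟩
        (coeffs (g ∷ʳ c) ⊛ coeffs (h ∷ʳ e)) k ≡⟨ sym (coeffs-mulP (g ∷ʳ c) (h ∷ʳ e) k) ⟩
        coeffs (mulP (g ∷ʳ c) (h ∷ʳ e)) k ≡⟨ cong (λ xs → coeffs xs k) eq ⟩
        coeffs (body f ∷ʳ 1#) k ≡⟨ sym (mon≈coeffs (body f) k) ⟩
        S f k ∎
        where open ≡-Reasoning
      finish : ∃[ m ] (Monic m v × length g ℕ.+ m ≡ deg f) → ⊥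
      finish (m , mv , _) with proj₂ (proj₂ (irr⇒irrSeries {f} i)) mu mv uv
      ... | inj₁ z = ℕ.<⇒≢ 1≤g (sym z)
      -- A constant v would vanish at the positive index `length h`, where its coefficient is c e.
      ... | inj₂ refl = *-nonzero c≢0 e≢0 (trans (cong (c *_) (sym (coeffs-top h e))) (proj₂ mv (length h) 1≤h))

  const-mon : ∀ as → const (as ∷ʳ 1#) ≡ mon as 0
  const-mon [] = refl
  const-mon (a ∷ as) = refl

  count-vec : ∀ {d n} (Ψ : List Carrier → Set) → (∀ w → Ψ w → mon w 0 ≢ 0#) →
    HasCount {Vec Carrier d} (λ v → Ψ (toList v)) n → HasCount (λ f → deg f ≡ d × Ψ (body f)) n
  count-vec {d} Ψ nonzero c = count-map (fromBody ∘ toList) c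
    (λ v ψ → let e = body-fromBody (nonzero _ ψ) in trans (cong length e) (length-toList v) , subst Ψ (sym e) ψ)
    (λ {v} {v′} ψ ψ′ e → trans (sym (cast-is-id refl v))
      (toList-injective refl v v′ (trans (sym (body-fromBody (nonzero _ ψ))) (trans (cong body e) (body-fromBody (nonzero _ ψ′))))))
    λ { f (refl , ψ) → let l = toList∘fromList (body f) in Vec.fromList (body f) , subst Ψ (sym l) ψ ,
        body-injective (trans (body-fromBody (λ z → const-nonzero f (trans (cong (λ w → mon w 0) (sym l)) z))) l) }

-- Roots, Fermat and Frobenius

binomial : ℕ → ℕ → ℕ
binomial zero zero = 1
binomial zero (suc k) = 0
binomial (suc n) zero = binomial n zero
binomial (suc n) (suc k) = binomial n (suc k) ℕ.+ binomial n k

module FieldFacts (K : FiniteField) where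
  open FieldSeries K
  open ListCount K

  -- The first argument cuts the series off, since only a polynomial has values; one of degree n is
  -- evaluated with `suc n`.
  ev : ℕ → Ser → Carrier → Carrier
  ev zero f x = 0#
  ev (suc n) f x = f 0 + x * ev n (tl f) x

  ev-cong : ∀ n {f g} x → (∀ k → k < n → f k ≡ g k) → ev n f x ≡ ev n g x
  ev-cong zero x e = refl
  ev-cong (suc n) x e = cong₂ (λ a b → a + x * b) (e 0 (s≤s z≤n)) (ev-cong n x λ k k<n → e (suc k) (s≤s k<n))

  ev-𝟘 : ∀ n x → ev n 𝟘 x ≡ 0#
  ev-𝟘 zero x = refl
  ev-𝟘 (suc n) x = trans (+-identityˡ _) (trans (cong (x *_) (ev-𝟘 n x)) (zeroʳ x))

  ev-⊕ : ∀ n f g x → ev n (f ⊕ g) x ≡ ev n f x + ev n g x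
  ev-⊕ zero f g x = sym (+-identityˡ 0#)
  ev-⊕ (suc n) f g x = trans (cong (λ z → f 0 + g 0 + x * z) (ev-⊕ n (tl f) (tl g) x))
    (AS.solve 5 (λ a b x y z → (a :+ b) :+ (x :* (y :+ z)) := (a :+ x :* y) :+ (b :+ x :* z)) refl (f 0) (g 0) x _ _)

  ev-· : ∀ n c f x → ev n (c · f) x ≡ c * ev n f x
  ev-· zero c f x = sym (zeroʳ c)
  ev-· (suc n) c f x = trans (cong (λ z → c * f 0 + x * z) (ev-· n c (tl f) x))
    (AS.solve 4 (λ c a x y → (c :* a) :+ (x :* (c :* y)) := c :* (a :+ x :* y)) refl c (f 0) x _)

  ev-last : ∀ n f x → ev (suc n) f x ≡ ev n f x + f n * x ^ n
  ev-last zero f x = trans (cong (f 0 +_) (zeroʳ x)) (trans (+-comm _ _) (cong (0# +_) (sym (*-identityʳ _))))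
  ev-last (suc n) f x = trans (cong (λ z → f 0 + x * z) (ev-last n (tl f) x))
    (AS.solve 5 (λ a x y b p → a :+ (x :* (y :+ b :* p)) := (a :+ x :* y) :+ (b :* (x :* p))) refl (f 0) x _ _ _)

  ev-X^ : ∀ n d x → d < n → ev n (X^ d) x ≡ x ^ d
  ev-X^ (suc n) zero x _ = trans (cong (λ z → 1# + x * z) (ev-𝟘 n x)) (trans (cong (1# +_) (zeroʳ x)) (+-identityʳ 1#))
  ev-X^ (suc n) (suc d) x (s≤s d<n) = trans (+-identityˡ _) (cong (x *_) (ev-X^ n d x d<n))

  ev-con : ∀ n c x → ev (suc n) (con c) x ≡ c
  ev-con n c x = trans (cong (λ z → c + x * z) (ev-𝟘 n x)) (trans (cong (c +_) (zeroʳ x)) (+-identityʳ c))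

  -- The quotient of f - f(r) by x - r.
  synthetic : ℕ → Ser → Carrier → Ser
  synthetic zero f r = 𝟘
  synthetic (suc n) f r = ev n (tl f) r ◂ synthetic n (tl f) r

  -- The identity f(x) - f(r) = (x - r) q(x) with every term on its positive side, so that it lives
  -- in a semiring.
  ev-synthetic : ∀ n f r x → ev (suc n) f x + r * ev n (synthetic (suc n) f r) x ≡ ev (suc n) f r + x * ev n (synthetic (suc n) f r) x
  ev-synthetic zero f r x = AS.solve 3 (λ a x r → (a :+ x :* AS.con 0) :+ r :* AS.con 0 := (a :+ r :* AS.con 0) :+ x :* AS.con 0) refl (f 0) x r
  ev-synthetic (suc n) f r x = begin
    f 0 + x * hx + r * (hr + x * e)
      ≡⟨ AS.solve 6 (λ a x hx r hr e → (a :+ x :* hx) :+ r :* (hr :+ x :* e) := (a :+ r :* hr) :+ x :* (hx :+ r :* e)) refl (f 0) x hx r hr e ⟩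
    f 0 + r * hr + x * (hx + r * e) ≡⟨ cong (λ z → f 0 + r * hr + x * z) (ev-synthetic n (tl f) r x) ⟩
    f 0 + r * hr + x * (hr + x * e) ∎
    where
    open ≡-Reasoning
    hx hr e : Carrier
    hx = ev (suc n) (tl f) x
    hr = ev (suc n) (tl f) r
    e = ev n (synthetic (suc n) (tl f) r) x

  head-vanishes : ∀ n f r → (∀ k → k < n → f (suc k) ≡ 0#) → ev (suc n) f r ≡ 0# → f 0 ≡ 0#
  head-vanishes n f r z e = trans (sym (trans (cong (λ y → f 0 + r * y) (trans (ev-cong n r z) (ev-𝟘 n r))) (trans (cong (f 0 +_) (zeroʳ r)) (+-identityʳ _)))) e

  synthetic-vanishes : ∀ n f r → (∀ k → k < n → synthetic (suc n) f r k ≡ 0#) → ∀ k → k < n → f (suc k) ≡ 0#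
  synthetic-vanishes (suc n) f r z = λ
    { zero _ → head-vanishes n (tl f) r rest (z 0 (s≤s z≤n))
    ; (suc k) (s≤s k<n) → rest k k<n }
    where
    rest : ∀ k → k < n → f (suc (suc k)) ≡ 0#
    rest = synthetic-vanishes n (tl f) r (λ k k<n → z (suc k) (s≤s k<n))

  -- Division by x - r leaves a quotient that vanishes at the other roots. By induction it is zero,
  -- so f is constant and, having a root, zero.
  roots-vanish : ∀ n f xs → Unique xs → n ≤ length xs → (∀ x → x ∈ xs → ev n f x ≡ 0#) → ∀ k → k < n → f k ≡ 0#
  roots-vanish (suc n) f (r ∷ xs) (r∉ ∷ u) (s≤s le) z = λ
    { zero _ → head-vanishes n f r rest (z r (here refl))
    ; (suc k) (s≤s k<n) → rest k k<n }
    where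
    quot : Carrier → Carrier
    quot = ev n (synthetic (suc n) f r)
    quotient-root : ∀ x → x ∈ xs → quot x ≡ 0#
    quotient-root x x∈ with quot x ≟ 0#
    ... | yes p = p
    ... | no p = ⊥-elim (All.lookup r∉ x∈ (*-cancelˡ-nonzero p (trans (*-comm _ _) (trans
          (+-cancelˡ 0# (r * quot x) (x * quot x) (trans (cong (_+ r * quot x) (sym (z x (there x∈)))) (trans (ev-synthetic n f r x) (cong (_+ x * quot x) (z r (here refl))))))
          (*-comm _ _)))))
    rest : ∀ k → k < n → f (suc k) ≡ 0#
    rest = synthetic-vanishes n f r (roots-vanish n (synthetic (suc n) f r) xs u le quotient-root)

  root-bound : ∀ {n f} → f n ≢ 0# → ∀ xs → Unique xs → (∀ x → x ∈ xs → ev (suc n) f x ≡ 0#) → length xs ≤ n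
  root-bound {n} {f} top xs u z with length xs ℕ.≤? n
  ... | yes p = p
  ... | no p = ⊥-elim (top (roots-vanish (suc n) f xs u (ℕ.≰⇒> p) z n ℕ.≤-refl))

  ^-+ : ∀ x m n → x ^ (m ℕ.+ n) ≡ x ^ m * x ^ n
  ^-+ x zero n = sym (*-identityˡ _)
  ^-+ x (suc m) n = trans (cong (x *_) (^-+ x m n)) (sym (*-assoc _ _ _))

  *-^ : ∀ x y n → (x * y) ^ n ≡ x ^ n * y ^ n
  *-^ x y zero = sym (*-identityˡ 1#)
  *-^ x y (suc n) = trans (cong (x * y *_) (*-^ x y n))
    (AS.solve 4 (λ x y a b → (x :* y) :* (a :* b) := (x :* a) :* (y :* b)) refl x y _ _)

  1^ : ∀ n → 1# ^ n ≡ 1#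
  1^ zero = refl
  1^ (suc n) = trans (*-identityˡ _) (1^ n)

  ^-^ : ∀ x m n → (x ^ m) ^ n ≡ x ^ (m ℕ.* n)
  ^-^ x zero n = 1^ n
  ^-^ x (suc m) n = trans (*-^ x (x ^ m) n) (trans (cong (x ^ n *_) (^-^ x m n)) (sym (^-+ x n (m ℕ.* n))))

  product : List Carrier → Carrier
  product = foldr _*_ 1#

  product-↭ : ∀ {xs ys} → xs ↭ ys → product xs ≡ product ys
  product-↭ ↭.refl = refl
  product-↭ (↭.prep x p) = cong (x *_) (product-↭ p)
  product-↭ (↭.swap x y p) = trans (cong (λ z → x * (y * z)) (product-↭ p))
    (AS.solve 3 (λ x y z → x :* (y :* z) := y :* (x :* z)) refl x y _)
  product-↭ (↭.trans p q) = trans (product-↭ p) (product-↭ q)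

  product-scale : ∀ x ys → product (map (x *_) ys) ≡ x ^ length ys * product ys
  product-scale x [] = sym (*-identityˡ 1#)
  product-scale x (y ∷ ys) = trans (cong (x * y *_) (product-scale x ys))
    (AS.solve 4 (λ x y a b → (x :* y) :* (a :* b) := (x :* a) :* (y :* b)) refl x y _ _)

  product-nonzero : ∀ ys → (∀ y → y ∈ ys → y ≢ 0#) → product ys ≢ 0#
  product-nonzero [] _ = 1≢0
  product-nonzero (y ∷ ys) nz = *-nonzero (nz y (here refl)) (product-nonzero ys (λ z m → nz z (there m)))

  -- Multiplication by x permutes the units, so their product equals x^k times itself.
  fermat : ∀ {k} → card ≡ suc k → ∀ x → x ≢ 0# → x ^ k ≡ 1#
  fermat {k} c x x≢0 with count-nonzero
  ... | k′ , (us , en , refl) , c′ with ℕ.suc-injective (trans (sym c) c′)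
  ...   | refl = *-cancelˡ-nonzero {product us} (product-nonzero us (λ y m → proj₁ (proj₂ en y) m))
    (trans (*-comm _ _) (trans (sym (product-scale x us)) (trans (product-↭ (enum-↭ scaled en)) (sym (*-identityʳ _)))))
    where
    scaled : Enumerates (_≢ 0#) (map (x *_) us)
    scaled = enum-map (x *_) en (λ y nz → *-nonzero x≢0 nz) (λ _ _ → *-cancelˡ-nonzero x≢0)
      (λ y nz → x ⁻¹ * y , *-nonzero (⁻¹-nonzero x≢0) nz , trans (sym (*-assoc _ _ _)) (trans (cong (_* y) (trans (*-comm _ _) (⁻¹-inverse x x≢0))) (*-identityˡ y)))

  card-positive : ∃[ k ] card ≡ suc k
  card-positive = proj₁ count-nonzero , proj₂ (proj₂ count-nonzero)

  ^-card : ∀ x → x ^ card ≡ x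
  ^-card x with card-positive | x ≟ 0#
  ... | k , c | yes refl = trans (cong (0# ^_) c) (zeroˡ _)
  ... | k , c | no x≢0 = trans (cong (x ^_) c) (trans (cong (x *_) (fermat c x x≢0)) (*-identityʳ x))

  binomialSeries : ℕ → Ser
  binomialSeries zero = 𝟙
  binomialSeries (suc n) = binomialSeries n ⊕ (0# ◂ binomialSeries n)

  binomialSeries-monic : ∀ n → Monic n (binomialSeries n)
  binomialSeries-monic zero = refl , λ { (suc k) _ → refl }
  binomialSeries-monic (suc n) = let t , b = binomialSeries-monic n in
    trans (cong₂ _+_ (b (suc n) ℕ.≤-refl) t) (+-identityˡ 1#) ,
    λ { (suc k) (s≤s le) → trans (cong₂ _+_ (b (suc k) (ℕ.m≤n⇒m≤1+n le)) (b k le)) (+-identityˡ 0#) }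

  ev-binomialSeries : ∀ n x → ev (suc n) (binomialSeries n) x ≡ (1# + x) ^ n
  ev-binomialSeries zero x = ev-X^ 1 0 x (s≤s z≤n)
  ev-binomialSeries (suc n) x = begin
    ev (suc (suc n)) (Bin ⊕ (0# ◂ Bin)) x ≡⟨ ev-⊕ (suc (suc n)) Bin (0# ◂ Bin) x ⟩
    ev (suc (suc n)) Bin x + (0# + x * ev (suc n) Bin x) ≡⟨ cong₂ _+_ (trans (ev-last (suc n) Bin x)
        (trans (cong (λ z → ev (suc n) Bin x + z * x ^ suc n) (proj₂ (binomialSeries-monic n) (suc n) ℕ.≤-refl)) (trans (cong (ev (suc n) Bin x +_) (zeroˡ _)) (+-identityʳ _)))) (+-identityˡ _) ⟩
    ev (suc n) Bin x + x * ev (suc n) Bin x ≡⟨ cong (λ z → z + x * z) (ev-binomialSeries n x) ⟩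
    (1# + x) ^ n + x * (1# + x) ^ n ≡⟨ AS.solve 2 (λ x p → p :+ x :* p := (AS.con 1 :+ x) :* p) refl x _ ⟩
    (1# + x) * (1# + x) ^ n ∎
    where
    open ≡-Reasoning
    Bin : Ser
    Bin = binomialSeries n

  binomialSeries-+ : ∀ m n → binomialSeries (m ℕ.+ n) ≈ binomialSeries m ⊛ binomialSeries n
  binomialSeries-+ zero n = ≈-sym (⊛-identityˡ (binomialSeries n))
  binomialSeries-+ (suc m) n k = trans (cong₂ _+_ (binomialSeries-+ m n k) (trans (◂-cong (binomialSeries-+ m n) k) (sym (◂-⊛ (binomialSeries m) (binomialSeries n) k))))
    (sym (⊛-distribʳ (binomialSeries n) (binomialSeries m) (0# ◂ binomialSeries m) k))

  -- The polynomial (1 + x)^card - 1 - x^card has degree less than card and vanishes everywhere.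
  binomialSeries-card : ∀ {k} → card ≡ suc k → binomialSeries card ≈[ k ] 𝟙
  binomialSeries-card {k} c i i≤k = x∙y⁻¹≈ε⇒x≈y _ _ (trans (cong (Bin i +_) (neg𝟙 i))
      (roots-vanish card (Bin ⊕ con (- 1#)) elements elements-unique ℕ.≤-refl vanish i (subst (i <_) (sym c) (s≤s i≤k))))
    where
    Bin : Ser
    Bin = binomialSeries card
    neg𝟙 : ∀ i → - (𝟙 i) ≡ con (- 1#) i
    neg𝟙 zero = refl
    neg𝟙 (suc i) = -0#≈0#
    ev-Bin : ∀ x → ev card Bin x ≡ 1#
    ev-Bin x = +-cancelʳ x (ev card Bin x) 1# (begin
      ev card Bin x + x ≡⟨ cong (ev card Bin x +_) (sym (trans (cong (_* x ^ card) (proj₁ (binomialSeries-monic card))) (trans (*-identityˡ _) (^-card x)))) ⟩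
      ev card Bin x + Bin card * x ^ card ≡⟨ sym (ev-last card Bin x) ⟩
      ev (suc card) Bin x ≡⟨ ev-binomialSeries card x ⟩
      (1# + x) ^ card ≡⟨ ^-card (1# + x) ⟩
      1# + x ∎)
      where open ≡-Reasoning
    vanish : ∀ x → x ∈ elements → ev card (Bin ⊕ con (- 1#)) x ≡ 0#
    vanish x _ = trans (ev-⊕ card Bin (con (- 1#)) x) (trans (cong₂ _+_ (ev-Bin x) (trans (cong (λ n → ev n (con (- 1#)) x) c) (ev-con k (- 1#) x))) (-‿inverseʳ 1#))

  ι : ℕ → Carrier
  ι zero = 0#
  ι (suc n) = 1# + ι n

  ι-+ : ∀ m n → ι (m ℕ.+ n) ≡ ι m + ι n
  ι-+ zero n = sym (+-identityˡ _)
  ι-+ (suc m) n = trans (cong (1# +_) (ι-+ m n)) (sym (+-assoc _ _ _))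

  ι-* : ∀ m n → ι (m ℕ.* n) ≡ ι m * ι n
  ι-* zero n = sym (zeroˡ _)
  ι-* (suc m) n = trans (ι-+ n (m ℕ.* n)) (trans (cong (ι n +_) (ι-* m n)) (AS.solve 2 (λ a b → a :+ b :* a := (AS.con 1 :+ b) :* a) refl (ι n) (ι m)))

  binomialSeries-ι : ∀ n k → binomialSeries n k ≡ ι (binomial n k)
  binomialSeries-ι zero zero = sym (+-identityʳ 1#)
  binomialSeries-ι zero (suc k) = refl
  binomialSeries-ι (suc n) zero = trans (+-identityʳ _) (binomialSeries-ι n zero)
  binomialSeries-ι (suc n) (suc k) = trans (cong₂ _+_ (binomialSeries-ι n (suc k)) (binomialSeries-ι n k)) (sym (ι-+ (binomial n (suc k)) (binomial n k)))

  power : Ser → ℕ → Ser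
  power g zero = 𝟙
  power g (suc n) = g ⊛ power g n

  geometric : Ser → ℕ → Ser
  geometric g zero = 𝟘
  geometric g (suc n) = 𝟙 ⊕ g ⊛ geometric g n

  geometric-sum : ∀ g n → g ⊛ geometric g n ⊕ 𝟙 ≈ power g n ⊕ geometric g n
  geometric-sum g zero k = trans (cong (_+ 𝟙 k) (trans (⊛-comm g 𝟘 k) (𝟘-⊛ g k))) (+-comm _ _)
  geometric-sum g (suc n) = ≈-trans (SS.solve 2 (λ g s → g SS.:* (SS.con 1 SS.:+ g SS.:* s) SS.:+ SS.con 1 SS.:= g SS.:* (g SS.:* s SS.:+ SS.con 1) SS.:+ SS.con 1) ≈-refl g (geometric g n))
    (≈-trans (⊕-cong {u = 𝟙} (⊛-cong {f = g} ≈-refl (geometric-sum g n)) ≈-refl)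
      (SS.solve 3 (λ g p s → g SS.:* (p SS.:+ s) SS.:+ SS.con 1 SS.:= g SS.:* p SS.:+ (SS.con 1 SS.:+ g SS.:* s)) ≈-refl g (power g n) (geometric g n)))

  geometric-const : ∀ g n → g 0 ≡ 1# → geometric g n 0 ≡ ι n
  geometric-const g zero _ = refl
  geometric-const g (suc n) e = cong (1# +_) (trans (cong₂ _*_ e (geometric-const g n e)) (*-identityˡ _))

  -- g^n = 1 forces g = 1 when n is invertible, since g^n - 1 = (g - 1)(1 + g + ⋯ + g^(n-1)).
  root-of-one : ∀ g n {k} → g 0 ≡ 1# → ι n ≢ 0# → power g n ≈[ k ] 𝟙 → g ≈[ k ] 𝟙
  root-of-one g n {k} g0 nz e = ⊛-cancelʳ[] {u = ι n ⁻¹} {f = geometric g n} (trans (cong (ι n ⁻¹ *_) (geometric-const g n g0)) (⁻¹-inverse _ nz))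
    λ i i≤k → trans (+-cancelʳ (𝟙 i) _ _ (trans (geometric-sum g n i) (trans (cong (_+ geometric g n i) (e i i≤k)) (+-comm _ _)))) (sym (⊛-identityˡ (geometric g n) i))

  binomialSeries-* : ∀ p t → binomialSeries (p ℕ.* t) ≈ power (binomialSeries t) p
  binomialSeries-* zero t = ≈-refl
  binomialSeries-* (suc p) t = ≈-trans (binomialSeries-+ t (p ℕ.* t)) (⊛-cong {f = binomialSeries t} ≈-refl (binomialSeries-* p t))

  binomialSeries-const : ∀ n → binomialSeries n 0 ≡ 1#
  binomialSeries-const zero = refl
  binomialSeries-const (suc n) = trans (+-identityʳ _) (binomialSeries-const n)

  -- Here (1 + x)^(p t) is 1 below degree |K| = p t. Were p invertible, its p-th root (1 + x)^t
  -- would be 1 there too, yet its coefficient at x^t is 1 and 0 < t < |K|. This takes the place of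
  -- the characteristic.
  divisor-of-card-is-zero : ∀ p t → 2 ≤ p → card ≡ p ℕ.* t → ι p ≡ 0#
  divisor-of-card-is-zero p t 2≤p c with ι p ≟ 0# | card-positive
  ... | yes z | _ = z
  ... | no nz | k , ck = ⊥-elim (1≢0 (trans (sym (proj₁ (binomialSeries-monic t))) (trans (g≈ t t≤k) (𝟙-pos t 1≤t))))
    where
    g≈ : binomialSeries t ≈[ k ] 𝟙
    g≈ = root-of-one (binomialSeries t) p (binomialSeries-const t) nz λ i i≤k →
      trans (sym (binomialSeries-* p t i)) (trans (cong (λ n → binomialSeries n i) (sym c)) (binomialSeries-card ck i i≤k))
    1≤t : 1 ≤ t
    1≤t = ℕ.n≢0⇒n>0 λ { refl → ℕ.1+n≢0 (trans (sym ck) (trans c (ℕ.*-zeroʳ p))) }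
    t≤k : t ≤ k
    t≤k = ℕ.<⇒≤pred (ℕ.<-≤-trans (ℕ.m<m+n t 1≤t) (ℕ.≤-trans (ℕ.≤-reflexive (cong (t ℕ.+_) (sym (ℕ.+-identityʳ t)))) (ℕ.≤-trans (ℕ.*-monoˡ-≤ t 2≤p) (ℕ.≤-reflexive (trans (sym c) ck)))))
    𝟙-pos : ∀ j → 1 ≤ j → 𝟙 j ≡ 0#
    𝟙-pos (suc j) _ = refl

  -- For x nonzero, x + y = x (1 + w) with w = y / x, which reduces the two-variable expansion to
  -- that of (1 + w)^n.
  freshman : ∀ n → 1 ≤ n → (∀ k → 1 ≤ k → k < n → ι (binomial n k) ≡ 0#) → ∀ x y → (x + y) ^ n ≡ x ^ n + y ^ n
  freshman n@(suc n′) _ z x y with x ≟ 0#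
  ... | yes refl = trans (cong (_^ n) (+-identityˡ y)) (sym (trans (cong (_+ y ^ n) (zeroˡ _)) (+-identityˡ _)))
  ... | no x≢0 = begin
      (x + y) ^ n ≡⟨ cong (_^ n) (sym (trans (distribˡ x 1# w) (cong₂ _+_ (*-identityʳ x) xw))) ⟩
      (x * (1# + w)) ^ n ≡⟨ *-^ x (1# + w) n ⟩
      x ^ n * (1# + w) ^ n ≡⟨ cong (x ^ n *_) one-plus ⟩
      x ^ n * (1# + w ^ n) ≡⟨ trans (distribˡ _ _ _) (cong₂ _+_ (*-identityʳ _) (sym (*-^ x w n))) ⟩
      x ^ n + (x * w) ^ n ≡⟨ cong (λ z → x ^ n + z ^ n) xw ⟩
      x ^ n + y ^ n ∎
    where
    open ≡-Reasoning
    w : Carrier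
    w = x ⁻¹ * y
    xw : x * w ≡ y
    xw = trans (sym (*-assoc _ _ _)) (trans (cong (_* y) (trans (*-comm _ _) (⁻¹-inverse x x≢0))) (*-identityˡ y))
    sparse : ∀ k → k < suc n → binomialSeries n k ≡ (𝟙 ⊕ X^ n) k
    sparse zero _ = trans (binomialSeries-const n) (sym (+-identityʳ 1#))
    sparse (suc k) (s≤s k<n) with suc k ℕ.≟ n
    ... | yes refl = trans (proj₁ (binomialSeries-monic n)) (sym (trans (+-identityˡ _) (proj₁ (X^-monic n))))
    ... | no ne = trans (binomialSeries-ι n (suc k)) (trans (z (suc k) (s≤s z≤n) (ℕ.≤∧≢⇒< k<n ne))
        (sym (trans (+-identityˡ _) (shift-< n 𝟙 (suc k) (ℕ.≤∧≢⇒< k<n ne)))))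
    one-plus : (1# + w) ^ n ≡ 1# + w ^ n
    one-plus = trans (sym (ev-binomialSeries n w)) (trans (ev-cong (suc n) w sparse) (trans (ev-⊕ (suc n) 𝟙 (X^ n) w)
      (cong₂ _+_ (ev-con n 1# w) (ev-X^ (suc n) n w ℕ.≤-refl))))

module _ (K : FiniteField) where
  open FieldSeries K
  open ListCount K
  open FieldFacts K

  2≤card : 2 ≤ card
  2≤card = let k , (us , en , l) , c = count-nonzero in
    subst (2 ≤_) (sym c) (s≤s (subst (1 ≤_) l (∈-length (proj₂ (proj₂ en 1#) 1≢0))))

  ι-card : ι card ≡ 0#
  ι-card = divisor-of-card-is-zero card 1 2≤card (sym (ℕ.*-identityʳ card))

  binomial-card : ∀ k → 1 ≤ k → k < card → ι (binomial card k) ≡ 0#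
  binomial-card (suc k) _ lt = trans (sym (binomialSeries-ι card (suc k)))
    (binomialSeries-card (proj₂ card-positive) (suc k) (ℕ.<⇒≤pred (subst (suc k <_) (proj₂ card-positive) lt)))

-- Conjugation on the field of q² elements and Hilbert 90

module Unitary (K L : FiniteField) (q : ℕ) (cardK : FiniteField.card K ≡ q) (cardL : FiniteField.card L ≡ q ℕ.* q) where
  private
    module k = FieldSeries K
    module kF = FieldFacts K
  open FieldSeries L
  open ListCount L
  open FieldFacts L

  2≤q : 2 ≤ q
  2≤q = subst (2 ≤_) cardK (2≤card K)

  -- A common divisor d ≥ 2 of n and q divides |L|, so it vanishes in L.
  ι-transfer : ∀ n → kF.ι n ≡ k.0# → ι n ≡ 0#
  ι-transfer n z with gcd n q in e | gcd[m,n]∣m n q | gcd[m,n]∣n n q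
  ... | 0 | _ | divides t p = ⊥-elim (ℕ.<⇒≢ (ℕ.≤-trans (s≤s z≤n) 2≤q) (sym (trans p (ℕ.*-zeroʳ t))))
  -- Bézout gives consecutive multiples of n and of q. Both vanish in K, hence so would 1.
  ... | 1 | _ | _ = ⊥-elim (absurd (coprime-Bézout (gcd≡1⇒coprime e)))
    where
    vanish : ∀ x m → kF.ι m ≡ k.0# → kF.ι (x ℕ.* m) ≡ k.0#
    vanish x m z = trans (kF.ι-* x m) (trans (cong (kF.ι x k.*_) z) (k.zeroʳ _))
    ιq : kF.ι q ≡ k.0#
    ιq = trans (cong kF.ι (sym cardK)) (ι-card K)
    one≡0 : ∀ a b → kF.ι a ≡ k.0# → kF.ι b ≡ k.0# → suc a ≡ b → ⊥
    one≡0 a b za zb eq = k.1≢0 (trans (sym (k.+-identityʳ _)) (trans (cong (k.1# k.+_) (sym za)) (trans (cong kF.ι eq) zb)))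
    absurd : Bézout.Identity 1 n q → ⊥
    absurd (Bézout.+- x y eq) = one≡0 (y ℕ.* q) (x ℕ.* n) (vanish y q ιq) (vanish x n z) eq
    absurd (Bézout.-+ x y eq) = one≡0 (x ℕ.* n) (y ℕ.* q) (vanish x n z) (vanish y q ιq) eq
  ... | d@(suc (suc _)) | divides s p | divides t r = trans (cong ι p) (trans (ι-* s d) (trans (cong (ι s *_)
      (divisor-of-card-is-zero d (t ℕ.* q) (s≤s (s≤s z≤n)) (trans cardL (trans (cong (ℕ._* q) (trans r (ℕ.*-comm t d))) (ℕ.*-assoc d t q))))) (zeroʳ _)))

  σ : Carrier → Carrier
  σ x = x ^ q

  σ-+ : ∀ x y → σ (x + y) ≡ σ x + σ y
  σ-+ = freshman q (ℕ.≤-trans (s≤s z≤n) 2≤q) λ i 1≤i i<q → ι-transfer (binomial q i)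
    (subst (λ m → kF.ι (binomial m i) ≡ k.0#) cardK (binomial-card K i 1≤i (subst (i <_) (sym cardK) i<q)))

  σ-* : ∀ x y → σ (x * y) ≡ σ x * σ y
  σ-* x y = *-^ x y q

  σ-1 : σ 1# ≡ 1#
  σ-1 = 1^ q

  σ-involutive : ∀ x → σ (σ x) ≡ x
  σ-involutive x = trans (^-^ x q q) (trans (cong (x ^_) (sym cardL)) (^-card x))

  conjugation : Involution L
  conjugation = record { σ = σ ; σ-+ = σ-+ ; σ-* = σ-* ; σ-1 = σ-1 ; σ-involutive = σ-involutive }

  -- The count is pinned between the number of roots of a polynomial and a bound from the fibres of
  -- a map into the solutions; no preimage has to be exhibited.
  count-roots : ∀ {P : Carrier → Set} {n} → (∀ x → Dec (P x)) → (∀ xs → Unique xs → (∀ x → x ∈ xs → P x) → length xs ≤ n) →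
    (∀ {m} → HasCount P m → n ≤ m) → HasCount P n
  count-roots {P} P? upper lower with count-filter P? count-all
  ... | m , c = subst (HasCount P) (ℕ.≤-antisym (small c′) (lower c′)) c′
    where
    c′ : HasCount P m
    c′ = count-resp (λ _ → proj₂) (λ _ p → refl , p) c
    small : ∀ {m} → HasCount P m → m ≤ _
    small (xs , (u , en) , refl) = upper xs u λ x → proj₁ (en x)

  module _ {q′ : ℕ} (q≡ : q ≡ suc (suc q′)) where

    private
      r : ℕ
      r = suc q′

    -- q² - 1 = (q - 1)(q + 1): the number of units, the largest fibre of y ↦ y^(q-1), and the
    -- number of elements of norm one.
    card≡ : card ≡ suc (r ℕ.* suc q)
    card≡ = trans cardL (trans (cong₂ ℕ._*_ q≡ q≡) (trans (expand q′) (cong (λ z → suc (r ℕ.* suc z)) (sym q≡))))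
      where
      expand : ∀ q′ → suc (suc q′) ℕ.* suc (suc q′) ≡ suc (suc q′ ℕ.* suc (suc (suc q′)))
      expand = ℕ-solve-∀

    root-of : ∀ n b xs → Unique xs → (∀ x → x ∈ xs → x ^ suc n ≡ b) → length xs ≤ suc n
    root-of n b xs u z = root-bound {suc n} {f} (λ e → 1≢0 (trans (sym (trans (cong (_+ 0#) (proj₁ (X^-monic (suc n)))) (+-identityʳ 1#))) e)) xs u
      λ x m → trans (ev-⊕ (suc (suc n)) (X^ (suc n)) (con (- b)) x) (trans (cong₂ _+_ (trans (ev-X^ (suc (suc n)) (suc n) x ℕ.≤-refl) (z x m)) (ev-con (suc n) (- b) x)) (-‿inverseʳ b))
      where
      f : Ser
      f = X^ (suc n) ⊕ con (- b)

    -- Hilbert 90: y ↦ y^(q-1) maps the units onto the elements of norm one.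
    norm-count : HasCount (λ c → c * σ c ≡ 1#) (suc q)
    norm-count = count-roots (λ c → (c * σ c) ≟ 1#) (root-of q 1#) lower
      where
      lower : ∀ {m} → HasCount (λ c → c * σ c ≡ 1#) m → suc q ≤ m
      lower (ys , (_ , en) , refl) with count-nonzero
      ... | k , (us , (u , enu) , refl) , c = ℕ.*-cancelʳ-≤ (suc q) (length ys) r
        (ℕ.≤-trans (ℕ.≤-reflexive (trans (ℕ.*-comm (suc q) r) (ℕ.suc-injective (trans (sym card≡) c))))
          (fibre-bound _≟_ (_^ r) r (root-of q′) ys us u λ y y∈ → proj₂ (en (y ^ r)) (norm-one y (proj₁ (enu y) y∈))))
        where
        norm-one : ∀ y → y ≢ 0# → y ^ r * σ (y ^ r) ≡ 1#
        norm-one y y≢0 = trans (^-^ y r (suc q)) (fermat card≡ y y≢0)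

    -- Serves both halves of `fixed-count`: a = -1, b = 0 describes the fixed points, and a = 1 the
    -- fibres of the trace.
    trinomial : ∀ c a b xs → c ≢ 0# → Unique xs → (∀ x → x ∈ xs → c * σ x + a * x + b ≡ 0#) → length xs ≤ q
    trinomial c a b xs c≢0 u z = root-bound {q} {f} (λ e → c≢0 (trans (sym top) e)) xs u λ x m → trans (ev-f x) (z x m)
      where
      f : Ser
      f = c · X^ q ⊕ a · X^ 1 ⊕ con b
      top : f q ≡ c
      top = trans (cong₂ _+_ (cong₂ _+_ (trans (cong (c *_) (proj₁ (X^-monic q))) (*-identityʳ c)) (trans (cong (a *_) (proj₂ (X^-monic 1) q 2≤q)) (zeroʳ a)))
        (trans (cong (con b) q≡) refl)) (trans (+-identityʳ _) (+-identityʳ c))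
      ev-f : ∀ x → ev (suc q) f x ≡ c * σ x + a * x + b
      ev-f x = trans (ev-⊕ (suc q) (c · X^ q ⊕ a · X^ 1) (con b) x) (cong₂ _+_ (trans (ev-⊕ (suc q) (c · X^ q) (a · X^ 1) x)
        (cong₂ _+_ (trans (ev-· (suc q) c (X^ q) x) (cong (c *_) (ev-X^ (suc q) q x ℕ.≤-refl)))
          (trans (ev-· (suc q) a (X^ 1) x) (cong (a *_) (trans (ev-X^ (suc q) 1 x (ℕ.m≤n⇒m≤1+n 2≤q)) (*-identityʳ x))))))
        (ev-con q b x))

    -- The additive Hilbert 90: y ↦ y + c σ(y) maps L onto the fixed points of b ↦ c σ(b).
    fixed-count : ∀ c → c * σ c ≡ 1# → HasCount (λ b → c * σ b ≡ b) q
    fixed-count c nc = count-roots (λ b → (c * σ b) ≟ b)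
      (λ xs u z → trinomial c (- 1#) 0# xs c≢0 u λ x m → trans (+-identityʳ _) (trans (cong₂ _+_ (z x m) (trans (sym (-‿distribˡ-* 1# x)) (cong -_ (*-identityˡ x)))) (-‿inverseʳ x)))
      lower
      where
      c≢0 : c ≢ 0#
      c≢0 = *≡1⇒nonzero nc
      trace : Carrier → Carrier
      trace y = y + c * σ y
      trace-fixed : ∀ y → c * σ (trace y) ≡ trace y
      trace-fixed y = begin
        c * σ (y + c * σ y) ≡⟨ cong (c *_) (trans (σ-+ y (c * σ y)) (cong (σ y +_) (trans (σ-* c (σ y)) (cong (σ c *_) (σ-involutive y))))) ⟩
        c * (σ y + σ c * y) ≡⟨ AS.solve 4 (λ c s d y → c :* (s :+ d :* y) := (c :* d) :* y :+ c :* s) refl c (σ y) (σ c) y ⟩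
        c * σ c * y + c * σ y ≡⟨ cong (_+ c * σ y) (trans (cong (_* y) nc) (*-identityˡ y)) ⟩
        y + c * σ y ∎
        where open ≡-Reasoning
      lower : ∀ {m} → HasCount (λ b → c * σ b ≡ b) m → q ≤ m
      lower (ys , (_ , en) , refl) = ℕ.*-cancelʳ-≤ q (length ys) q {{ℕ.>-nonZero (ℕ.≤-trans (s≤s z≤n) 2≤q)}}
        (ℕ.≤-trans (ℕ.≤-reflexive (sym cardL)) (fibre-bound _≟_ trace q
          (λ b zs u z → trinomial c 1# (- b) zs c≢0 u λ x m → trans (cong (_+ - b) (trans (cong (c * σ x +_) (*-identityˡ x)) (trans (+-comm _ _) (z x m)))) (-‿inverseʳ b))
          ys elements elements-unique λ y _ → proj₂ (en (trace y)) (trace-fixed y)))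

  q-decomposition : ∃[ q′ ] q ≡ suc (suc q′)
  q-decomposition = q ℕ.∸ 2 , sym (ℕ.m+[n∸m]≡n 2≤q)

  norm-one-count : HasCount (λ c → c * σ c ≡ 1#) (suc q)
  norm-one-count = norm-count (proj₂ q-decomposition)

  norm-fixed-count : HasCount (λ ((c , b) : Carrier × Carrier) → c * σ c ≡ 1# × c * σ b ≡ b) (suc q ℕ.* q)
  norm-fixed-count = count-Σ norm-one-count (fixed-count (proj₂ q-decomposition))

-- Self-reciprocal polynomials

parity : ∀ n → ∃[ j ] (n ≡ j ℕ.* 2 ⊎ n ≡ suc (j ℕ.* 2))
parity zero = 0 , inj₁ refl
parity (suc n) with parity n
... | j , inj₁ refl = j , inj₂ refl
... | j , inj₂ refl = suc j , inj₁ refl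

module Reciprocal (K : FiniteField) where
  open FieldSeries K
  open ListCount K

  trivial : Involution K
  trivial = record { σ = id ; σ-+ = λ _ _ → refl ; σ-* = λ _ _ → refl ; σ-1 = refl ; σ-involutive = λ _ → refl }

  open MonicMonoid K trivial
  open Mon using (body)

  square-root-of-one : ∀ {c} → c * c ≡ 1# → c ≡ 1# ⊎ c ≡ - 1#
  square-root-of-one {c} e with (c + - 1#) ≟ 0#
  ... | yes z = inj₁ (x∙y⁻¹≈ε⇒x≈y c 1# z)
  ... | no nz = inj₂ (x∙y⁻¹≈ε⇒x≈y c (- 1#) (trans (cong (c +_) (-‿involutive 1#)) (no-zero-divisors product≡0 nz)))
    where
    product≡0 : (c + - 1#) * (c + 1#) ≡ 0#
    product≡0 = trans (AS.solve 2 (λ c m → (c :+ m) :* (c :+ AS.con 1) := (c :* c :+ m) :+ c :* (AS.con 1 :+ m)) refl c (- 1#))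
      (trans (cong₂ _+_ (trans (cong (_+ - 1#) e) (-‿inverseʳ 1#)) (trans (cong (c *_) (-‿inverseʳ 1#)) (zeroʳ c))) (+-identityˡ 0#))

  double≡0 : ∀ {x} → 1# + 1# ≢ 0# → x + x ≡ 0# → x ≡ 0#
  double≡0 {x} 2≢0 e = no-zero-divisors (trans (trans (distribʳ x 1# 1#) (cong₂ _+_ (*-identityˡ x) (*-identityˡ x))) e) 2≢0

  minus-one-square : - 1# * - 1# ≡ 1#
  minus-one-square = trans (sym (-‿distribˡ-* 1# (- 1#))) (trans (cong -_ (*-identityˡ (- 1#))) (-‿involutive 1#))

  -- κ records whether 1 + 1 is nonzero. If it is, c = -1 is a second square root of 1, and it adds
  -- the single pair (-1, 0), since -b = b forces b = 0.
  counts : ∃[ κ ] ((κ ≡ 0 ⊎ κ ≡ 1) × HasCount NormOne (suc κ)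
    × HasCount NormOneFixed (card ℕ.+ κ))
  counts with (1# + 1#) ≟ 0#
  ... | yes 2≡0 = 0 , inj₁ refl , count-one 1# (*-identityˡ 1#) (λ c → only) ,
      subst (HasCount NormOneFixed) (trans (ℕ.*-identityˡ card) (sym (ℕ.+-identityʳ card)))
        (count-resp {Q = NormOneFixed} (λ { (c , b) (refl , _) → *-identityˡ 1# , *-identityˡ b }) (λ { (c , b) (e , _) → only e , refl })
          (count-Σ (count-one {P = _≡ 1#} 1# refl (λ _ e → e)) (λ _ _ → count-all)))
    where
    only : ∀ {c} → c * c ≡ 1# → c ≡ 1#
    only e with square-root-of-one e
    ... | inj₁ p = p
    ... | inj₂ p = trans p (sym (x∙y⁻¹≈ε⇒x≈y 1# (- 1#) (trans (cong (1# +_) (-‿involutive 1#)) 2≡0)))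
  ... | no 2≢0 = 1 , inj₂ refl ,
      count-resp {Q = NormOne} (λ { c (inj₁ refl) → *-identityˡ 1# ; c (inj₂ refl) → minus-one-square }) (λ c → square-root-of-one)
        (count-⊎ (count-one {P = _≡ 1#} 1# refl (λ _ e → e)) (count-one {P = _≡ - 1#} (- 1#) refl (λ _ e → e)) (λ { _ refl e → 1≢-1 e })) ,
      subst (HasCount NormOneFixed) (cong (ℕ._+ 1) (ℕ.*-identityˡ card))
        (count-resp {Q = NormOneFixed} (λ { (c , b) (inj₁ (refl , _)) → *-identityˡ 1# , *-identityˡ b ; (c , b) (inj₂ refl) → minus-one-square , zeroʳ (- 1#) }) cases
          (count-⊎ (count-Σ (count-one {P = _≡ 1#} 1# refl (λ _ e → e)) (λ _ _ → count-all))
            (count-one {P = _≡ (- 1# , 0#)} (- 1# , 0#) refl (λ _ e → e)) (λ { _ (e , _) refl → 1≢-1 (sym e) })))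
    where
    1≢-1 : 1# ≢ - 1#
    1≢-1 e = 2≢0 (trans (cong (1# +_) e) (-‿inverseʳ 1#))
    cases : ∀ ((c , b) : Carrier × Carrier) → c * c ≡ 1# × c * b ≡ b → (c ≡ 1# × 1# ≡ 1#) ⊎ (c , b) ≡ (- 1# , 0#)
    cases (c , b) (e , p) with square-root-of-one e
    ... | inj₁ q = inj₁ (q , refl)
    ... | inj₂ refl = inj₂ (cong (- 1# ,_) (double≡0 2≢0 (trans (cong (b +_) (sym (trans (trans (cong -_ (sym (*-identityˡ b))) (-‿distribˡ-* 1# b)) p))) (-‿inverseʳ b))))

  -- A self-dual f of degree n = N + 1 satisfies f = c x^n f(1/x) with c = f(0) = ±1.  Dividing it by 1 + c x as a
  -- power series gives g; the quotient is a polynomial as soon as g₀ = g_N.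
  module _ (f : Mon) (sd : f ~ ≡ f) (N : ℕ) (deg≡ : deg f ≡ suc N) where

    c : Carrier
    c = S f 0

    S≈dual : S f ≈ dualSeries f
    S≈dual k = trans (cong (λ z → S z k) (sym sd)) (S-~ f k)

    scale≡c : dualScale f ≡ c
    scale≡c = sym (trans (S≈dual 0) (dual-const f))

    c*c≡1 : c * c ≡ 1#
    c*c≡1 = trans (cong (_* c) (sym scale≡c)) (⁻¹-inverse c (const-nonzero f))

    c*c* : ∀ x → c * (c * x) ≡ x
    c*c* x = trans (sym (*-assoc _ _ _)) (trans (cong (_* x) c*c≡1) (*-identityˡ x))

    symmetry : ∀ i → i ≤ suc N → S f i ≡ c * S f (suc N ℕ.∸ i)
    symmetry i le = trans (S≈dual i) (cong₂ _*_ scale≡c (trans (rv-coeff (deg f) (S f) i (subst (i ≤_) (sym deg≡) le)) (cong (λ n → S f (n ℕ.∸ i)) deg≡)))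

    g : Ser
    g zero = c
    g (suc k) = S f (suc k) + - (c * g k)

    g-rec : ∀ k → S f (suc k) ≡ g (suc k) + c * g k
    g-rec k = sym (trans (+-assoc _ _ _) (trans (cong (S f (suc k) +_) (-‿inverseˡ _)) (+-identityʳ _)))

    g-below : g N ≡ c → Below (suc N) g
    g-below e (suc k) (s≤s N≤k) with k ℕ.≟ N
    ... | yes refl = trans (cong₂ (λ x y → x + - (c * y)) (trans (cong (S f) (sym deg≡)) (proj₁ (S-monic f))) e)
      (trans (cong (λ z → 1# + - z) c*c≡1) (-‿inverseʳ 1#))
    g-below e (suc (suc k)) (s≤s N≤k) | no ne =
      trans (cong₂ (λ x y → x + - (c * y)) (proj₂ (S-monic f) (suc (suc k)) (s≤s (subst (_≤ suc k) (sym deg≡) N<k))) (g-below e (suc k) N<k))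
        (trans (+-identityˡ _) (trans (cong -_ (zeroʳ c)) -0#≈0#))
      where
      N<k : N < suc k
      N<k = ℕ.≤∧≢⇒< N≤k (λ e → ne (sym e))
    g-below e (suc zero) (s≤s N≤k) | no ne = ⊥-elim (ne (sym (ℕ.n≤0⇒n≡0 N≤k)))

    -- As c² = 1, the monic divisor c + x is c (1 + c x), and the factor c passes to the quotient.
    g-product : mon (c ∷ []) ⊛ (c · g) ≈ S f
    g-product zero = c*c* c
    g-product (suc k) = trans (cong₂ _+_ (c*c* _) (⊛-identityˡ (c · g) k)) (sym (g-rec k))

    reducible-if-symmetric : g N ≡ c → Irr f → 1 ≤ N → ⊥
    reducible-if-symmetric e i 1≤N with monic-quotient (mon-monic (c ∷ [])) (S-monic f) (poly-· c (suc N , g-below e)) g-product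
    ... | m , mh , s with proj₂ (proj₂ (irr⇒irrSeries {f} i)) (mon-monic (c ∷ [])) mh g-product
    ...   | inj₂ refl = ℕ.<⇒≢ 1≤N (ℕ.suc-injective (trans s deg≡))

    -- The defect of symmetry of the quotient. It starts with c - g_N, and the symmetry of f makes
    -- it geometric with ratio -c.
    h : ℕ → Carrier
    h k = g k + - g (N ℕ.∸ k)

    h-rec : ∀ k → k < N → h (suc k) ≡ - (c * h k)
    h-rec k k<N = begin
      g (suc k) + - g j
        ≡⟨ cong (_+ - g j) (sym (trans (+-assoc _ _ _) (trans (cong (g (suc k) +_) (-‿inverseʳ _)) (+-identityʳ _)))) ⟩
      g (suc k) + c * g k + - (c * g k) + - g j
        ≡⟨ cong (λ z → z + - (c * g k) + - g j) (trans (sym (g-rec k)) (trans (symmetry (suc k) (s≤s (ℕ.<⇒≤ k<N)))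
             (trans (cong (λ i → c * S f i) N∸k) (trans (cong (c *_) (g-rec j)) (trans (distribˡ _ _ _) (cong (c * g (suc j) +_) (c*c* (g j)))))))) ⟩
      c * g (suc j) + g j + - (c * g k) + - g j
        ≡⟨ AS.solve 4 (λ a b m n → ((a :+ b) :+ m) :+ n := (m :+ a) :+ (b :+ n)) refl (c * g (suc j)) (g j) (- (c * g k)) (- g j) ⟩
      - (c * g k) + c * g (suc j) + (g j + - g j)
        ≡⟨ trans (cong (- (c * g k) + c * g (suc j) +_) (-‿inverseʳ _)) (+-identityʳ _) ⟩
      - (c * g k) + c * g (suc j)
        ≡⟨ cong (- (c * g k) +_) (sym (trans (cong -_ (sym (-‿distribʳ-* c (g (suc j))))) (-‿involutive _))) ⟩
      - (c * g k) + - (c * - g (suc j))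
        ≡⟨ -‿+-comm (c * g k) (c * - g (suc j)) ⟩
      - (c * g k + c * - g (suc j))
        ≡⟨ cong -_ (sym (distribˡ c (g k) (- g (suc j)))) ⟩
      - (c * (g k + - g (suc j)))
        ≡⟨ cong (λ i → - (c * (g k + - g i))) (sym N∸k) ⟩
      - (c * h k) ∎
      where
      open ≡-Reasoning
      j : ℕ
      j = N ℕ.∸ suc k
      N∸k : N ℕ.∸ k ≡ suc j
      N∸k = sym (trans (sym (ℕ.+-∸-assoc 1 k<N)) refl)

    h-descend : ∀ k → k ≤ N → h k ≡ 0# → h 0 ≡ 0#
    h-descend zero _ e = e
    h-descend (suc k) le e = h-descend k (ℕ.<⇒≤ le) (no-zero-divisors (trans (sym (-‿involutive _)) (trans (cong -_ (trans (sym (h-rec k le)) e)) -0#≈0#)) (const-nonzero f))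

    h0⇒symmetric : h 0 ≡ 0# → g N ≡ c
    h0⇒symmetric e = sym (x∙y⁻¹≈ε⇒x≈y _ _ e)

    -- At the middle index m = N - m the defect vanishes; its ratio is nonzero, so it vanishes at 0
    -- as well.
    odd-degree-symmetric : ∀ m → N ≡ m ℕ.* 2 → g N ≡ c
    odd-degree-symmetric m refl = h0⇒symmetric (h-descend m (ℕ.m≤m*n m 2)
      (trans (cong (λ i → g m + - g i) (trans (cong (ℕ._∸ m) (trans (ℕ.*-comm m 2) (cong (m ℕ.+_) (ℕ.+-identityʳ m)))) (ℕ.m+n∸m≡n m m))) (-‿inverseʳ _)))

    -- For c = -1 the ratio is 1, so h is constant. But h_N = -h_0 by construction, and 2 is nonzero
    -- because 1 ≠ -1.
    antisymmetric : c ≢ 1# → g N ≡ c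
    antisymmetric c≢1 with square-root-of-one c*c≡1
    ... | inj₁ e = ⊥-elim (c≢1 e)
    ... | inj₂ c≡-1 = h0⇒symmetric (double≡0 2≢0 (trans (cong (_+ h 0) (sym (constant N ℕ.≤-refl))) hN+h0))
      where
      2≢0 : 1# + 1# ≢ 0#
      2≢0 z = c≢1 (trans c≡-1 (sym (x∙y⁻¹≈ε⇒x≈y 1# (- 1#) (trans (cong (1# +_) (-‿involutive 1#)) z))))
      constant : ∀ k → k ≤ N → h k ≡ h 0
      constant zero _ = refl
      constant (suc k) le = trans (h-rec k le) (trans (cong (λ z → - (z * h k)) c≡-1)
        (trans (cong -_ (sym (-‿distribˡ-* 1# (h k)))) (trans (-‿involutive _) (trans (*-identityˡ _) (constant k (ℕ.<⇒≤ le))))))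
      hN+h0 : h N + h 0 ≡ 0#
      hN+h0 = trans (cong (λ i → g N + - g i + h 0) (ℕ.n∸n≡0 N)) (trans (AS.solve 4 (λ a m b n → (a :+ m) :+ (b :+ n) := (a :+ n) :+ (b :+ m)) refl (g N) (- g 0) (g 0) (- g N))
        (trans (cong₂ _+_ (-‿inverseʳ _) (-‿inverseʳ _)) (+-identityˡ 0#)))

    irr⇒c≡1 : Irr f → 1 ≤ N → c ≡ 1#
    irr⇒c≡1 i 1≤N with c ≟ 1#
    ... | yes e = e
    ... | no ne = ⊥-elim (reducible-if-symmetric (antisymmetric ne) i 1≤N)

  -- Reconciles two notions: `SelfReciprocal` has no scaling constant, while the dual divides by
  -- f(0). The value -1 is excluded by the factor found above.
  selfDual-irr-const : ∀ {f} → Irr f → f ~ ≡ f → 2 ≤ deg f → S f 0 ≡ 1#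
  selfDual-irr-const {f@(mk (_ ∷ w) _)} i sd (s≤s 1≤) = irr⇒c≡1 f sd (length w) refl i 1≤

  selfDual-irr-odd : ∀ {f} → Irr f → f ~ ≡ f → ∀ m → deg f ≡ suc (suc m ℕ.* 2) → ⊥
  selfDual-irr-odd {f} i sd m e = reducible-if-symmetric f sd (suc m ℕ.* 2) e (odd-degree-symmetric f sd (suc m ℕ.* 2) e (suc m) refl) i (s≤s z≤n)

  deg1-irr : ∀ f → deg f ≡ 1 → Irr f
  deg1-irr f e = ℕ.≤-reflexive (sym e) , λ g h p → split g h (trans (sym (deg-∙ g h)) (trans (cong deg p) e))
    where
    split : ∀ g h → deg g ℕ.+ deg h ≡ 1 → deg g ≡ 0 ⊎ deg h ≡ 0
    split g h s with deg g
    ... | zero = inj₁ refl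
    ... | suc k = inj₂ (ℕ.m+n≡0⇒n≡0 k (ℕ.suc-injective s))

  ones-dual : ∀ w → twistedReverse (1# ⁻¹) w ≡ reverse w
  ones-dual w = trans (map-cong (λ x → trans (cong (_* x) 1⁻¹≡1) (*-identityˡ x)) (reverse (map id w))) (trans (map-id _) (cong reverse (map-id w)))
    where
    1⁻¹≡1 : 1# ⁻¹ ≡ 1#
    1⁻¹≡1 = trans (sym (*-identityʳ _)) (⁻¹-inverse 1# 1≢0)

  selfRecipIrr-count : ∀ d n → 1 ≤ d → HasCount (SelfRecipIrr d) n → HasCount (λ f → deg f ≡ 2 ℕ.* d × Irr f × f ~ ≡ f) n
  selfRecipIrr-count d n 1≤d c = count-resp to from (count-vec Ψ (λ w (_ , nz , _) z → nz (trans (const-mon w) z)) c)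
    where
    Ψ : List Carrier → Set
    Ψ w = (1 ≤ 2 ℕ.* d × ¬ Reducible (w ∷ʳ 1#)) × SelfReciprocal (w ∷ʳ 1#)
    2≤2d : 2 ≤ 2 ℕ.* d
    2≤2d = ℕ.*-monoʳ-≤ 2 1≤d
    dual-reverse : ∀ f → S f 0 ≡ 1# → dualList f ≡ reverse (body f ∷ʳ 1#)
    dual-reverse f e = trans (cong (λ z → twistedReverse (z ⁻¹) (body f ∷ʳ 1#)) e) (ones-dual (body f ∷ʳ 1#))
    const≡1 : ∀ f → 2 ≤ deg f → reverse (body f ∷ʳ 1#) ≡ body f ∷ʳ 1# → S f 0 ≡ 1#
    const≡1 (mk (a ∷ w) _) _ r = ∷-injectiveˡ (trans (sym r) (reverse-ends a 1# w))
    to : ∀ f → deg f ≡ 2 ℕ.* d × Ψ (body f) → deg f ≡ 2 ℕ.* d × Irr f × f ~ ≡ f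
    to f (e , (1≤ , red) , _ , r) = e , ¬reducible⇒irr f (subst (1 ≤_) (sym e) 1≤ , red) ,
      list⇒selfDual (trans (dual-reverse f (const≡1 f (subst (2 ≤_) (sym e) 2≤2d) r)) r)
    from : ∀ f → deg f ≡ 2 ℕ.* d × Irr f × f ~ ≡ f → deg f ≡ 2 ℕ.* d × Ψ (body f)
    from f (e , i , sd) = e , (subst (1 ≤_) e (proj₁ i) , proj₂ (irr⇒¬reducible f i)) ,
      (λ z → const-nonzero f (trans (sym (const-mon (body f))) z)) ,
      trans (sym (dual-reverse f (selfDual-irr-const {f} i sd (subst (2 ≤_) (sym e) 2≤2d)))) (selfDual⇒list sd)

  -- The involution f ↦ f* has one fixed irreducible x + c for each c with c² = 1, none of odd degree ≥ 3,
  -- and the self-reciprocal ones in even degree.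
  spread : (ℕ → ℕ) → ℕ → ℕ
  spread t zero = t 0
  spread t (suc zero) = 0
  spread t (suc (suc n)) = spread (λ d → t (suc d)) n

  spread-even : ∀ t j → spread t (j ℕ.* 2) ≡ t j
  spread-even t zero = refl
  spread-even t (suc j) = spread-even (λ d → t (suc d)) j

  spread-odd : ∀ t j → spread t (suc (j ℕ.* 2)) ≡ 0
  spread-odd t zero = refl
  spread-odd t (suc j) = spread-odd (λ d → t (suc d)) j

  module _ (srim : ℕ → ℕ) (srim-count : ∀ d → 1 ≤ d → HasCount (SelfRecipIrr d) (srim d)) {κ : ℕ}
      (norm-count : HasCount NormOne (suc κ))
      (fixed-count : HasCount NormOneFixed (card ℕ.+ κ)) where

    irrCount : ℕ → ℕ
    irrCount zero = 0
    irrCount (suc zero) = suc κ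
    irrCount (suc (suc n)) = spread (λ d → srim (suc d)) n

    irr-count : ∀ d → 1 ≤ d → HasCount (λ p → deg p ≡ d × Irr p × p ~ ≡ p) (irrCount d)
    irr-count (suc zero) _ = count-resp (λ f (e , sd) → e , deg1-irr f e , sd) (λ f (e , _ , sd) → e , sd) (selfDual-count norm-count fixed-count 1)
    irr-count (suc (suc n)) _ with parity n
    ... | j , inj₁ refl = subst (HasCount _) (sym (spread-even (λ d → srim (suc d)) j))
      (count-resp (λ f (e , r) → trans e (ℕ.*-comm 2 (suc j)) , r) (λ f (e , r) → trans e (ℕ.*-comm (suc j) 2) , r)
        (selfRecipIrr-count (suc j) (srim (suc j)) (s≤s z≤n) (srim-count (suc j) (s≤s z≤n))))
    ... | j , inj₂ refl = subst (HasCount _) (sym (spread-odd (λ d → srim (suc d)) j)) (count-zero λ f (e , i , sd) → selfDual-irr-odd {f} i sd j e)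

-- Opened this late because the constructor +_ makes left sections of the field addition ambiguous.
open import Data.Integer using (ℤ; +_; -1ℤ) renaming (-_ to neg)
import Data.Integer as ℤ hiding (+_; -_)
import Data.Integer.Properties as ℤ
open import Data.Integer.Tactic.RingSolver using (solve-∀)
open import Data.Nat.Combinatorics using (_C_; nCk≡nC[n∸k]; nCk+nC[k+1]≡[n+1]C[k+1]; k>n⇒nCk≡0)
open import Data.Nat.Divisibility using (∣m+n∣m⇒∣n) renaming (_∣_ to _ℕ∣_; _∣?_ to _ℕ∣?_; ∣-refl to ℕ∣-refl)
open import Data.Nat.DivMod using ([m+kn]%n≡m%n)
open import Data.Nat.ListAction using (sum)

-- Integer power series and the coefficients of ((1 + y) / (1 - y))^s

open PowerSeries ℤ.+-*-isCommutativeRing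
  using (Ser; _≈_; _≈[_]_; tl; _◂_; 𝟘; 𝟙; _⊕_; _·_; _⊛_; shift; X^; ≈-refl; ≈-sym; ≈-trans; ⊕-cong; ◂-cong; ⊛-cong; ⊛-cong[];
         ⊛-comm; ⊛-assoc; ⊛-distribʳ; ·-⊛; ⊛-identityˡ; ⊛-identityʳ; shift-cong; shift-shift; X^-⊛; shift-+; shift-<; shift-≥;
         ⊛-cancelʳ[]; module SS; serRing)
open SS using (_:*_; _:=_)

IsSign : ℤ → Set
IsSign ε = ε ≡ + 1 ⊎ ε ≡ neg (+ 1)

sumTo : ℕ → (ℕ → ℤ) → ℤ
sumTo zero h = + 0
sumTo (suc n) h = h 0 ℤ.+ sumTo n (h ∘ suc)

sum-applyUpTo : ∀ (h : ℕ → ℤ) (φ : ℕ → ℕ) n → sumℤ (map h (applyUpTo φ n)) ≡ sumTo n (h ∘ φ)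
sum-applyUpTo h φ zero = refl
sum-applyUpTo h φ (suc n) = cong (λ z → h (φ 0) ℤ.+ z) (sum-applyUpTo h (φ ∘ suc) n)

sumTo-cong : ∀ n {h h′ : ℕ → ℤ} → (∀ i → i ℕ.< n → h i ≡ h′ i) → sumTo n h ≡ sumTo n h′
sumTo-cong zero e = refl
sumTo-cong (suc n) e = cong₂ ℤ._+_ (e 0 (s≤s z≤n)) (sumTo-cong n λ i i<n → e (suc i) (s≤s i<n))

sumTo-+ : ∀ n (h h′ : ℕ → ℤ) → sumTo n (λ i → h i ℤ.+ h′ i) ≡ sumTo n h ℤ.+ sumTo n h′
sumTo-+ zero h h′ = refl
sumTo-+ (suc n) h h′ = trans (cong (λ z → h 0 ℤ.+ h′ 0 ℤ.+ z) (sumTo-+ n (h ∘ suc) (h′ ∘ suc)))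
  (interchange (h 0) (h′ 0) _ _)
  where
  interchange : ∀ a b c d → (a ℤ.+ b) ℤ.+ (c ℤ.+ d) ≡ (a ℤ.+ c) ℤ.+ (b ℤ.+ d)
  interchange = solve-∀

sumTo-* : ∀ n c (h : ℕ → ℤ) → sumTo n (λ i → c ℤ.* h i) ≡ c ℤ.* sumTo n h
sumTo-* zero c h = sym (ℤ.*-zeroʳ c)
sumTo-* (suc n) c h = trans (cong (λ z → c ℤ.* h 0 ℤ.+ z) (sumTo-* n c (h ∘ suc))) (sym (ℤ.*-distribˡ-+ c _ _))

sumTo-suc : ∀ n (h : ℕ → ℤ) → sumTo (suc n) h ≡ sumTo n h ℤ.+ h n
sumTo-suc zero h = ℤ.+-comm (h 0) (+ 0)
sumTo-suc (suc n) h = trans (cong (λ z → h 0 ℤ.+ z) (sumTo-suc n (h ∘ suc))) (sym (ℤ.+-assoc (h 0) _ _))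

⊛-sumTo : ∀ f g n → (f ⊛ g) n ≡ sumTo (suc n) (λ k → f k ℤ.* g (n ℕ.∸ k))
⊛-sumTo f g zero = sym (ℤ.+-identityʳ _)
⊛-sumTo f g (suc n) = cong (λ z → f 0 ℤ.* g (suc n) ℤ.+ z) (⊛-sumTo (tl f) g n)

⋆≈⊛ : ∀ f g → (f ⋆ g) ≈ f ⊛ g
⋆≈⊛ f g n = trans (sum-applyUpTo (λ k → f k ℤ.* g (n ℕ.∸ k)) (λ k → k) (suc n)) (sym (⊛-sumTo f g n))

-- stretch k f is f(x^(k+1)).
stretchDec : ∀ {k} n → Ser → Dec (suc k ℕ∣ n) → ℤ
stretchDec n f (yes (divides e _)) = f e
stretchDec n f (no _) = + 0

stretch : ℕ → Ser → Ser
stretch k f n = stretchDec n f (suc k ℕ∣? n)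

stretchDec-yes : ∀ {k n} f e (d : Dec (suc k ℕ∣ n)) → n ≡ e ℕ.* suc k → stretchDec n f d ≡ f e
stretchDec-yes {k} f e (yes (divides e′ p)) q = cong f (ℕ.*-cancelʳ-≡ e′ e (suc k) (trans (sym p) q))
stretchDec-yes f e (no ¬p) q = ⊥-elim (¬p (divides e q))

stretchDec-no : ∀ {k n} f (d : Dec (suc k ℕ∣ n)) → ¬ (suc k ℕ∣ n) → stretchDec n f d ≡ + 0
stretchDec-no f (yes p) ¬p = ⊥-elim (¬p p)
stretchDec-no f (no _) ¬p = refl

stretch-* : ∀ k f e → stretch k f (e ℕ.* suc k) ≡ f e
stretch-* k f e = stretchDec-yes f e (suc k ℕ∣? (e ℕ.* suc k)) refl

stretch-cong : ∀ k {f g} → f ≈ g → stretch k f ≈ stretch k g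
stretch-cong k p n with suc k ℕ∣? n
... | yes (divides e _) = p e
... | no _ = refl

stretch-⊕ : ∀ k f g → stretch k (f ⊕ g) ≈ stretch k f ⊕ stretch k g
stretch-⊕ k f g n with suc k ℕ∣? n
... | yes (divides e _) = refl
... | no _ = refl

stretch-· : ∀ k c f → stretch k (c · f) ≈ c · stretch k f
stretch-· k c f n with suc k ℕ∣? n
... | yes (divides e _) = refl
... | no _ = sym (ℤ.*-zeroʳ c)

stretch-◂ : ∀ k f → stretch k (+ 0 ◂ f) ≈ shift (suc k) (stretch k f)
stretch-◂ k f n with suc k ℕ.≤? n
... | no n<k = trans (small (suc k ℕ∣? n)) (sym (shift-< (suc k) (stretch k f) n (ℕ.≰⇒> n<k)))
  where
  small : ∀ d → stretchDec n (+ 0 ◂ f) d ≡ + 0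
  small (yes (divides zero _)) = refl
  small (yes (divides (suc e) p)) = ⊥-elim (n<k (subst (suc k ℕ.≤_) (sym p) (ℕ.m≤m+n (suc k) (e ℕ.* suc k))))
  small (no _) = refl
... | yes k≤n = subst (λ n → stretch k (+ 0 ◂ f) n ≡ shift (suc k) (stretch k f) n) (ℕ.m+[n∸m]≡n k≤n)
    (trans (large (n ℕ.∸ suc k) (suc k ℕ∣? (n ℕ.∸ suc k))) (sym (shift-+ (suc k) (stretch k f) (n ℕ.∸ suc k))))
  where
  large : ∀ m (d : Dec (suc k ℕ∣ m)) → stretch k (+ 0 ◂ f) (suc k ℕ.+ m) ≡ stretchDec m f (suc k ℕ∣? m)
  large m (yes (divides e p)) = trans (stretchDec-yes (+ 0 ◂ f) (suc e) (suc k ℕ∣? (suc k ℕ.+ m)) (cong (suc k ℕ.+_) p))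
    (sym (stretchDec-yes f e (suc k ℕ∣? m) p))
  large m (no ¬p) = trans (stretchDec-no (+ 0 ◂ f) (suc k ℕ∣? (suc k ℕ.+ m)) (λ q → ¬p (∣m+n∣m⇒∣n q ℕ∣-refl)))
    (sym (stretchDec-no f (suc k ℕ∣? m) ¬p))

lin : ℤ → ℕ → Ser
lin c d = 𝟙 ⊕ c · X^ d

lin-⊛ : ∀ c d f → lin c d ⊛ f ≈ f ⊕ c · shift d f
lin-⊛ c d f = ≈-trans (⊛-distribʳ f 𝟙 (c · X^ d))
  (⊕-cong (⊛-identityˡ f) (≈-trans (·-⊛ c (X^ d) f) (λ n → cong (c ℤ.*_) (X^-⊛ d f n))))

stretch-shift : ∀ k d f → stretch k (shift d f) ≈ shift (d ℕ.* suc k) (stretch k f)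
stretch-shift k zero f = ≈-refl
stretch-shift k (suc d) f = ≈-trans (stretch-◂ k (shift d f))
  (≈-trans (shift-cong (suc k) (stretch-shift k d f)) (≈-sym (shift-shift (suc k) (d ℕ.* suc k) (stretch k f))))

stretch-lin* : ∀ k c d f → stretch k (lin c d ⊛ f) ≈ lin c (d ℕ.* suc k) ⊛ stretch k f
stretch-lin* k c d f = ≈-trans (stretch-cong k (lin-⊛ c d f)) (≈-trans (stretch-⊕ k f (c · shift d f))
  (≈-trans (⊕-cong {x = stretch k f} ≈-refl (≈-trans (stretch-· k c (shift d f)) (λ n → cong (c ℤ.*_) (stretch-shift k d f n))))
    (≈-sym (lin-⊛ c (d ℕ.* suc k) (stretch k f)))))

stretch-lin : ∀ k c f → stretch k (lin c 1 ⊛ f) ≈ lin c (suc k) ⊛ stretch k f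
stretch-lin k c f = subst (λ d → stretch k (lin c 1 ⊛ f) ≈ lin c d ⊛ stretch k f) (ℕ.*-identityˡ (suc k)) (stretch-lin* k c 1 f)

lin-conjugate : ∀ c d → lin (neg c) d ⊛ lin c d ≈ lin (neg (c ℤ.* c)) (d ℕ.* 2)
lin-conjugate c d n = trans (lin-⊛ (neg c) d (lin c d) n)
  (trans (cong (λ z → 𝟙 n ℤ.+ c ℤ.* X^ d n ℤ.+ neg c ℤ.* z) (shifted n)) (ident c (𝟙 n) (X^ d n) (X^ (d ℕ.* 2) n)))
  where
  ident : ∀ c x y z → x ℤ.+ c ℤ.* y ℤ.+ neg c ℤ.* (y ℤ.+ c ℤ.* z) ≡ x ℤ.+ neg (c ℤ.* c) ℤ.* z
  ident = solve-∀
  shifted : shift d (lin c d) ≈ X^ d ⊕ c · X^ (d ℕ.* 2)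
  shifted n = trans (sym (X^-⊛ d (lin c d) n)) (trans (⊛-comm (X^ d) (lin c d) n) (trans (lin-⊛ c d (X^ d) n)
    (cong (λ z → X^ d n ℤ.+ c ℤ.* z) (trans (sym (shift-shift d d 𝟙 n)) (cong (λ e → X^ e n)
      (trans (cong (d ℕ.+_) (sym (ℕ.+-identityʳ d))) (ℕ.*-comm 2 d)))))))

-- The convention for negative lower indices is made so that ε contributes a mere factor ε^k.
binom-sign : ∀ {ε} → IsSign ε → ∀ m k → binom m (ε ℤ.* + k) ≡ ε ℤ.^ k ℤ.* + (m C k)
binom-sign (inj₁ refl) m k = trans (cong (binom m) (ℤ.*-identityˡ (+ k)))
  (sym (trans (cong (ℤ._* + (m C k)) (ℤ.^-zeroˡ k)) (ℤ.*-identityˡ _)))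
binom-sign (inj₂ refl) m zero = sym (ℤ.*-identityˡ _)
binom-sign (inj₂ refl) m (suc k) = cong (binom m) (ℤ.-1*i≡-i (+ suc k))

term : ℕ → ℕ → ℕ → ℤ
term e s i = (+ 2) ℤ.^ suc i ℤ.* + (e C i) ℤ.* + (s C suc i)

-- coeff s e is the coefficient of y^e in ((1 + y) / (1 - y))^s.
coeff : ℕ → ℕ → ℤ
coeff s zero = + 1
coeff s (suc e) = sumTo (suc e) (term e s)

-- The signs ε^(e-i) and ε^i combine to ε^e whatever i is, and the symmetry of binomial coefficients
-- turns C(e-1, e-i) into C(e-1, i-1).
inner-coeff : ∀ {ε} → IsSign ε → ∀ e s → inner ε (suc e) s ≡ ε ℤ.^ suc e ℤ.* coeff s (suc e)
inner-coeff {ε} sg e s = trans (cong sumℤ (sym (map-∘ {g = h} {f = suc} (upTo (suc e)))))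
  (trans (sum-applyUpTo (h ∘ suc) (λ k → k) (suc e))
    (trans (sumTo-cong (suc e) pointwise) (sumTo-* (suc e) (ε ℤ.^ suc e) (term e s))))
  where
  h : ℕ → ℤ
  h i = (+ 2) ℤ.^ i ℤ.* binom e (ε ℤ.* (+ suc e ℤ.- + i)) ℤ.* binom s (ε ℤ.* + i)
  regroup : ∀ a b c d f → a ℤ.* (b ℤ.* c) ℤ.* (d ℤ.* f) ≡ (b ℤ.* d) ℤ.* (a ℤ.* c ℤ.* f)
  regroup = solve-∀
  pointwise : ∀ i → i ℕ.< suc e →
    (+ 2) ℤ.^ suc i ℤ.* binom e (ε ℤ.* (+ suc e ℤ.- + suc i)) ℤ.* binom s (ε ℤ.* + suc i) ≡ ε ℤ.^ suc e ℤ.* term e s i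
  pointwise i (s≤s i≤e) = begin
    (+ 2) ℤ.^ suc i ℤ.* binom e (ε ℤ.* (+ suc e ℤ.- + suc i)) ℤ.* binom s (ε ℤ.* + suc i)
      ≡⟨ cong (λ z → (+ 2) ℤ.^ suc i ℤ.* binom e (ε ℤ.* z) ℤ.* binom s (ε ℤ.* + suc i))
           (trans (ℤ.m-n≡m⊖n (suc e) (suc i)) (ℤ.⊖-≥ (s≤s i≤e))) ⟩
    (+ 2) ℤ.^ suc i ℤ.* binom e (ε ℤ.* + (e ℕ.∸ i)) ℤ.* binom s (ε ℤ.* + suc i)
      ≡⟨ cong₂ (λ y z → (+ 2) ℤ.^ suc i ℤ.* y ℤ.* z) (binom-sign sg e (e ℕ.∸ i)) (binom-sign sg s (suc i)) ⟩
    (+ 2) ℤ.^ suc i ℤ.* (ε ℤ.^ (e ℕ.∸ i) ℤ.* + (e C (e ℕ.∸ i))) ℤ.* (ε ℤ.^ suc i ℤ.* + (s C suc i))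
      ≡⟨ regroup ((+ 2) ℤ.^ suc i) (ε ℤ.^ (e ℕ.∸ i)) (+ (e C (e ℕ.∸ i))) (ε ℤ.^ suc i) (+ (s C suc i)) ⟩
    (ε ℤ.^ (e ℕ.∸ i) ℤ.* ε ℤ.^ suc i) ℤ.* ((+ 2) ℤ.^ suc i ℤ.* + (e C (e ℕ.∸ i)) ℤ.* + (s C suc i))
      ≡⟨ cong₂ (λ y z → y ℤ.* ((+ 2) ℤ.^ suc i ℤ.* + z ℤ.* + (s C suc i)))
           (trans (sym (ℤ.^-distribˡ-+-* ε (e ℕ.∸ i) (suc i)))
             (cong (ε ℤ.^_) (trans (ℕ.+-suc (e ℕ.∸ i) i) (cong suc (ℕ.m∸n+n≡m i≤e)))))
           (sym (nCk≡nC[n∸k] i≤e)) ⟩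
    ε ℤ.^ suc e ℤ.* term e s i ∎
    where open ≡-Reasoning

pascal : ∀ n k → + (suc n C suc k) ≡ + (n C k) ℤ.+ + (n C suc k)
pascal n k = trans (cong +_ (sym (nCk+nC[k+1]≡[n+1]C[k+1] n k))) (ℤ.pos-+ (n C k) (n C suc k))

-- The coefficient form of (1 - y) G_(s+1) = (1 + y) G_s for the generating series G_s. Pascal's
-- rule in s produces the sums of `diag`; Pascal's rule in e reduces those for e + 1 to those for e.
coeff-rec : ∀ s e → coeff (suc s) (suc e) ≡ coeff s (suc e) ℤ.+ coeff (suc s) e ℤ.+ coeff s e
coeff-rec s zero = trans (cong (λ z → + 2 ℤ.* + 1 ℤ.* z ℤ.+ + 0) (pascal s 0)) (expand (+ (s C 1)))
  where
  expand : ∀ x → + 2 ℤ.* + 1 ℤ.* (+ 1 ℤ.+ x) ℤ.+ + 0 ≡ + 2 ℤ.* + 1 ℤ.* x ℤ.+ + 0 ℤ.+ + 1 ℤ.+ + 1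
  expand = solve-∀
coeff-rec s (suc e) = begin
    sumTo N (term (suc e) (suc s))                                       ≡⟨ sumTo-cong N (λ i _ → top i) ⟩
    sumTo N (λ i → term (suc e) s i ℤ.+ diag (suc e) i)                  ≡⟨ sumTo-+ N (term (suc e) s) (diag (suc e)) ⟩
    coeff s (suc (suc e)) ℤ.+ sumTo N (diag (suc e))                     ≡⟨ cong (λ z → coeff s (suc (suc e)) ℤ.+ z) diag-rec ⟩
    coeff s (suc (suc e)) ℤ.+ (sumTo (suc e) (diag e) ℤ.+ (coeff s (suc e) ℤ.+ coeff s (suc e)))
      ≡⟨ regroup (coeff s (suc (suc e))) (sumTo (suc e) (diag e)) (coeff s (suc e)) ⟩
    coeff s (suc (suc e)) ℤ.+ (coeff s (suc e) ℤ.+ sumTo (suc e) (diag e)) ℤ.+ coeff s (suc e)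
      ≡⟨ cong (λ z → coeff s (suc (suc e)) ℤ.+ z ℤ.+ coeff s (suc e))
           (sym (trans (sumTo-cong (suc e) (λ i _ → low i)) (sumTo-+ (suc e) (term e s) (diag e)))) ⟩
    coeff s (suc (suc e)) ℤ.+ coeff (suc s) (suc e) ℤ.+ coeff s (suc e) ∎
  where
  open ≡-Reasoning
  N : ℕ
  N = suc (suc e)
  diag : ℕ → ℕ → ℤ
  diag e i = (+ 2) ℤ.^ suc i ℤ.* + (e C i) ℤ.* + (s C i)
  dist : ∀ a b c d → a ℤ.* b ℤ.* (c ℤ.+ d) ≡ a ℤ.* b ℤ.* d ℤ.+ a ℤ.* b ℤ.* c
  dist = solve-∀
  regroup : ∀ a b c → a ℤ.+ (b ℤ.+ (c ℤ.+ c)) ≡ a ℤ.+ (c ℤ.+ b) ℤ.+ c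
  regroup = solve-∀
  split : ∀ e i → term e (suc s) i ≡ term e s i ℤ.+ diag e i
  split e i = trans (cong ((+ 2) ℤ.^ suc i ℤ.* + (e C i) ℤ.*_) (pascal s i)) (dist ((+ 2) ℤ.^ suc i) (+ (e C i)) (+ (s C i)) (+ (s C suc i)))
  top : ∀ i → term (suc e) (suc s) i ≡ term (suc e) s i ℤ.+ diag (suc e) i
  top = split (suc e)
  low : ∀ i → term e (suc s) i ≡ term e s i ℤ.+ diag e i
  low = split e
  step : ∀ a b c d → + 2 ℤ.* a ℤ.* (b ℤ.+ c) ℤ.* d ≡ (+ 2 ℤ.* a) ℤ.* c ℤ.* d ℤ.+ (a ℤ.* b ℤ.* d ℤ.+ a ℤ.* b ℤ.* d)
  step = solve-∀
  -- The last summand carries C(e, e + 1) = 0.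
  drop-last : sumTo N (diag e) ≡ sumTo (suc e) (diag e)
  drop-last = trans (sumTo-suc (suc e) (diag e))
    (trans (cong (λ z → sumTo (suc e) (diag e) ℤ.+ (+ 2) ℤ.^ N ℤ.* + z ℤ.* + (s C suc e)) (k>n⇒nCk≡0 (ℕ.n<1+n e)))
      (trans (cong (λ z → sumTo (suc e) (diag e) ℤ.+ z ℤ.* + (s C suc e)) (ℤ.*-zeroʳ ((+ 2) ℤ.^ N))) (ℤ.+-identityʳ (sumTo (suc e) (diag e)))))
  diag-rec : sumTo N (diag (suc e)) ≡ sumTo (suc e) (diag e) ℤ.+ (coeff s (suc e) ℤ.+ coeff s (suc e))
  diag-rec = begin
    diag e 0 ℤ.+ sumTo (suc e) (λ i → diag (suc e) (suc i))
      ≡⟨ cong (λ z → diag e 0 ℤ.+ z) (trans (sumTo-cong (suc e) (λ i _ → trans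
           (cong (λ z → (+ 2) ℤ.^ suc (suc i) ℤ.* z ℤ.* + (s C suc i)) (pascal e i))
           (step ((+ 2) ℤ.^ suc i) (+ (e C i)) (+ (e C suc i)) (+ (s C suc i)))))
           (trans (sumTo-+ (suc e) (λ i → diag e (suc i)) (λ i → term e s i ℤ.+ term e s i))
             (cong (λ z → sumTo (suc e) (λ i → diag e (suc i)) ℤ.+ z) (sumTo-+ (suc e) (term e s) (term e s))))) ⟩
    diag e 0 ℤ.+ (sumTo (suc e) (λ i → diag e (suc i)) ℤ.+ (coeff s (suc e) ℤ.+ coeff s (suc e)))
      ≡⟨ sym (ℤ.+-assoc (diag e 0) (sumTo (suc e) (λ i → diag e (suc i))) (coeff s (suc e) ℤ.+ coeff s (suc e))) ⟩
    sumTo N (diag e) ℤ.+ (coeff s (suc e) ℤ.+ coeff s (suc e))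
      ≡⟨ cong (ℤ._+ (coeff s (suc e) ℤ.+ coeff s (suc e))) drop-last ⟩
    sumTo (suc e) (diag e) ℤ.+ (coeff s (suc e) ℤ.+ coeff s (suc e)) ∎

-- The expansion of ((1 + ε y) / (1 - ε y))^s.
coeffε : ℤ → ℕ → Ser
coeffε ε s e = ε ℤ.^ e ℤ.* coeff s e

coeff-lin : ∀ {ε} → IsSign ε → ∀ s → lin (neg ε) 1 ⊛ coeffε ε (suc s) ≈ lin ε 1 ⊛ coeffε ε s
coeff-lin {ε} sg s n = trans (lin-⊛ (neg ε) 1 (coeffε ε (suc s)) n) (trans (eq n) (sym (lin-⊛ ε 1 (coeffε ε s) n)))
  where
  eq : coeffε ε (suc s) ⊕ (neg ε) · (+ 0 ◂ coeffε ε (suc s)) ≈ coeffε ε s ⊕ ε · (+ 0 ◂ coeffε ε s)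
  eq zero = trans (cong (λ z → + 1 ℤ.+ z) (ℤ.*-zeroʳ (neg ε))) (cong (λ z → + 1 ℤ.+ z) (sym (ℤ.*-zeroʳ ε)))
  eq (suc e) = trans (cong (λ z → ε ℤ.^ suc e ℤ.* z ℤ.+ (neg ε) ℤ.* (ε ℤ.^ e ℤ.* coeff (suc s) e)) (coeff-rec s e))
    (ident ε (ε ℤ.^ e) (coeff s (suc e)) (coeff (suc s) e) (coeff s e))
    where
    ident : ∀ x p a b c → x ℤ.* p ℤ.* (a ℤ.+ b ℤ.+ c) ℤ.+ (neg x) ℤ.* (p ℤ.* b) ≡ x ℤ.* p ℤ.* a ℤ.+ x ℤ.* (p ℤ.* c)
    ident = solve-∀

pow : Ser → ℕ → Ser
pow f zero = 𝟙
pow f (suc n) = f ⊛ pow f n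

coeff-zero : ∀ e → coeff 0 (suc e) ≡ + 0
coeff-zero e = trans (sumTo-cong (suc e) λ i _ → ℤ.*-zeroʳ ((+ 2) ℤ.^ suc i ℤ.* + (e C i))) (sumTo-0 (suc e))
  where
  sumTo-0 : ∀ n → sumTo n (λ _ → + 0) ≡ + 0
  sumTo-0 zero = refl
  sumTo-0 (suc n) = trans (ℤ.+-identityˡ _) (sumTo-0 n)

stretch-𝟙 : ∀ k → stretch k 𝟙 ≈ 𝟙
stretch-𝟙 k zero = stretchDec-yes 𝟙 0 (suc k ℕ∣? 0) refl
stretch-𝟙 k (suc n) = go (suc k ℕ∣? suc n)
  where
  go : ∀ d → stretchDec {k} (suc n) 𝟙 d ≡ + 0
  go (yes (divides (suc e) _)) = refl
  go (no _) = refl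

-- That expansion at y = x^(k+1), with its denominator cleared. Each step in s trades one factor 1 -
-- ε x^(k+1) for one 1 + ε x^(k+1).
stretch-coeff : ∀ {ε} → IsSign ε → ∀ k s →
  stretch k (coeffε ε s) ⊛ pow (lin (neg ε) (suc k)) s ≈ pow (lin ε (suc k)) s
stretch-coeff {ε} sg k zero = ≈-trans (⊛-identityʳ _) (≈-trans (stretch-cong k base) (stretch-𝟙 k))
  where
  base : coeffε ε 0 ≈ 𝟙
  base zero = refl
  base (suc e) = trans (cong (ε ℤ.^ suc e ℤ.*_) (coeff-zero e)) (ℤ.*-zeroʳ (ε ℤ.^ suc e))
stretch-coeff {ε} sg k (suc s) = begin
    G (suc s) ⊛ (L⁻ ⊛ pow L⁻ s)   ≈⟨ SS.solve 3 (λ g l p → g :* (l :* p) := (l :* g) :* p) ≈-refl (G (suc s)) L⁻ (pow L⁻ s) ⟩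
    (L⁻ ⊛ G (suc s)) ⊛ pow L⁻ s   ≈⟨ ⊛-cong {g = pow L⁻ s} (≈-trans (≈-sym (stretch-lin k (neg ε) (coeffε ε (suc s))))
                                        (≈-trans (stretch-cong k (coeff-lin sg s)) (stretch-lin k ε (coeffε ε s)))) ≈-refl ⟩
    (L⁺ ⊛ G s) ⊛ pow L⁻ s         ≈⟨ ⊛-assoc L⁺ (G s) (pow L⁻ s) ⟩
    L⁺ ⊛ (G s ⊛ pow L⁻ s)         ≈⟨ ⊛-cong {f = L⁺} ≈-refl (stretch-coeff sg k s) ⟩
    L⁺ ⊛ pow L⁺ s ∎
  where
  open import Relation.Binary.Reasoning.Setoid (CommutativeRing.setoid serRing)
  G : ℕ → Ser
  G s = stretch k (coeffε ε s)
  L⁻ L⁺ : Ser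
  L⁻ = lin (neg ε) (suc k)
  L⁺ = lin ε (suc k)

-- Partitions

sumℤ-++ : ∀ xs ys → sumℤ (xs ++ ys) ≡ sumℤ xs ℤ.+ sumℤ ys
sumℤ-++ [] ys = sym (ℤ.+-identityˡ _)
sumℤ-++ (x ∷ xs) ys = trans (cong (λ z → x ℤ.+ z) (sumℤ-++ xs ys)) (sym (ℤ.+-assoc x _ _))

sumℤ-concatMap : {I A : Set} (w : A → ℤ) (h : I → List A) (is : List I) →
  sumℤ (map w (concatMap h is)) ≡ sumℤ (map (λ i → sumℤ (map w (h i))) is)
sumℤ-concatMap w h [] = refl
sumℤ-concatMap w h (i ∷ is) = trans (cong sumℤ (map-++ w (h i) (concatMap h is)))
  (trans (sumℤ-++ (map w (h i)) _) (cong (λ z → sumℤ (map w (h i)) ℤ.+ z) (sumℤ-concatMap w h is)))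

sumℤ-scale : {A : Set} (c : ℤ) (w : A → ℤ) (xs : List A) → sumℤ (map (λ x → c ℤ.* w x) xs) ≡ c ℤ.* sumℤ (map w xs)
sumℤ-scale c w [] = sym (ℤ.*-zeroʳ c)
sumℤ-scale c w (x ∷ xs) = trans (cong (λ z → c ℤ.* w x ℤ.+ z) (sumℤ-scale c w xs)) (sym (ℤ.*-distribˡ-+ c _ _))

sumℤ-↭ : {A : Set} (w : A → ℤ) {xs ys : List A} → xs ↭ ys → sumℤ (map w xs) ≡ sumℤ (map w ys)
sumℤ-↭ w ↭.refl = refl
sumℤ-↭ w (↭.prep x p) = cong (λ z → w x ℤ.+ z) (sumℤ-↭ w p)
sumℤ-↭ w (↭.swap x y p) = trans (cong (λ z → w x ℤ.+ (w y ℤ.+ z)) (sumℤ-↭ w p))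
  (trans (sym (ℤ.+-assoc (w x) (w y) _)) (trans (cong (ℤ._+ _) (ℤ.+-comm (w x) (w y))) (ℤ.+-assoc (w y) (w x) _)))
sumℤ-↭ w (↭.trans p q) = trans (sumℤ-↭ w p) (sumℤ-↭ w q)

BoundedPartition : ℕ → ℕ → List ℕ → Set
BoundedPartition k n λs = All (_≤ k) λs × IsPartition n λs

-- Partitions are descending, so the parts equal to the largest allowed value k + 1 stand in front
-- of those at most k.
block : ℕ → ℕ → List ℕ → List ℕ
block k e μ = replicate e (suc k) ++ μ

All≤⇒All≢ : ∀ {k μ} → All (_≤ k) μ → All (suc k ≢_) μ
All≤⇒All≢ = All.map λ { x≤k refl → ℕ.1+n≰n x≤k }

B-block : ∀ k e {μ} → All (_≤ k) μ → B (block k (suc e) μ) ≡ suc k ∷ B μ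
B-block k zero {μ} μ≤k = cong (suc k ∷_) (filter-all (¬? ∘ (suc k ℕ.≟_)) (All.deduplicate⁺ ℕ._≟_ (All≤⇒All≢ μ≤k)))
B-block k (suc e) {μ} μ≤k = cong (suc k ∷_) (trans (cong (filter (¬? ∘ (suc k ℕ.≟_))) (B-block k e μ≤k))
  (trans (filter-reject (¬? ∘ (suc k ℕ.≟_)) (λ ¬p → ¬p refl))
    (filter-all (¬? ∘ (suc k ℕ.≟_)) (All.deduplicate⁺ ℕ._≟_ (All≤⇒All≢ μ≤k)))))

E-block-top : ∀ k e {μ} → All (_≤ k) μ → E (block k e μ) (suc k) ≡ e
E-block-top k zero μ≤k = cong length (filter-none (suc k ℕ.≟_) (All≤⇒All≢ μ≤k))
E-block-top k (suc e) μ≤k = trans (cong length (filter-accept (suc k ℕ.≟_) refl)) (cong suc (E-block-top k e μ≤k))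

E-block-low : ∀ k e μ {d} → d ≤ k → E (block k e μ) d ≡ E μ d
E-block-low k zero μ d≤k = refl
E-block-low k (suc e) μ {d} d≤k = trans (cong length (filter-reject (d ℕ.≟_) λ { refl → ℕ.1+n≰n d≤k })) (E-block-low k e μ d≤k)

module _ {ε : ℤ} (sg : IsSign ε) (s : ℕ → ℕ) where

  -- The weight is a product over distinct parts, and a block of parts k + 1 leaves the
  -- multiplicities of smaller parts alone.
  partTerm-block : ∀ k e {μ} → All (_≤ k) μ →
    partTerm ε s (block k e μ) ≡ coeffε ε (s (suc k)) e ℤ.* partTerm ε s μ
  partTerm-block k zero μ≤k = sym (ℤ.*-identityˡ _)
  partTerm-block k (suc e) {μ} μ≤k = begin
    prodℤ (map (λ d → inner ε (E λs d) (s d)) (B λs))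
      ≡⟨ cong (prodℤ ∘ map (λ d → inner ε (E λs d) (s d))) (B-block k e μ≤k) ⟩
    inner ε (E λs (suc k)) (s (suc k)) ℤ.* prodℤ (map (λ d → inner ε (E λs d) (s d)) (B μ))
      ≡⟨ cong₂ ℤ._*_ (trans (cong (λ m → inner ε m (s (suc k))) (E-block-top k (suc e) μ≤k)) (inner-coeff sg e (s (suc k))))
           (cong prodℤ (map-cong-local (All.map (λ {d} d≤k → cong (λ m → inner ε m (s d)) (E-block-low k (suc e) μ d≤k))
             (All.deduplicate⁺ ℕ._≟_ μ≤k)))) ⟩
    coeffε ε (s (suc k)) (suc e) ℤ.* partTerm ε s μ ∎
    where
    open ≡-Reasoning
    λs : List ℕ
    λs = block k (suc e) μ

-- The index j is the total of the parts equal to k + 1. It runs over 0, ..., n with nothing from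
-- the non-multiples of k + 1, so that the weighted sum is a Cauchy product with a stretched series.
parts : ℕ → ℕ → List (List ℕ)
blockParts : ∀ k n j → Dec (suc k ℕ∣ j) → List (List ℕ)
parts zero zero = [] ∷ []
parts zero (suc n) = []
parts (suc k) n = concatMap (λ j → blockParts k n j (suc k ℕ∣? j)) (upTo (suc n))
blockParts k n j (yes (divides e _)) = map (block k e) (parts k (n ℕ.∸ j))
blockParts k n j (no _) = []

BlockPartition : ℕ → ℕ → ℕ → List ℕ → Set
BlockPartition k n j λs = ∃[ e ] ∃[ μ ] (j ≡ e ℕ.* suc k × BoundedPartition k (n ℕ.∸ j) μ × λs ≡ block k e μ)

block-injective : ∀ k e e′ {μ μ′} → All (_≤ k) μ → All (_≤ k) μ′ → block k e μ ≡ block k e′ μ′ → e ≡ e′ × μ ≡ μ′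
block-injective k zero zero _ _ p = refl , p
block-injective k zero (suc e′) (k≤k ∷ _) _ refl = ⊥-elim (ℕ.1+n≰n k≤k)
block-injective k (suc e) zero _ (k≤k ∷ _) refl = ⊥-elim (ℕ.1+n≰n k≤k)
block-injective k (suc e) (suc e′) μ≤ μ′≤ p with block-injective k e e′ μ≤ μ′≤ (∷-injectiveʳ p)
... | refl , q = refl , q

sum-block : ∀ k e μ → sum (block k e μ) ≡ e ℕ.* suc k ℕ.+ sum μ
sum-block k zero μ = refl
sum-block k (suc e) μ = trans (cong (suc k ℕ.+_) (sum-block k e μ)) (sym (ℕ.+-assoc (suc k) (e ℕ.* suc k) (sum μ)))

block-partition : ∀ k e {n μ} → BoundedPartition k n μ → BoundedPartition (suc k) (e ℕ.* suc k ℕ.+ n) (block k e μ)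
block-partition k e {n} {μ} (≤k , ≥1 , desc , Σ≡) =
  All.++⁺ (rep ℕ.≤-refl) (All.map ℕ.m≤n⇒m≤1+n ≤k) , All.++⁺ (rep (s≤s z≤n)) ≥1 , descending e ,
  trans (sum-block k e μ) (cong (e ℕ.* suc k ℕ.+_) Σ≡)
  where
  rep : ∀ {e} {P : ℕ → Set} → P (suc k) → All P (replicate e (suc k))
  rep {zero} p = []
  rep {suc e} p = p ∷ rep p
  descending : ∀ e → AllPairs _≥_ (block k e μ)
  descending zero = desc
  descending (suc e) = All.++⁺ (rep ℕ.≤-refl) (All.map ℕ.m≤n⇒m≤1+n ≤k) ∷ descending e

unblock : ∀ k {n} λs → BoundedPartition (suc k) n λs → ∃[ e ] ∃[ μ ] ∃[ m ] (n ≡ e ℕ.* suc k ℕ.+ m × BoundedPartition k m μ × λs ≡ block k e μ)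
unblock k [] ([] , [] , [] , refl) = 0 , [] , 0 , refl , ([] , [] , [] , refl) , refl
unblock k (x ∷ λs) (x≤ ∷ ≤k , 1≤ ∷ ≥1 , x≥ ∷ desc , refl) with x ℕ.≟ suc k
... | yes refl with unblock k λs (≤k , ≥1 , desc , refl)
...   | e , μ , m , p , bp , refl = suc e , μ , m , trans (cong (suc k ℕ.+_) p) (sym (ℕ.+-assoc (suc k) _ m)) , bp , refl
unblock k (x ∷ λs) (x≤ ∷ ≤k , 1≤ ∷ ≥1 , x≥ ∷ desc , refl) | no x≢ =
  0 , x ∷ λs , _ , refl , (x≤k ∷ All.map (λ y≤x → ℕ.≤-trans y≤x x≤k) x≥ , 1≤ ∷ ≥1 , x≥ ∷ desc , refl) , refl
  where
  x≤k : x ≤ k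
  x≤k = ℕ.<⇒≤pred (ℕ.≤∧≢⇒< x≤ x≢)

parts-enum : ∀ k n → Enumerates (BoundedPartition k n) (parts k n)
blockParts-enum : ∀ k n j → (d : Dec (suc k ℕ∣ j)) → Enumerates (BlockPartition k n j) (blockParts k n j d)
parts-enum zero zero = ([] ∷ []) , λ λs → (λ { (here refl) → [] , [] , [] , refl }) ,
  λ { ([] , [] , [] , refl) → here refl ; (x≤0 ∷ _ , 1≤x ∷ _ , _) → ⊥-elim (ℕ.1+n≰n (ℕ.≤-trans 1≤x x≤0)) }
parts-enum zero (suc n) = enum-[] λ { _ ([] , [] , [] , ()) ; _ (x≤0 ∷ _ , 1≤x ∷ _ , _) → ℕ.1+n≰n (ℕ.≤-trans 1≤x x≤0) }
parts-enum (suc k) n = enum-resp to from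
  (enum-⋃ (upTo (suc n)) (upTo⁺ (suc n)) (λ j → blockParts k n j (suc k ℕ∣? j)) (BlockPartition k n)
    (λ j _ → blockParts-enum k n j (suc k ℕ∣? j))
    λ { (e , μ , refl , bp , refl) (e′ , μ′ , refl , bp′ , p) → cong (ℕ._* suc k) (proj₁ (block-injective k e e′ (proj₁ bp) (proj₁ bp′) p)) })
  where
  to : ∀ λs → ∃[ j ] (j ∈ upTo (suc n) × BlockPartition k n j λs) → BoundedPartition (suc k) n λs
  to λs (j , j∈ , e , μ , refl , bp , refl) = subst (λ m → BoundedPartition (suc k) m λs)
    (ℕ.m+[n∸m]≡n (ℕ.<⇒≤pred (∈-upTo⁻ j∈))) (block-partition k e bp)
  from : ∀ λs → BoundedPartition (suc k) n λs → ∃[ j ] (j ∈ upTo (suc n) × BlockPartition k n j λs)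
  from λs bp with unblock k λs bp
  ... | e , μ , m , refl , bp′ , refl = e ℕ.* suc k , ∈-upTo⁺ (s≤s (ℕ.m≤m+n (e ℕ.* suc k) m)) ,
    e , μ , refl , subst (λ m → BoundedPartition k m μ) (sym (ℕ.m+n∸m≡n (e ℕ.* suc k) m)) bp′ , refl
blockParts-enum k n j (no ¬p) = enum-[] λ { _ (e , _ , p , _) → ¬p (divides e p) }
blockParts-enum k n j (yes (divides e p)) = enum-map (block k e) (parts-enum k (n ℕ.∸ j))
  (λ μ bp → e , μ , p , bp , refl)
  (λ bp bp′ q → proj₂ (block-injective k e e (proj₁ bp) (proj₁ bp′) q))
  λ { _ (e′ , μ , p′ , bp , refl) → μ , bp , cong (λ e → block k e μ) (ℕ.*-cancelʳ-≡ e e′ (suc k) (trans (sym p) p′)) }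

-- The truncated numerator of the left-hand side; with -ε for ε it is the denominator.
W : ℤ → (ℕ → ℕ) → ℕ → Ser
W ε s zero = 𝟙
W ε s (suc k) = pow (lin ε (suc k)) (s (suc k)) ⊛ W ε s k

module _ {ε : ℤ} (sg : IsSign ε) (s : ℕ → ℕ) where

  partSum : ℕ → Ser
  partSum k n = sumℤ (map (partTerm ε s) (parts k n))

  partSum-suc : ∀ k → partSum (suc k) ≈ stretch k (coeffε ε (s (suc k))) ⊛ partSum k
  partSum-suc k n = trans (sumℤ-concatMap (partTerm ε s) (λ j → blockParts k n j (suc k ℕ∣? j)) (upTo (suc n)))
    (trans (cong sumℤ (map-cong (λ j → each j (suc k ℕ∣? j)) (upTo (suc n))))
      (⋆≈⊛ (stretch k (coeffε ε (s (suc k)))) (partSum k) n))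
    where
    each : ∀ j d → sumℤ (map (partTerm ε s) (blockParts k n j d)) ≡ stretchDec j (coeffε ε (s (suc k))) d ℤ.* partSum k (n ℕ.∸ j)
    each j (no _) = refl
    each j (yes (divides e _)) = trans (cong sumℤ (trans (sym (map-∘ (parts k (n ℕ.∸ j))))
      (map-cong-local (All.tabulate λ {μ} μ∈ → partTerm-block sg s k e (proj₁ (proj₁ (proj₂ (parts-enum k (n ℕ.∸ j)) μ) μ∈))))))
      (sumℤ-scale (coeffε ε (s (suc k)) e) (partTerm ε s) (parts k (n ℕ.∸ j)))

  partSum-W : ∀ k → partSum k ⊛ W (neg ε) s k ≈ W ε s k
  partSum-W zero = ≈-trans (⊛-identityʳ (partSum 0)) λ { zero → refl ; (suc n) → refl }
  partSum-W (suc k) = begin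
    partSum (suc k) ⊛ (P⁻ ⊛ W (neg ε) s k) ≈⟨ ⊛-cong {g = P⁻ ⊛ W (neg ε) s k} (partSum-suc k) ≈-refl ⟩
    (G ⊛ partSum k) ⊛ (P⁻ ⊛ W (neg ε) s k) ≈⟨ SS.solve 4 (λ a b c d → (a :* b) :* (c :* d) := (a :* c) :* (b :* d)) ≈-refl G (partSum k) P⁻ (W (neg ε) s k) ⟩
    (G ⊛ P⁻) ⊛ (partSum k ⊛ W (neg ε) s k) ≈⟨ ⊛-cong (stretch-coeff sg k (s (suc k))) (partSum-W k) ⟩
    W ε s (suc k) ∎
    where
    open import Relation.Binary.Reasoning.Setoid (CommutativeRing.setoid serRing)
    G P⁻ : Ser
    G = stretch k (coeffε ε (s (suc k)))
    P⁻ = pow (lin (neg ε) (suc k)) (s (suc k))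

  -- Up to degree n only parts at most n occur, so the truncated products are exact there. The
  -- constant term 1 of `lhs` comes from the empty partition.
  lhs-W : (ps : ℕ → List (List ℕ)) → (∀ n → Enumerates (IsPartition n) (ps n)) → ∀ n →
    lhs ε ps s ⊛ W (neg ε) s n ≈[ n ] W ε s n
  lhs-W ps pe n k k≤n = trans (⊛-cong[] {n} {g = W (neg ε) s n} lhs≈ (λ _ _ → refl) k k≤n) (partSum-W n k)
    where
    bounded : ∀ {m} → m ≤ n → ∀ λs → IsPartition m λs → BoundedPartition n m λs
    bounded m≤n λs p@(_ , _ , refl) = parts≤ λs m≤n , p
      where
      parts≤ : ∀ λs → sum λs ≤ n → All (_≤ n) λs
      parts≤ [] _ = []
      parts≤ (x ∷ λs) le = ℕ.≤-trans (ℕ.m≤m+n x _) le ∷ parts≤ λs (ℕ.≤-trans (ℕ.m≤n+m _ x) le)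
    all : ∀ {m} → m ≤ n → sumℤ (map (partTerm ε s) (ps m)) ≡ partSum n m
    all {m} m≤n = sumℤ-↭ (partTerm ε s) (enum-↭ (pe m) (enum-resp (λ _ → proj₂) (bounded m≤n) (parts-enum n m)))
    lhs≈ : lhs ε ps s ≈[ n ] partSum n
    lhs≈ zero m≤n = trans (sumℤ-↭ (partTerm ε s) {xs = [] ∷ []} (enum-↭
      (([] ∷ []) , λ λs → (λ { (here refl) → [] , [] , refl }) , λ { ([] , [] , refl) → here refl ; (1≤x ∷ _ , _ , p) → ⊥-elim (ℕ.1+n≰n (ℕ.≤-trans 1≤x (ℕ.≤-trans (ℕ.m≤m+n _ _) (ℕ.≤-reflexive p)))) })
      (pe 0))) (all m≤n)
    lhs≈ (suc m) m≤n = all m≤n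

-- The sieve

module Sieve (G : GradedMonoid) where
  open GradedMonoid G

  elems : ℕ → List M
  elems m = proj₁ (level m)

  elems-enum : ∀ m → Enumerates (λ f → deg f ≡ m) (elems m)
  elems-enum m = proj₁ (proj₂ (level m))

  ∈-elems : ∀ f → f ∈ elems (deg f)
  ∈-elems f = proj₂ (proj₂ (elems-enum (deg f)) f) refl

  deg-quotient : ∀ {f g h} → f ∙ h ≡ g → deg h ≡ deg g ℕ.∸ deg f
  deg-quotient {f} {g} {h} refl = sym (trans (cong (ℕ._∸ deg f) (deg-∙ f h)) (ℕ.m+n∸m≡n (deg f) (deg h)))

  ∣⇒deg≤ : ∀ {f g} → f ∣ g → deg f ≤ deg g
  ∣⇒deg≤ {f} (h , refl) = subst (deg f ≤_) (sym (deg-∙ f h)) (ℕ.m≤m+n (deg f) (deg h))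

  -- The degree of a quotient is known, so it is searched for in one finite level.
  _∣?_ : ∀ f g → Dec (f ∣ g)
  f ∣? g = map′ (λ a → let h , _ , p = find a in h , p)
    (λ (h , p) → lose (subst (λ m → h ∈ elems m) (deg-quotient p) (∈-elems h)) p)
    (any? (λ h → (f ∙ h) ≟ g) (elems (deg g ℕ.∸ deg f)))

  ∣-trans : ∀ {f g h} → f ∣ g → g ∣ h → f ∣ h
  ∣-trans {f} (u , refl) (v , refl) = u ∙ v , sym (∙-assoc f u v)

  ∣-∙ʳ : ∀ {f g} h → f ∣ g → f ∣ h ∙ g
  ∣-∙ʳ {f} {g} h (u , refl) = u ∙ h , trans (sym (∙-assoc f u h)) (∙-comm (f ∙ u) h)

  ~-∣ : ∀ {f g} → f ∣ g → f ~ ∣ g ~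
  ~-∣ {f} (u , refl) = u ~ , sym (~-∙ f u)

  ~-∣˘ : ∀ {f g} → f ~ ∣ g → f ∣ g ~
  ~-∣˘ {f} {g} d = subst (_∣ g ~) (~-involutive f) (~-∣ d)

  -- A proper divisor, when there is one, is found by searching the finitely many elements of smaller degree.
  irr⊎factor : ∀ f → 1 ≤ deg f → Irr f ⊎ ∃[ g ] (g ∣ f × 1 ≤ deg g × deg g < deg f)
  irr⊎factor f 1≤ with any? (λ m → any? (λ g → (g ∣? f) ×-dec (1 ℕ.≤? deg g)) (elems m)) (upTo (deg f))
  ... | yes a with find a
  ...   | m , m∈ , b with find b
  ...     | g , g∈ , d , 1≤g = inj₂ (g , d , 1≤g , subst (_< deg f) (sym (proj₁ (proj₂ (elems-enum m) g) g∈)) (∈-upTo⁻ m∈))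
  irr⊎factor f 1≤ | no ¬a = inj₁ (1≤ , irr)
    where
    irr : ∀ g h → g ∙ h ≡ f → deg g ≡ 0 ⊎ deg h ≡ 0
    irr g h p with deg g ℕ.≟ 0 | deg h ℕ.≟ 0
    ... | yes q | _ = inj₁ q
    ... | no _ | yes q = inj₂ q
    ... | no g≢0 | no h≢0 = ⊥-elim (¬a (lose (∈-upTo⁺ (subst (deg g <_) (trans (sym (deg-∙ g h)) (cong deg p))
      (ℕ.m<m+n (deg g) (ℕ.n≢0⇒n>0 h≢0)))) (lose (∈-elems g) ((h , p) , ℕ.n≢0⇒n>0 g≢0))))

  Irr? : Decidable Irr
  Irr? f with 1 ℕ.≤? deg f
  ... | no ¬p = no (¬p ∘ proj₁)
  ... | yes p with irr⊎factor f p
  ...   | inj₁ i = yes i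
  ...   | inj₂ (g , (h , q) , 1≤g , g<f) = no λ (_ , irr) → absurd (irr g h q)
    where
    absurd : deg g ≡ 0 ⊎ deg h ≡ 0 → ⊥
    absurd (inj₁ e) = ℕ.<⇒≢ 1≤g (sym e)
    absurd (inj₂ e) = ℕ.<⇒≢ g<f (trans (sym (ℕ.+-identityʳ (deg g))) (trans (cong (deg g ℕ.+_) (sym e)) (trans (sym (deg-∙ g h)) (cong deg q))))

  irr-divisor : ∀ f → 1 ≤ deg f → ∃[ p ] (Irr p × p ∣ f)
  irr-divisor f 1≤ = go f 1≤ (<-wellFounded (deg f))
    where
    go : ∀ f → 1 ≤ deg f → Acc _<_ (deg f) → ∃[ p ] (Irr p × p ∣ f)
    go f 1≤ (acc rec) with irr⊎factor f 1≤
    ... | inj₁ i = f , i , one , ∙-identityʳ f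
    ... | inj₂ (g , d , 1≤g , g<f) = let p , i , e = go g 1≤g (rec g<f) in p , i , ∣-trans e d

  Irr-~ : ∀ {f} → Irr f → Irr (f ~)
  Irr-~ {f} (1≤ , irr) = subst (1 ≤_) (sym (deg-~ f)) 1≤ , λ g h p → lift g h (irr (g ~) (h ~)
    (trans (sym (~-∙ g h)) (trans (cong _~ p) (~-involutive f))))
    where
    lift : ∀ g h → deg (g ~) ≡ 0 ⊎ deg (h ~) ≡ 0 → deg g ≡ 0 ⊎ deg h ≡ 0
    lift g h (inj₁ e) = inj₁ (trans (sym (deg-~ g)) e)
    lift g h (inj₂ e) = inj₂ (trans (sym (deg-~ h)) e)

  irr-∣-irr : ∀ {r p} → Irr r → Irr p → r ∣ p → r ≡ p
  irr-∣-irr {r} (1≤r , _) (_ , irr) (h , e) with irr r h e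
  ... | inj₁ z = ⊥-elim (ℕ.<⇒≢ 1≤r (sym z))
  ... | inj₂ z = trans (sym (∙-identityʳ r)) (trans (cong (r ∙_) (sym (deg≡0⇒one h z))) e)

  series : {Φ : M → Set} → Decidable Φ → Ser
  series Φ? m = + length (filter Φ? (elems m))

  series-count : ∀ {Φ : M → Set} (Φ? : Decidable Φ) {m n} → HasCount (λ f → deg f ≡ m × Φ f) n → series Φ? m ≡ + n
  series-count Φ? {m} c = cong +_ (count-unique (_ , enum-filter Φ? (elems-enum m) , refl) c)

  series-resp : ∀ {Φ Ψ : M → Set} (Φ? : Decidable Φ) (Ψ? : Decidable Ψ) → (∀ f → Φ f → Ψ f) → (∀ f → Ψ f → Φ f) → series Φ? ≈ series Ψ?
  series-resp Φ? Ψ? to from m = series-count Φ? (count-resp (λ f (d , p) → d , from f p) (λ f (d , p) → d , to f p)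
    (_ , enum-filter Ψ? (elems-enum m) , refl))

  -- Multiplication by q carries the Φ-elements of degree m - deg q bijectively onto those of degree
  -- m that q divides; removing these leaves Ψ. It is applied to irreducibles and to products p p~.
  sieve : ∀ {Φ Ψ : M → Set} (Φ? : Decidable Φ) (Ψ? : Decidable Ψ) q → (∀ w → Φ w → Φ (q ∙ w)) → (∀ w → Φ (q ∙ w) → Φ w) →
    (∀ f → Ψ f → Φ f × ¬ q ∣ f) → (∀ f → Φ f → ¬ q ∣ f → Ψ f) → series Ψ? ≈ lin -1ℤ (deg q) ⊛ series Φ?
  sieve {Φ} {Ψ} Φ? Ψ? q up down Ψ⇒ ⇒Ψ m = trans (solve-for (trans (cong +_ split) (ℤ.pos-+ a b)) (a≡ (deg q ℕ.≤? m)))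
      (sym (lin-⊛ (neg (+ 1)) (deg q) (series Φ?) m))
    where
    Θ? : Decidable (λ f → q ∣ f)
    Θ? = q ∣?_
    a b : ℕ
    a = length (filter Θ? (filter Φ? (elems m)))
    b = length (filter Ψ? (elems m))
    Φ-enum : ∀ m → Enumerates (λ f → deg f ≡ m × Φ f) (filter Φ? (elems m))
    Φ-enum m = enum-filter Φ? (elems-enum m)
    split : length (filter Φ? (elems m)) ≡ a ℕ.+ b
    split = count-split Θ? (_ , Φ-enum m , refl) (_ , enum-filter Θ? (Φ-enum m) , refl)
      (_ , enum-resp (λ f (d , ψ) → (d , proj₁ (Ψ⇒ f ψ)) , proj₂ (Ψ⇒ f ψ)) (λ f ((d , φ) , n) → d , ⇒Ψ f φ n) (enum-filter Ψ? (elems-enum m)) , refl)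
    a≡ : Dec (deg q ≤ m) → + a ≡ shift (deg q) (series Φ?) m
    a≡ (no q≰m) = trans (cong +_ (count-unique (_ , enum-filter Θ? (Φ-enum m) , refl)
      (count-zero λ { f ((refl , _) , d) → q≰m (∣⇒deg≤ d) }))) (sym (shift-< (deg q) (series Φ?) m (ℕ.≰⇒> q≰m)))
    a≡ (yes q≤m) = trans (cong +_ (count-unique (_ , enum-filter Θ? (Φ-enum m) , refl)
      (count-map (q ∙_) (_ , Φ-enum (m ℕ.∸ deg q) , refl)
        (λ w (d , φ) → (trans (deg-∙ q w) (trans (cong (deg q ℕ.+_) d) (ℕ.m+[n∸m]≡n q≤m)) , up w φ) , w , refl)
        (λ _ _ → ∙-cancelˡ q)
        λ { f ((refl , φ) , w , refl) → w , (deg-quotient refl , down w φ) , refl })))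
      (sym (shift-≥ (deg q) (series Φ?) m q≤m))
    solve-for : ∀ {x y z s : ℤ} → x ≡ y ℤ.+ z → y ≡ s → z ≡ x ℤ.+ neg (+ 1) ℤ.* s
    solve-for {y = y} {z} refl refl = ident y z
      where
      ident : ∀ y z → z ≡ y ℤ.+ z ℤ.+ neg (+ 1) ℤ.* y
      ident = solve-∀

  -- Both members of the orbit of r are excluded at once, so the condition is stable under the
  -- involution of f.
  Coprime : M → M → Set
  Coprime f r = ¬ r ∣ f × ¬ r ~ ∣ f

  Avoids : List M → M → Set
  Avoids ps f = All (Coprime f) ps

  Avoids? : ∀ ps → Decidable (Avoids ps)
  Avoids? ps f = all? (λ r → ¬? (r ∣? f) ×-dec ¬? ((r ~) ∣? f)) ps

  SelfDualAvoids : List M → M → Set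
  SelfDualAvoids ps f = f ~ ≡ f × Avoids ps f

  SelfDualAvoids? : ∀ ps → Decidable (SelfDualAvoids ps)
  SelfDualAvoids? ps f = ((f ~) ≟ f) ×-dec Avoids? ps f

  A Z : List M → Ser
  A ps = series (SelfDualAvoids? ps)
  Z ps = series (Avoids? ps)

  avoids-∙ : ∀ {ps q w} → All Irr ps → Avoids ps q → Avoids ps w → Avoids ps (q ∙ w)
  avoids-∙ [] [] [] = []
  avoids-∙ {q = q} {w} (i ∷ is) ((a , b) ∷ as) ((c , d) ∷ cs) = (∤-∙ i a c , ∤-∙ (Irr-~ i) b d) ∷ avoids-∙ is as cs
    where
    ∤-∙ : ∀ {r} → Irr r → ¬ r ∣ q → ¬ r ∣ w → ¬ r ∣ q ∙ w
    ∤-∙ i a c m with euclid i q w m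
    ... | inj₁ x = a x
    ... | inj₂ x = c x

  avoids-∙⁻ : ∀ {ps} q {w} → Avoids ps (q ∙ w) → Avoids ps w
  avoids-∙⁻ q = All.map λ (a , b) → a ∘ ∣-∙ʳ q , b ∘ ∣-∙ʳ q

  selfDual-∙ : ∀ {q w} → q ~ ≡ q → w ~ ≡ w → (q ∙ w) ~ ≡ q ∙ w
  selfDual-∙ {q} {w} p r = trans (~-∙ q w) (cong₂ _∙_ p r)

  selfDual-∙⁻ : ∀ {q w} → q ~ ≡ q → (q ∙ w) ~ ≡ q ∙ w → w ~ ≡ w
  selfDual-∙⁻ {q} {w} p r = ∙-cancelˡ q (trans (cong (_∙ w ~) (sym p)) (trans (sym (~-∙ q w)) r))

  irr-avoids : ∀ {ps p} → All Irr ps → Irr p → p ∉ ps → p ~ ∉ ps → Avoids ps p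
  irr-avoids [] _ _ _ = []
  irr-avoids {r ∷ _} {p} (i ∷ is) ip p∉ p~∉ =
    ((λ d → p∉ (here (sym (irr-∣-irr i ip d)))) ,
     (λ d → p~∉ (here (trans (cong _~ (sym (irr-∣-irr (Irr-~ i) ip d))) (~-involutive r)))))
    ∷ irr-avoids is ip (p∉ ∘ there) (p~∉ ∘ there)

  avoids-~ : ∀ {ps q} → Avoids ps q → Avoids ps (q ~)
  avoids-~ {q = q} = All.map λ {r} (a , b) →
    (λ d → b (subst (r ~ ∣_) (~-involutive q) (~-∣ d))) , (λ d → a (subst (r ∣_) (~-involutive q) (~-∣˘ d)))

  A-step : ∀ {ps p q} → All Irr ps → Avoids ps q → q ~ ≡ q →
    (∀ f → f ~ ≡ f → Coprime f p → ¬ q ∣ f) → (∀ f → f ~ ≡ f → ¬ q ∣ f → Coprime f p) →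
    A (p ∷ ps) ≈ lin -1ℤ (deg q) ⊛ A ps
  A-step {ps} {p} {q} is av sd to from = sieve (SelfDualAvoids? ps) (SelfDualAvoids? (p ∷ ps)) q
    (λ w (s , a) → selfDual-∙ sd s , avoids-∙ is av a)
    (λ w (s , a) → selfDual-∙⁻ sd s , avoids-∙⁻ q a)
    (λ { f (s , c ∷ a) → (s , a) , to f s c })
    (λ f (s , a) n → s , from f s n ∷ a)

  factors : ℤ → List M → Ser
  factors c [] = 𝟙
  factors c (p ∷ ps) with (p ~) ≟ p
  ... | yes _ = lin c (deg p) ⊛ factors c ps
  ... | no _ = factors c ps

  open import Relation.Binary.Reasoning.Setoid (CommutativeRing.setoid serRing)

  Z₂ : List M → Ser
  Z₂ ps = stretch 1 (Z ps)

  -- The invariant of the sieve: A(x)² / Z(x²) before and after, compared by cross-multiplication.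
  Balanced : List M → Set
  Balanced ps = (A ps ⊛ A ps) ⊛ (factors (+ 1) ps ⊛ Z₂ []) ≈ Z₂ ps ⊛ (factors -1ℤ ps ⊛ (A [] ⊛ A []))

  private
    F⁺ F⁻ : List M → Ser
    F⁺ = factors (+ 1)
    F⁻ = factors -1ℤ
    _∈?_ : ∀ (p : M) ps → Dec (p ∈ ps)
    p ∈? ps = any? (p ≟_) ps

  balanced : ∀ ps → All Irr ps → Unique ps → Balanced ps
  balanced [] _ _ = SS.solve 2 (λ a z → (a :* a) :* (SS.con 1 :* z) := z :* (SS.con 1 :* (a :* a))) ≈-refl (A []) (Z₂ [])
  balanced (p ∷ ps) (i ∷ is) (p∉ ∷ u) with balanced ps is u | (p ~) ≟ p
  -- Self-dual p of degree d: A² gains (1 - x^d)², while Z(x²) gains 1 - x^(2d) = (1 - x^d)(1 +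
  -- x^d).
  ... | ih | yes sd = begin
      (A (p ∷ ps) ⊛ A (p ∷ ps)) ⊛ ((L⁺ ⊛ F⁺ ps) ⊛ Z₂ [])
        ≈⟨ ⊛-cong {g = (L⁺ ⊛ F⁺ ps) ⊛ Z₂ []} (⊛-cong A≈ A≈) ≈-refl ⟩
      ((L⁻ ⊛ A ps) ⊛ (L⁻ ⊛ A ps)) ⊛ ((L⁺ ⊛ F⁺ ps) ⊛ Z₂ [])
        ≈⟨ SS.solve 5 (λ l k a f z → ((l :* a) :* (l :* a)) :* ((k :* f) :* z) := (l :* (l :* k)) :* ((a :* a) :* (f :* z))) ≈-refl L⁻ L⁺ (A ps) (F⁺ ps) (Z₂ []) ⟩
      (L⁻ ⊛ (L⁻ ⊛ L⁺)) ⊛ ((A ps ⊛ A ps) ⊛ (F⁺ ps ⊛ Z₂ []))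
        ≈⟨ ⊛-cong {f = L⁻ ⊛ (L⁻ ⊛ L⁺)} ≈-refl ih ⟩
      (L⁻ ⊛ (L⁻ ⊛ L⁺)) ⊛ (Z₂ ps ⊛ (F⁻ ps ⊛ (A [] ⊛ A [])))
        ≈⟨ SS.solve 5 (λ l k z f a → (l :* k) :* (z :* (f :* a)) := (k :* z) :* ((l :* f) :* a)) ≈-refl L⁻ (L⁻ ⊛ L⁺) (Z₂ ps) (F⁻ ps) (A [] ⊛ A []) ⟩
      ((L⁻ ⊛ L⁺) ⊛ Z₂ ps) ⊛ ((L⁻ ⊛ F⁻ ps) ⊛ (A [] ⊛ A []))
        ≈⟨ ⊛-cong {g = (L⁻ ⊛ F⁻ ps) ⊛ (A [] ⊛ A [])} (≈-sym Z≈) ≈-refl ⟩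
      Z₂ (p ∷ ps) ⊛ ((L⁻ ⊛ F⁻ ps) ⊛ (A [] ⊛ A [])) ∎
    where
    L⁻ L⁺ : Ser
    L⁻ = lin -1ℤ (deg p)
    L⁺ = lin (+ 1) (deg p)
    p∉ps : p ∉ ps
    p∉ps m = All.lookup p∉ m refl
    av : Avoids ps p
    av = irr-avoids is i p∉ps (subst (_∉ ps) (sym sd) p∉ps)
    both : ∀ f → ¬ p ∣ f → Coprime f p
    both f n = n , subst (λ r → ¬ r ∣ f) (sym sd) n
    A≈ : A (p ∷ ps) ≈ L⁻ ⊛ A ps
    A≈ = A-step is av sd (λ _ _ → proj₁) (λ f _ → both f)
    Z≈ : Z₂ (p ∷ ps) ≈ (L⁻ ⊛ L⁺) ⊛ Z₂ ps
    Z≈ = ≈-trans (stretch-cong 1 (sieve (Avoids? ps) (Avoids? (p ∷ ps)) p (λ w → avoids-∙ is av) (λ w → avoids-∙⁻ p)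
        (λ { f (c ∷ a) → a , proj₁ c }) (λ f a n → both f n ∷ a)))
      (≈-trans (stretch-lin* 1 (neg (+ 1)) (deg p) (Z ps)) (⊛-cong {g = Z₂ ps} (≈-sym (lin-conjugate (+ 1) (deg p))) ≈-refl))
  ... | ih | no ¬sd with (p ~) ∈? ps
  -- The orbit of p was sieved out together with its partner, so nothing changes.
  ...   | yes p~∈ = ≈-trans (⊛-cong {g = F⁺ ps ⊛ Z₂ []} (⊛-cong A≈ A≈) ≈-refl)
      (≈-trans ih (⊛-cong {g = F⁻ ps ⊛ (A [] ⊛ A [])} (stretch-cong 1 (≈-sym Z≈)) ≈-refl))
    where
    cop : ∀ f → Avoids ps f → Coprime f p
    cop f a = let x , y = All.lookup a p~∈ in subst (λ r → ¬ r ∣ f) (~-involutive p) y , x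
    Z≈ : Z (p ∷ ps) ≈ Z ps
    Z≈ = series-resp (Avoids? (p ∷ ps)) (Avoids? ps) (λ { f (_ ∷ a) → a }) (λ f a → cop f a ∷ a)
    A≈ : A (p ∷ ps) ≈ A ps
    A≈ = series-resp (SelfDualAvoids? (p ∷ ps)) (SelfDualAvoids? ps) (λ { f (s , _ ∷ a) → s , a }) (λ f (s , a) → s , cop f a ∷ a)
  -- A new pair: A loses the multiples of p p~, and Z those of p and then of p~, so A² and Z(x²)
  -- both gain (1 - x^(2d))².
  ...   | no p~∉ = begin
      (A (p ∷ ps) ⊛ A (p ∷ ps)) ⊛ (F⁺ ps ⊛ Z₂ [])
        ≈⟨ ⊛-cong {g = F⁺ ps ⊛ Z₂ []} (⊛-cong A≈ A≈) ≈-refl ⟩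
      ((L ⊛ A ps) ⊛ (L ⊛ A ps)) ⊛ (F⁺ ps ⊛ Z₂ [])
        ≈⟨ SS.solve 4 (λ l a f z → ((l :* a) :* (l :* a)) :* (f :* z) := (l :* l) :* ((a :* a) :* (f :* z))) ≈-refl L (A ps) (F⁺ ps) (Z₂ []) ⟩
      (L ⊛ L) ⊛ ((A ps ⊛ A ps) ⊛ (F⁺ ps ⊛ Z₂ []))
        ≈⟨ ⊛-cong {f = L ⊛ L} ≈-refl ih ⟩
      (L ⊛ L) ⊛ (Z₂ ps ⊛ (F⁻ ps ⊛ (A [] ⊛ A [])))
        ≈⟨ SS.solve 3 (λ l z a → (l :* l) :* (z :* a) := (l :* (l :* z)) :* a) ≈-refl L (Z₂ ps) (F⁻ ps ⊛ (A [] ⊛ A [])) ⟩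
      (L ⊛ (L ⊛ Z₂ ps)) ⊛ (F⁻ ps ⊛ (A [] ⊛ A []))
        ≈⟨ ⊛-cong {g = F⁻ ps ⊛ (A [] ⊛ A [])} (≈-sym Z≈) ≈-refl ⟩
      Z₂ (p ∷ ps) ⊛ (F⁻ ps ⊛ (A [] ⊛ A [])) ∎
    where
    L : Ser
    L = lin -1ℤ (deg p ℕ.* 2)
    p∉ps : p ∉ ps
    p∉ps m = All.lookup p∉ m refl
    i~ : Irr (p ~)
    i~ = Irr-~ i
    av : Avoids ps p
    av = irr-avoids is i p∉ps p~∉
    q : M
    q = p ∙ p ~
    deg-q : deg q ≡ deg p ℕ.* 2
    deg-q = trans (deg-∙ p (p ~)) (trans (cong (deg p ℕ.+_) (deg-~ p))
      (trans (cong (deg p ℕ.+_) (sym (ℕ.+-identityʳ (deg p)))) (ℕ.*-comm 2 (deg p))))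
    q~ : q ~ ≡ q
    q~ = trans (~-∙ p (p ~)) (trans (cong (p ~ ∙_) (~-involutive p)) (∙-comm (p ~) p))
    p~∤p : ¬ p ~ ∣ p
    p~∤p d = ¬sd (irr-∣-irr i~ i d)
    p∤p~ : ¬ p ∣ p ~
    p∤p~ d = ¬sd (sym (irr-∣-irr i i~ d))
    -- A self-dual f = p w is also divisible by p~, which does not divide p and hence divides w.
    q∣ : ∀ f → f ~ ≡ f → p ∣ f → q ∣ f
    q∣ f s (w , refl) with euclid i~ p w (subst (p ~ ∣_) s (~-∣ (w , refl)))
    ... | inj₁ d = ⊥-elim (p~∤p d)
    ... | inj₂ (v , refl) = v , ∙-assoc p (p ~) v
    A≈ : A (p ∷ ps) ≈ L ⊛ A ps
    A≈ = subst (λ d → A (p ∷ ps) ≈ lin -1ℤ d ⊛ A ps) deg-q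
      (A-step is (avoids-∙ is av (avoids-~ av)) q~
        (λ f s (n , _) d → n (∣-trans (p ~ , refl) d))
        (λ f s n → (n ∘ q∣ f s) , λ d → n (q∣ f s (subst (p ∣_) s (~-∣˘ d)))))
    Avoids₁? : Decidable (λ f → Avoids ps f × ¬ p ∣ f)
    Avoids₁? f = Avoids? ps f ×-dec ¬? (p ∣? f)
    Z≈₁ : series Avoids₁? ≈ lin -1ℤ (deg p) ⊛ Z ps
    Z≈₁ = sieve (Avoids? ps) Avoids₁? p (λ w → avoids-∙ is av) (λ w → avoids-∙⁻ p) (λ f x → x) (λ f → _,_)
    Z≈₂ : Z (p ∷ ps) ≈ lin -1ℤ (deg p) ⊛ series Avoids₁?
    Z≈₂ = subst (λ d → Z (p ∷ ps) ≈ lin -1ℤ d ⊛ series Avoids₁?) (deg-~ p)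
      (sieve Avoids₁? (Avoids? (p ∷ ps)) (p ~)
        (λ w (a , n) → avoids-∙ is (avoids-~ av) a , λ d → case w n (euclid i (p ~) w d))
        (λ w (a , n) → avoids-∙⁻ (p ~) a , n ∘ ∣-∙ʳ (p ~))
        (λ { f ((x , y) ∷ a) → (a , x) , y })
        (λ { f (a , x) y → (x , y) ∷ a }))
      where
      case : ∀ w → ¬ p ∣ w → p ∣ p ~ ⊎ p ∣ w → ⊥
      case w n (inj₁ d) = p∤p~ d
      case w n (inj₂ d) = n d
    Z≈ : Z₂ (p ∷ ps) ≈ L ⊛ (L ⊛ Z₂ ps)
    Z≈ = ≈-trans (stretch-cong 1 (≈-trans Z≈₂ (⊛-cong {f = lin -1ℤ (deg p)} ≈-refl Z≈₁)))
      (≈-trans (stretch-lin* 1 (neg (+ 1)) (deg p) (lin -1ℤ (deg p) ⊛ Z ps))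
        (⊛-cong {f = L} ≈-refl (stretch-lin* 1 (neg (+ 1)) (deg p) (Z ps))))

  -- Sieving by all irreducibles of degree at most n

  irrs : ℕ → List M
  irrs zero = []
  irrs (suc k) = filter Irr? (elems (suc k)) ++ irrs k

  irrs-sound : ∀ k {p} → p ∈ irrs k → Irr p × deg p ≤ k
  irrs-sound (suc k) {p} m with ∈-++⁻ (filter Irr? (elems (suc k))) m
  ... | inj₁ m′ = let e , i = ∈-filter⁻ Irr? {xs = elems (suc k)} m′ in i , ℕ.≤-reflexive (proj₁ (proj₂ (elems-enum (suc k)) p) e)
  ... | inj₂ m′ = let i , le = irrs-sound k m′ in i , ℕ.m≤n⇒m≤1+n le

  irrs-complete : ∀ k {p} → Irr p → deg p ≤ k → p ∈ irrs k
  irrs-complete zero (1≤ , _) le = ⊥-elim (ℕ.1+n≰n (ℕ.≤-trans 1≤ le))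
  irrs-complete (suc k) {p} i le with deg p ℕ.≟ suc k
  ... | yes e = ∈-++⁺ˡ (∈-filter⁺ Irr? (proj₂ (proj₂ (elems-enum (suc k)) p) e) i)
  ... | no ne = ∈-++⁺ʳ (filter Irr? (elems (suc k))) (irrs-complete k i (ℕ.<⇒≤pred (ℕ.≤∧≢⇒< le ne)))

  irrs-unique : ∀ k → Unique (irrs k)
  irrs-unique zero = []
  irrs-unique (suc k) = ++⁺ (filter⁺ Irr? (proj₁ (elems-enum (suc k)))) (irrs-unique k)
    λ {p} (m , m′) → ℕ.1+n≰n (subst (_≤ k) (proj₁ (proj₂ (elems-enum (suc k)) p) (proj₁ (∈-filter⁻ Irr? {xs = elems (suc k)} m))) (proj₂ (irrs-sound k m′)))

  irrs-irr : ∀ k → All Irr (irrs k)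
  irrs-irr k = All.tabulate (proj₁ ∘ irrs-sound k)

  avoids-irrs : ∀ n f → 1 ≤ deg f → deg f ≤ n → ¬ Avoids (irrs n) f
  avoids-irrs n f 1≤ ≤n a = let p , i , d = irr-divisor f 1≤ in
    proj₁ (All.lookup a (irrs-complete n i (ℕ.≤-trans (∣⇒deg≤ d) ≤n))) d

  one-avoids : ∀ n → Avoids (irrs n) one
  one-avoids n = All.map (λ {r} i → ∤one i , ∤one (Irr-~ i)) (irrs-irr n)
    where
    ∤one : ∀ {r} → Irr r → ¬ r ∣ one
    ∤one (1≤ , _) d = ℕ.1+n≰n (ℕ.≤-trans 1≤ (ℕ.≤-trans (∣⇒deg≤ d) (ℕ.≤-reflexive deg-one)))

  one-selfDual : one ~ ≡ one
  one-selfDual = deg≡0⇒one (one ~) (trans (deg-~ one) deg-one)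

  exhausted : ∀ {Φ : M → Set} (Φ? : Decidable Φ) n → Φ one → (∀ f → 1 ≤ deg f → deg f ≤ n → ¬ Φ f) → series Φ? ≈[ n ] 𝟙
  exhausted Φ? n φ1 none zero _ = series-count Φ? (count-one one (deg-one , φ1) λ f (d , _) → deg≡0⇒one f d)
  exhausted Φ? n φ1 none (suc m) m≤n = series-count Φ? (count-zero λ f (d , φ) →
    none f (subst (1 ≤_) (sym d) (s≤s z≤n)) (subst (_≤ n) (sym d) m≤n) φ)

  -- Every element of degree between 1 and n has an irreducible divisor of degree at most n, so only
  -- `one` survives.
  A-irrs : ∀ n → A (irrs n) ≈[ n ] 𝟙
  A-irrs n = exhausted (SelfDualAvoids? (irrs n)) n (one-selfDual , one-avoids n) λ f 1≤ ≤n (_ , a) → avoids-irrs n f 1≤ ≤n a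

  Z₂-irrs : ∀ n → Z₂ (irrs n) ≈[ n ] 𝟙
  Z₂-irrs n k k≤n = trans (stretch-cong[] k k≤n) (stretch-𝟙 1 k)
    where
    stretch-cong[] : stretch 1 (Z (irrs n)) ≈[ n ] stretch 1 𝟙
    stretch-cong[] k k≤n with 2 ℕ∣? k
    ... | yes (divides e p) = exhausted (Avoids? (irrs n)) n (one-avoids n) (avoids-irrs n) e
      (ℕ.≤-trans (ℕ.m≤m*n e 2) (ℕ.≤-trans (ℕ.≤-reflexive (sym p)) k≤n))
    ... | no _ = refl

  factors-balance : ∀ n → factors (+ 1) (irrs n) ⊛ Z₂ [] ≈[ n ] factors -1ℤ (irrs n) ⊛ (A [] ⊛ A [])
  factors-balance n k k≤n = trans (sym (⊛-identityˡ (F⁺ ps ⊛ Z₂ []) k))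
    (trans (⊛-cong[] {n} {g = F⁺ ps ⊛ Z₂ []} (λ j j≤n → trans (sym (⊛-identityˡ 𝟙 j)) (⊛-cong[] (λ i i≤n → sym (A-irrs n i i≤n)) (λ i i≤n → sym (A-irrs n i i≤n)) j j≤n)) (λ _ _ → refl) k k≤n)
      (trans (balanced ps (irrs-irr n) (irrs-unique n) k)
        (trans (⊛-cong[] {n} {g = F⁻ ps ⊛ (A [] ⊛ A [])} (Z₂-irrs n) (λ _ _ → refl) k k≤n) (⊛-identityˡ (F⁻ ps ⊛ (A [] ⊛ A [])) k))))
    where
    ps : List M
    ps = irrs n

  factors-++ : ∀ c ps qs → factors c (ps ++ qs) ≈ factors c ps ⊛ factors c qs
  factors-++ c [] qs = ≈-sym (⊛-identityˡ (factors c qs))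
  factors-++ c (p ∷ ps) qs with (p ~) ≟ p
  ... | yes _ = ≈-trans (⊛-cong {f = lin c (deg p)} ≈-refl (factors-++ c ps qs)) (≈-sym (⊛-assoc (lin c (deg p)) (factors c ps) (factors c qs)))
  ... | no _ = factors-++ c ps qs

  selfDual? : Decidable (λ f → f ~ ≡ f)
  selfDual? f = (f ~) ≟ f

  factors-pow : ∀ c d ps → All (λ p → deg p ≡ d) ps → factors c ps ≈ pow (lin c d) (length (filter selfDual? ps))
  factors-pow c d [] [] = ≈-refl
  factors-pow c d (p ∷ ps) (refl ∷ a) = split ((p ~) ≟ p)
    where
    split : Dec (p ~ ≡ p) → factors c (p ∷ ps) ≈ pow (lin c (deg p)) (length (filter selfDual? (p ∷ ps)))
    split (yes s) with (p ~) ≟ p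
    ... | yes _ = ⊛-cong {f = lin c (deg p)} ≈-refl (factors-pow c (deg p) ps a)
    ... | no ¬s = ⊥-elim (¬s s)
    split (no ¬s) with (p ~) ≟ p
    ... | yes s = ⊥-elim (¬s s)
    ... | no _ = factors-pow c (deg p) ps a

  module _ (s : ℕ → ℕ) (s-count : ∀ d → 1 ≤ d → HasCount (λ p → deg p ≡ d × Irr p × p ~ ≡ p) (s d)) where

    factors-W : ∀ c n → factors c (irrs n) ≈ W c s n
    factors-W c zero = ≈-refl
    factors-W c (suc n) = ≈-trans (factors-++ c ps (irrs n)) (⊛-cong
      (≈-trans (factors-pow c (suc n) ps (All.tabulate λ {p} m → proj₁ (proj₂ (elems-enum (suc n)) p) (proj₁ (∈-filter⁻ Irr? {xs = elems (suc n)} m))))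
        λ k → cong (λ m → pow (lin c (suc n)) m k) number)
      (factors-W c n))
      where
      ps : List M
      ps = filter Irr? (elems (suc n))
      number : length (filter selfDual? ps) ≡ s (suc n)
      number = count-unique (_ , enum-resp (λ f ((d , i) , sd) → d , i , sd) (λ f (d , i , sd) → (d , i) , sd)
        (enum-filter selfDual? (enum-filter Irr? (elems-enum (suc n)))) , refl) (s-count (suc n) (s≤s z≤n))

    module _ (a : ℕ → ℕ) (a-count : ∀ m → HasCount (λ f → deg f ≡ m × f ~ ≡ f) (a m)) where

      W-balance : ∀ n → W (+ 1) s n ⊛ stretch 1 (λ m → + size m) ≈[ n ] W -1ℤ s n ⊛ ((λ m → + a m) ⊛ (λ m → + a m))
      W-balance n k k≤n = trans (⊛-cong (≈-sym (factors-W (+ 1) n)) (stretch-cong 1 (λ m → sym (Z-size m))) k)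
        (trans (factors-balance n k k≤n) (⊛-cong (factors-W -1ℤ n) (⊛-cong A-a A-a) k))
        where
        A-a : A [] ≈ (λ m → + a m)
        A-a m = series-count (SelfDualAvoids? []) (count-resp (λ f (d , sd) → d , sd , []) (λ f (d , sd , _) → d , sd) (a-count m))
        Z-size : Z [] ≈ (λ m → + size m)
        Z-size m = series-count (Avoids? []) (count-resp (λ f d → d , []) (λ f → proj₁) (level m))

-- The two identities

≈[]-mono : ∀ {m n f g} → m ≤ n → f ≈[ n ] g → f ≈[ m ] g
≈[]-mono m≤n e k k≤m = e k (ℕ.≤-trans k≤m m≤n)

quadratic : ℤ → ℤ → Ser
quadratic a b = + 1 ◂ a ◂ b ◂ 𝟘

lin-⊛-lin : ∀ a b → lin a 1 ⊛ lin b 1 ≈ quadratic (a ℤ.+ b) (a ℤ.* b)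
lin-⊛-lin a b n = trans (lin-⊛ a 1 (lin b 1) n) (cases n)
  where
  eq₀ : ∀ a b → + 1 ℤ.+ b ℤ.* + 0 ℤ.+ a ℤ.* + 0 ≡ + 1
  eq₀ = solve-∀
  eq₁ : ∀ a b → + 0 ℤ.+ b ℤ.* + 1 ℤ.+ a ℤ.* (+ 1 ℤ.+ b ℤ.* + 0) ≡ a ℤ.+ b
  eq₁ = solve-∀
  eq₂ : ∀ a b → + 0 ℤ.+ b ℤ.* + 0 ℤ.+ a ℤ.* (+ 0 ℤ.+ b ℤ.* + 1) ≡ a ℤ.* b
  eq₂ = solve-∀
  eq₃ : ∀ a b → + 0 ℤ.+ b ℤ.* + 0 ℤ.+ a ℤ.* (+ 0 ℤ.+ b ℤ.* + 0) ≡ + 0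
  eq₃ = solve-∀
  cases : lin b 1 ⊕ a · shift 1 (lin b 1) ≈ quadratic (a ℤ.+ b) (a ℤ.* b)
  cases 0 = eq₀ a b
  cases 1 = eq₁ a b
  cases 2 = eq₂ a b
  cases (suc (suc (suc n))) = eq₃ a b

quadratic-cong : ∀ {a a′ b b′} → a ≡ a′ → b ≡ b′ → quadratic a b ≈ quadratic a′ b′
quadratic-cong refl refl = ≈-refl

lin-const : ∀ c d → lin c (suc d) 0 ≡ + 1
lin-const c d = cong (λ z → + 1 ℤ.+ z) (ℤ.*-zeroʳ c)

pow-const : ∀ f n → f 0 ≡ + 1 → pow f n 0 ≡ + 1
pow-const f zero _ = refl
pow-const f (suc n) e = trans (cong₂ ℤ._*_ e (pow-const f n e)) refl

W-const : ∀ c s n → W c s n 0 ≡ + 1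
W-const c s zero = refl
W-const c s (suc n) = trans (cong₂ ℤ._*_ (pow-const (lin c (suc n)) (s (suc n)) (lin-const c n)) (W-const c s n)) refl

cancel-unit : ∀ {f g h n} → f 0 ≡ + 1 → g ⊛ f ≈[ n ] h ⊛ f → g ≈[ n ] h
cancel-unit {f} e = ⊛-cancelʳ[] {u = + 1} {f = f} (trans (ℤ.*-identityˡ _) e)

-- The product of ((1 + x^d) / (1 - x^d))^(s d) equals N / D, cross-multiplied and truncated. With
-- `suc n` the doubled product in `W-spread` always contains the linear factors.
Identity : (ℕ → ℕ) → Ser → Ser → Set
Identity s N D = ∀ n → W (+ 1) s (suc n) ⊛ D ≈[ n ] W -1ℤ s (suc n) ⊛ N

module _ {s : ℕ → ℕ} (ps : ℕ → List (List ℕ)) (pe : ∀ n → Enumerates (IsPartition n) (ps n)) where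

  transport : ∀ {ε} → IsSign ε → ∀ {P R} → (∀ n → W ε s (suc n) ⊛ P ≈[ n ] W (neg ε) s (suc n) ⊛ R) → ∀ n → (lhs ε ps s ⋆ P) n ≡ R n
  transport {ε} sg {P} {R} id n = trans (⋆≈⊛ F P n) (cancel-unit {f = V} (W-const (neg ε) s (suc n)) eq n ℕ.≤-refl)
    where
    F V : Ser
    F = lhs ε ps s
    V = W (neg ε) s (suc n)
    eq : (F ⊛ P) ⊛ V ≈[ n ] R ⊛ V
    eq k k≤n = trans (SS.solve 3 (λ f p v → (f :* p) :* v := (f :* v) :* p) ≈-refl F P V k)
      (trans (⊛-cong[] {n} {g = P} (≈[]-mono (ℕ.n≤1+n n) (lhs-W sg s ps pe (suc n))) (λ _ _ → refl) k k≤n)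
        (trans (id n k k≤n) (⊛-comm V R k)))

  -- Replacing ε by -ε exchanges the two products, so ε = -1 reads the same identity from right to
  -- left.
  ratPowEq : ∀ {ε} → IsSign ε → ∀ {N D} → Identity s N D → RatPowEq ε (lhs ε ps s) N D
  ratPowEq (inj₁ refl) id = (λ _ → transport (inj₁ refl) id) , λ ()
  ratPowEq (inj₂ refl) id = (λ ()) , λ _ → transport (inj₂ refl) (λ n k k≤n → sym (id n k k≤n))

-- The number of fixed pairs is |K| + κ in both applications: (q + 1) q = q² + q for the
-- conjugation, and |K| or |K| + 1 for the identity. This lets one calculation serve both.
module Balance (K : FiniteField) (I : Involution K)
    (κ : ℕ)
    (norm-count : HasCount (MonicMonoid.NormOne K I) (suc κ))
    (fixed-count : HasCount (MonicMonoid.NormOneFixed K I) (FiniteField.card K ℕ.+ κ)) where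
  open FiniteField K using (card)
  open ListCount K using (count-nonzero)
  open MonicMonoid K I using (deg; _~; Irr; monoid; size; selfDualCount; palCount; selfDual-count)

  private
    D : Ser
    D = lin (neg (+ card)) 2
    a : ℕ → ℕ
    a = selfDualCount norm-count fixed-count
    A Z₂ : Ser
    A m = + a m
    Z₂ = stretch 1 (λ m → + size m)

  -- From degree 3 on the count is |K| times the count two degrees lower, so `D` cancels it; in
  -- degree 2 it is |K| + κ, which leaves κ.
  D-A : D ⊛ A ≈ lin (+ 1) 1 ⊛ lin (+ κ) 1
  D-A n = trans (lin-⊛ (neg (+ card)) 2 A n) (trans (cases n) (sym (trans (lin-⊛-lin (+ 1) (+ κ) n) (quadratic-cong refl (ℤ.*-identityˡ (+ κ)) n))))
    where
    eq₂ : ∀ c k → (c ℤ.+ k) ℤ.+ neg c ℤ.* + 1 ≡ k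
    eq₂ = solve-∀
    eq₃ : ∀ c p → p ℤ.* c ℤ.+ neg c ℤ.* p ≡ + 0
    eq₃ = solve-∀
    cases : A ⊕ neg (+ card) · shift 2 A ≈ quadratic (+ 1 ℤ.+ + κ) (+ κ)
    cases 0 = cong (λ z → + 1 ℤ.+ z) (ℤ.*-zeroʳ (neg (+ card)))
    cases 1 = trans (cong (λ z → + suc κ ℤ.+ z) (ℤ.*-zeroʳ (neg (+ card)))) (ℤ.+-identityʳ _)
    cases 2 = trans (cong (ℤ._+ neg (+ card) ℤ.* + 1) (ℤ.pos-+ card κ)) (eq₂ (+ card) (+ κ))
    cases (suc (suc (suc n))) = trans (cong (ℤ._+ neg (+ card) ℤ.* + p) (ℤ.pos-* p card)) (eq₃ (+ card) (+ p))
      where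
      p : ℕ
      p = palCount norm-count fixed-count n

  D-Z₂ : D ⊛ Z₂ ≈ lin -1ℤ 2
  D-Z₂ = ≈-trans (≈-sym (stretch-lin 1 (neg (+ card)) (λ m → + size m)))
    (≈-trans (stretch-cong 1 (≈-trans base (≈-sym (⊛-identityʳ (lin -1ℤ 1)))))
      (≈-trans (stretch-lin 1 (neg (+ 1)) 𝟙) (≈-trans (⊛-cong {f = lin -1ℤ 2} ≈-refl (stretch-𝟙 1)) (⊛-identityʳ (lin -1ℤ 2)))))
    where
    k : ℕ
    k = proj₁ count-nonzero
    eq₁ : ∀ k → k ℤ.* + 1 ℤ.+ neg (+ 1 ℤ.+ k) ℤ.* + 1 ≡ + 0 ℤ.+ neg (+ 1) ℤ.* + 1
    eq₁ = solve-∀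
    eq₂ : ∀ c k p → k ℤ.* (c ℤ.* p) ℤ.+ neg c ℤ.* (k ℤ.* p) ≡ + 0 ℤ.+ neg (+ 1) ℤ.* + 0
    eq₂ = solve-∀
    cases : (λ m → + size m) ⊕ neg (+ card) · shift 1 (λ m → + size m) ≈ lin -1ℤ 1
    cases 0 = cong (λ z → + 1 ℤ.+ z) (trans (ℤ.*-zeroʳ (neg (+ card))) (sym (ℤ.*-zeroʳ (neg (+ 1)))))
    cases 1 = trans (cong₂ (λ x y → x ℤ.+ neg y ℤ.* + 1) (ℤ.pos-* k 1) (cong +_ (proj₂ (proj₂ count-nonzero)))) (eq₁ (+ k))
    cases (suc (suc m)) = trans (cong₂ (λ x y → x ℤ.+ neg (+ card) ℤ.* y)
      (trans (ℤ.pos-* k (card ℕ.* card ℕ.^ m)) (cong (+ k ℤ.*_) (ℤ.pos-* card (card ℕ.^ m)))) (ℤ.pos-* k (card ℕ.^ m))) (eq₂ (+ card) (+ k) (+ (card ℕ.^ m)))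
    base : lin (neg (+ card)) 1 ⊛ (λ m → + size m) ≈ lin -1ℤ 1
    base n = trans (lin-⊛ (neg (+ card)) 1 (λ m → + size m) n) (cases n)

  module _ (s : ℕ → ℕ) (s-count : ∀ d → 1 ≤ d → HasCount (λ p → deg p ≡ d × Irr p × p ~ ≡ p) (s d)) where

    -- The sieve's relation multiplied by D². Since D Z(x²) = (1 - x)(1 + x) and D A = (1 + x)(1 + κ
    -- x), one factor 1 + x cancels.
    balance : ∀ n → W (+ 1) s n ⊛ (lin -1ℤ 1 ⊛ D) ≈[ n ] W -1ℤ s n ⊛ (lin (+ 1) 1 ⊛ (lin (+ κ) 1 ⊛ lin (+ κ) 1))
    balance n = cancel-unit {f = L⁺} (lin-const (+ 1) 0) λ k k≤n → begin
        ((W⁺ ⊛ (L⁻ ⊛ D)) ⊛ L⁺) k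
          ≡⟨ SS.solve 4 (λ w l d p → (w :* (l :* d)) :* p := (w :* (l :* p)) :* d) ≈-refl W⁺ L⁻ D L⁺ k ⟩
        ((W⁺ ⊛ (L⁻ ⊛ L⁺)) ⊛ D) k
          ≡⟨ ⊛-cong {g = D} (⊛-cong {f = W⁺} ≈-refl (≈-trans (lin-conjugate (+ 1) 1) (≈-sym D-Z₂))) ≈-refl k ⟩
        ((W⁺ ⊛ (D ⊛ Z₂)) ⊛ D) k
          ≡⟨ SS.solve 3 (λ w d z → (w :* (d :* z)) :* d := (w :* z) :* (d :* d)) ≈-refl W⁺ D Z₂ k ⟩
        ((W⁺ ⊛ Z₂) ⊛ (D ⊛ D)) k
          ≡⟨ ⊛-cong[] {n} {g = D ⊛ D} (Sieve.W-balance monoid s s-count a (selfDual-count norm-count fixed-count) n) (λ _ _ → refl) k k≤n ⟩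
        ((W⁻ ⊛ (A ⊛ A)) ⊛ (D ⊛ D)) k
          ≡⟨ SS.solve 3 (λ w d a → (w :* (a :* a)) :* (d :* d) := w :* ((d :* a) :* (d :* a))) ≈-refl W⁻ D A k ⟩
        (W⁻ ⊛ ((D ⊛ A) ⊛ (D ⊛ A))) k
          ≡⟨ ⊛-cong {f = W⁻} ≈-refl (⊛-cong D-A D-A) k ⟩
        (W⁻ ⊛ ((L⁺ ⊛ M) ⊛ (L⁺ ⊛ M))) k
          ≡⟨ SS.solve 3 (λ w l m → w :* ((l :* m) :* (l :* m)) := (w :* (l :* (m :* m))) :* l) ≈-refl W⁻ L⁺ M k ⟩
        ((W⁻ ⊛ (L⁺ ⊛ (M ⊛ M))) ⊛ L⁺) k ∎
      where
      open ≡-Reasoning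
      W⁺ W⁻ L⁺ L⁻ M : Ser
      W⁺ = W (+ 1) s n
      W⁻ = W -1ℤ s n
      L⁺ = lin (+ 1) 1
      L⁻ = lin -1ℤ 1
      M = lin (+ κ) 1

poly-quadratic : ∀ a b → poly (+ 1 ∷ a ∷ b ∷ []) ≈ quadratic a b
poly-quadratic a b 0 = refl
poly-quadratic a b 1 = refl
poly-quadratic a b 2 = refl
poly-quadratic a b (suc (suc (suc n))) = refl

-- The identity for self-dual irreducibles

module _ (q : ℕ) (K L : FiniteField) (cardK : FiniteField.card K ≡ q) (cardL : FiniteField.card L ≡ q ℕ.* q)
    (sdim : ℕ → ℕ) (sdim-count : ∀ d → 1 ≤ d → HasCount (FiniteField.SelfDualIrr L q d) (sdim d)) where
  open Unitary K L q cardK cardL using (σ; conjugation; norm-one-count; norm-fixed-count)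
  open FiniteField L using (1#; 0#; Carrier; Reducible; SelfDual; const; card; _⁻¹; _^_)
  open FieldSeries L using (mon)
  open MonicMonoid L conjugation using (Mon; deg; _~; Irr; const-nonzero; NormOneFixed; count-vec; const-mon; list⇒selfDual; selfDual⇒list; ¬reducible⇒irr; irr⇒¬reducible; twistedReverse)
  open Mon using (body)

  selfDualIrr-count : ∀ d → 1 ≤ d → HasCount (λ p → deg p ≡ d × Irr p × p ~ ≡ p) (sdim d)
  selfDualIrr-count d 1≤d = count-resp to from (count-vec Ψ (λ w (_ , nz , _) z → nz (trans (const-mon w) z)) (sdim-count d 1≤d))
    where
    Ψ : List Carrier → Set
    Ψ w = (1 ≤ d × ¬ Reducible (w ∷ʳ 1#)) × SelfDual q (w ∷ʳ 1#)
    scale : ∀ f → const (body f ∷ʳ 1#) ≡ mon (body f) 0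
    scale f = const-mon (body f)
    to : ∀ f → deg f ≡ d × Ψ (body f) → deg f ≡ d × Irr f × f ~ ≡ f
    to f (refl , i , _ , sd) = refl , ¬reducible⇒irr f i ,
      list⇒selfDual (trans (cong (λ c → twistedReverse (σ c ⁻¹) (body f ∷ʳ 1#)) (sym (scale f))) sd)
    from : ∀ f → deg f ≡ d × Irr f × f ~ ≡ f → deg f ≡ d × Ψ (body f)
    from f (refl , i , sd) = refl , irr⇒¬reducible f i , (λ z → const-nonzero f (trans (sym (scale f)) z)) ,
      trans (cong (λ c → twistedReverse (σ c ⁻¹) (body f ∷ʳ 1#)) (scale f)) (selfDual⇒list sd)

  open Balance L conjugation q norm-one-count
    (subst (HasCount NormOneFixed) (trans (ℕ.+-comm q (q ℕ.* q)) (cong (ℕ._+ q) (sym cardL))) norm-fixed-count) using (balance)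

  -- With κ = q and |L| = q², the factor 1 - q² x² splits as (1 - q x)(1 + q x), and one of the two
  -- factors 1 + q x on the other side cancels.
  sd-identity : Identity sdim (sdNum q) (sdDen q)
  sd-identity n = cancel-unit {f = M} (lin-const (+ q) 0) λ k k≤n → begin
      ((W⁺ ⊛ sdDen q) ⊛ M) k
        ≡⟨ ⊛-cong {g = M} (⊛-cong {f = W⁺} ≈-refl den) ≈-refl k ⟩
      ((W⁺ ⊛ (L⁻ ⊛ M⁻)) ⊛ M) k
        ≡⟨ SS.solve 4 (λ w l d m → (w :* (l :* d)) :* m := w :* (l :* (d :* m))) ≈-refl W⁺ L⁻ M⁻ M k ⟩
      (W⁺ ⊛ (L⁻ ⊛ (M⁻ ⊛ M))) k
        ≡⟨ ⊛-cong {f = W⁺} ≈-refl (⊛-cong {f = L⁻} ≈-refl (≈-trans (lin-conjugate (+ q) 1) (λ j → cong (λ z → lin (neg z) 2 j) (trans (sym (ℤ.pos-* q q)) (cong +_ (sym cardL)))))) k ⟩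
      (W⁺ ⊛ (L⁻ ⊛ lin (neg (+ card)) 2)) k
        ≡⟨ balance sdim selfDualIrr-count (suc n) k (ℕ.m≤n⇒m≤1+n k≤n) ⟩
      (W⁻ ⊛ (L⁺ ⊛ (M ⊛ M))) k
        ≡⟨ SS.solve 3 (λ w l m → w :* (l :* (m :* m)) := (w :* (l :* m)) :* m) ≈-refl W⁻ L⁺ M k ⟩
      ((W⁻ ⊛ (L⁺ ⊛ M)) ⊛ M) k
        ≡⟨ ⊛-cong {g = M} (⊛-cong {f = W⁻} ≈-refl (≈-sym num)) ≈-refl k ⟩
      ((W⁻ ⊛ sdNum q) ⊛ M) k ∎
    where
    open ≡-Reasoning
    W⁺ W⁻ L⁺ L⁻ M M⁻ : Ser
    W⁺ = W (+ 1) sdim (suc n)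
    W⁻ = W -1ℤ sdim (suc n)
    L⁺ = lin (+ 1) 1
    L⁻ = lin -1ℤ 1
    M = lin (+ q) 1
    M⁻ = lin (neg (+ q)) 1
    num : sdNum q ≈ L⁺ ⊛ M
    num = ≈-trans (poly-quadratic (+ 1 ℤ.+ + q) (+ q)) (≈-trans (quadratic-cong refl (sym (ℤ.*-identityˡ (+ q)))) (≈-sym (lin-⊛-lin (+ 1) (+ q))))
    den : sdDen q ≈ L⁻ ⊛ M⁻
    den = ≈-trans (poly-quadratic (neg (+ 1 ℤ.+ + q)) (+ q)) (≈-trans (quadratic-cong (ℤ.neg-distrib-+ (+ 1) (+ q)) (sym (trans (ℤ.-1*i≡-i (neg (+ q))) (ℤ.neg-involutive (+ q)))))
      (≈-sym (lin-⊛-lin -1ℤ (neg (+ q)))))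

poly-lin : ∀ c → poly (+ 1 ∷ c ∷ []) ≈ lin c 1
poly-lin c 0 = cong (λ z → + 1 ℤ.+ z) (sym (ℤ.*-zeroʳ c))
poly-lin c 1 = sym (trans (ℤ.+-identityˡ _) (ℤ.*-identityʳ c))
poly-lin c (suc (suc n)) = sym (trans (ℤ.+-identityˡ _) (ℤ.*-zeroʳ c))

stretch-pow : ∀ c d m f → stretch 1 (pow (lin c d) m ⊛ f) ≈ pow (lin c (d ℕ.* 2)) m ⊛ stretch 1 f
stretch-pow c d zero f = ≈-trans (stretch-cong 1 (⊛-identityˡ f)) (≈-sym (⊛-identityˡ (stretch 1 f)))
stretch-pow c d (suc m) f = ≈-trans (stretch-cong 1 (⊛-assoc (lin c d) (pow (lin c d) m) f))
  (≈-trans (stretch-lin* 1 c d (pow (lin c d) m ⊛ f)) (≈-trans (⊛-cong {f = lin c (d ℕ.* 2)} ≈-refl (stretch-pow c d m f))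
    (≈-sym (⊛-assoc (lin c (d ℕ.* 2)) (pow (lin c (d ℕ.* 2)) m) (stretch 1 f)))))

pow-coeff₁ : ∀ f m → f 0 ≡ + 1 → pow f m 1 ≡ + m ℤ.* f 1
pow-coeff₁ f zero e = refl
pow-coeff₁ f (suc m) e = trans (cong₂ ℤ._+_ (cong₂ ℤ._*_ e (pow-coeff₁ f m e)) (cong (f 1 ℤ.*_) (pow-const f m e))) (ident (+ m) (f 1))
  where
  ident : ∀ m x → + 1 ℤ.* (m ℤ.* x) ℤ.+ x ℤ.* + 1 ≡ (+ 1 ℤ.+ m) ℤ.* x
  ident = solve-∀

W₂-coeff₁ : ∀ c s → W c s 2 1 ≡ c ℤ.* + s 1
W₂-coeff₁ c s = trans (cong₂ ℤ._+_ (cong₂ ℤ._*_ (pow-const (lin c 2) (s 2) (lin-const c 1))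
      (trans (⊛-identityʳ (pow (lin c 1) (s 1)) 1) (pow-coeff₁ (lin c 1) (s 1) (lin-const c 0))))
    (cong₂ ℤ._*_ (pow-coeff₁ (lin c 2) (s 2) (lin-const c 1)) (W-const c s 1)))
  (ident c (+ s 1) (+ s 2))
  where
  ident : ∀ c s t → + 1 ℤ.* (s ℤ.* (+ 0 ℤ.+ c ℤ.* + 1)) ℤ.+ t ℤ.* (+ 0 ℤ.+ c ℤ.* + 0) ℤ.* + 1 ≡ c ℤ.* s
  ident = solve-∀

-- The identity for self-reciprocal irreducibles

module _ (K : FiniteField) (srim : ℕ → ℕ) (srim-count : ∀ d → 1 ≤ d → HasCount (FiniteField.SelfRecipIrr K d) (srim d)) where
  open FiniteField K using (card)
  open Reciprocal K
  open MonicMonoid K trivial using (NormOne; NormOneFixed)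

  -- The κ + 1 irreducibles of degree 1 give a power of 1 + c x; all others have even degree 2d and
  -- give a product in x².
  W-spread : ∀ {κ} (nc : HasCount NormOne (suc κ)) (fc : HasCount NormOneFixed (card ℕ.+ κ)) c k →
    W c (irrCount srim srim-count nc fc) (suc k ℕ.* 2) ≈ pow (lin c 1) (suc κ) ⊛ stretch 1 (W c srim (suc k))
  W-spread {κ} nc fc c k = ≈-trans (⊛-cong (λ j → cong (λ m → pow (lin c (suc k ℕ.* 2)) m j) (spread-even (λ d → srim (suc d)) k)) (rest k))
    (≈-trans (SS.solve 3 (λ a b v → a :* (b :* v) := b :* (a :* v)) ≈-refl (pow (lin c (suc k ℕ.* 2)) (srim (suc k))) (pow (lin c 1) (suc κ)) (stretch 1 (W c srim k)))
      (⊛-cong {f = pow (lin c 1) (suc κ)} ≈-refl (≈-sym (stretch-pow c (suc k) (srim (suc k)) (W c srim k)))))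
    where
    s : ℕ → ℕ
    s = irrCount srim srim-count nc fc
    rest : ∀ k → W c s (suc (k ℕ.* 2)) ≈ pow (lin c 1) (suc κ) ⊛ stretch 1 (W c srim k)
    rest zero = ⊛-cong {f = pow (lin c 1) (suc κ)} ≈-refl (≈-sym (stretch-𝟙 1))
    rest (suc k) = ≈-trans (⊛-cong {g = W c s (suc k ℕ.* 2)} (λ j → cong (λ m → pow (lin c (suc (suc k ℕ.* 2))) m j) (spread-odd (λ d → srim (suc d)) k)) ≈-refl)
      (≈-trans (⊛-identityˡ (W c s (suc k ℕ.* 2))) (W-spread nc fc c k))

  private
    D N₁ : Ser
    D = lin (neg (+ card)) 1
    N₁ = lin -1ℤ 1
    L⁺ L⁻ D₂ : Ser
    L⁺ = lin (+ 1) 1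
    L⁻ = lin -1ℤ 1
    D₂ = lin (neg (+ card)) 2
    V⁺ V⁻ : ℕ → Ser
    V⁺ n = stretch 1 (W (+ 1) srim (suc n))
    V⁻ n = stretch 1 (W -1ℤ srim (suc n))

  unstretch : ∀ {n f g} → stretch 1 f ≈[ suc n ℕ.* 2 ] stretch 1 g → f ≈[ n ] g
  unstretch {n} {f} {g} e k k≤n = trans (sym (stretch-* 1 f k)) (trans (e (k ℕ.* 2) (ℕ.*-monoˡ-≤ 2 (ℕ.m≤n⇒m≤1+n k≤n))) (stretch-* 1 g k))

  V-D : ∀ n → stretch 1 (W (+ 1) srim (suc n) ⊛ D) ≈ V⁺ n ⊛ D₂
  V-D n = ≈-trans (stretch-cong 1 (⊛-comm (W (+ 1) srim (suc n)) D)) (≈-trans (stretch-lin 1 (neg (+ card)) (W (+ 1) srim (suc n))) (⊛-comm D₂ (V⁺ n)))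

  spread-balance : ∀ {κ} (nc : HasCount NormOne (suc κ)) (fc : HasCount NormOneFixed (card ℕ.+ κ)) n →
    (pow L⁺ (suc κ) ⊛ V⁺ n) ⊛ (L⁻ ⊛ D₂) ≈[ suc n ℕ.* 2 ] (pow L⁻ (suc κ) ⊛ V⁻ n) ⊛ (L⁺ ⊛ (lin (+ κ) 1 ⊛ lin (+ κ) 1))
  spread-balance {κ} nc fc n k k≤ = trans (sym (⊛-cong {g = L⁻ ⊛ D₂} (W-spread nc fc (+ 1) n) ≈-refl k))
    (trans (Balance.balance K trivial κ nc fc (irrCount srim srim-count nc fc) (irr-count srim srim-count nc fc) (suc n ℕ.* 2) k k≤)
      (⊛-cong {g = L⁺ ⊛ (lin (+ κ) 1 ⊛ lin (+ κ) 1)} (W-spread nc fc (neg (+ 1)) n) ≈-refl k))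

  -- The linear factors are 1 + x against 1 - x. Cancelling both leaves V⁺ (1 - |K| x²) = V⁻, a
  -- relation in x².
  identity₀ : HasCount NormOne 1 → HasCount NormOneFixed (card ℕ.+ 0) → Identity srim 𝟙 D
  identity₀ nc fc n k k≤n = trans (unstretch {n} eq k k≤n) (sym (⊛-identityʳ (W -1ℤ srim (suc n)) k))
    where
    lin0 : lin (+ 0) 1 ≈ 𝟙
    lin0 j = ℤ.+-identityʳ (𝟙 j)
    eq : stretch 1 (W (+ 1) srim (suc n) ⊛ D) ≈[ suc n ℕ.* 2 ] V⁻ n
    eq j j≤ = trans (V-D n j) (cancel-unit {f = L⁺ ⊛ L⁻} (cong₂ ℤ._*_ (lin-const (+ 1) 0) (lin-const (neg (+ 1)) 0))
      (λ i i≤ → trans (SS.solve 4 (λ p m v d → (v :* d) :* (p :* m) := ((p :* SS.con 1) :* v) :* (m :* d)) ≈-refl L⁺ L⁻ (V⁺ n) D₂ i)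
        (trans (spread-balance nc fc n i i≤) (trans (⊛-cong {f = pow L⁻ 1 ⊛ V⁻ n} ≈-refl (⊛-cong {f = L⁺} ≈-refl (⊛-cong lin0 lin0)) i)
          (SS.solve 3 (λ p m v → ((m :* SS.con 1) :* v) :* (p :* (SS.con 1 :* SS.con 1)) := v :* (p :* m)) ≈-refl L⁺ L⁻ (V⁻ n) i)))) j j≤)

  -- Here (1 + x)² V⁺ (1 - x)(1 - |K| x²) = (1 - x)² V⁻ (1 + x)³. Cancelling (1 + x)² (1 - x) leaves
  -- 1 - x² on the right, which is the numerator 1 - x at x².
  identity₁ : HasCount NormOne 2 → HasCount NormOneFixed (card ℕ.+ 1) → Identity srim N₁ D
  identity₁ nc fc n = unstretch {n} eq
    where
    stretch-N : stretch 1 (W -1ℤ srim (suc n) ⊛ N₁) ≈ V⁻ n ⊛ (L⁻ ⊛ L⁺)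
    stretch-N = ≈-trans (stretch-cong 1 (⊛-comm (W -1ℤ srim (suc n)) N₁)) (≈-trans (stretch-lin 1 (neg (+ 1)) (W -1ℤ srim (suc n)))
      (≈-trans (⊛-comm (lin -1ℤ 2) (V⁻ n)) (⊛-cong {f = V⁻ n} ≈-refl (≈-sym (lin-conjugate (+ 1) 1)))))
    eq : stretch 1 (W (+ 1) srim (suc n) ⊛ D) ≈[ suc n ℕ.* 2 ] stretch 1 (W -1ℤ srim (suc n) ⊛ N₁)
    eq j j≤ = trans (V-D n j) (trans (cancel-unit {f = (L⁺ ⊛ L⁺) ⊛ L⁻} (cong₂ ℤ._*_ (cong₂ ℤ._*_ (lin-const (+ 1) 0) (lin-const (+ 1) 0)) (lin-const (neg (+ 1)) 0))
      (λ i i≤ → trans (SS.solve 4 (λ p m v d → (v :* d) :* ((p :* p) :* m) := ((p :* (p :* SS.con 1)) :* v) :* (m :* d)) ≈-refl L⁺ L⁻ (V⁺ n) D₂ i)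
        (trans (spread-balance nc fc n i i≤)
          (SS.solve 3 (λ p m v → ((m :* (m :* SS.con 1)) :* v) :* (p :* (p :* p)) := (v :* (m :* p)) :* ((p :* p) :* m)) ≈-refl L⁺ L⁻ (V⁻ n) i))) j j≤)
      (sym (stretch-N j)))

  -- The coefficient of x in the identity reads srim 1 - card = - srim 1 - κ, which determines the parity of card.
  card-parity : ∀ κ {N} → N 0 ≡ + 1 → N 1 ≡ neg (+ κ) → Identity srim N D → card ≡ κ ℕ.+ srim 1 ℕ.* 2
  card-parity κ {N} n0 n1 id = ℤ.+-injective (trans (solve-q (+ card) (+ srim 1) (+ κ) coefficient)
      (sym (trans (ℤ.pos-+ κ (srim 1 ℕ.* 2)) (cong (λ z → + κ ℤ.+ z) (ℤ.pos-* (srim 1) 2)))))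
    where
    coefficient : + 1 ℤ.* (+ 0 ℤ.+ neg (+ card) ℤ.* + 1) ℤ.+ + 1 ℤ.* + srim 1 ℤ.* + 1 ≡ + 1 ℤ.* neg (+ κ) ℤ.+ neg (+ 1) ℤ.* + srim 1 ℤ.* + 1
    coefficient = trans (sym (cong₂ ℤ._+_ (cong (ℤ._* (+ 0 ℤ.+ neg (+ card) ℤ.* + 1)) (W-const (+ 1) srim 2)) (cong₂ ℤ._*_ (W₂-coeff₁ (+ 1) srim) (lin-const (neg (+ card)) 0))))
      (trans (id 1 1 (s≤s z≤n)) (cong₂ ℤ._+_ (cong₂ ℤ._*_ (W-const (neg (+ 1)) srim 2) n1) (cong₂ ℤ._*_ (W₂-coeff₁ (neg (+ 1)) srim) n0)))
    solve-q : ∀ c s k → + 1 ℤ.* (+ 0 ℤ.+ neg c ℤ.* + 1) ℤ.+ + 1 ℤ.* s ℤ.* + 1 ≡ + 1 ℤ.* neg k ℤ.+ neg (+ 1) ℤ.* s ℤ.* + 1 → c ≡ k ℤ.+ s ℤ.* + 2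
    solve-q c s k e = trans (before c s) (trans (cong (λ z → s ℤ.- z) e) (after s k))
      where
      before : ∀ c s → c ≡ s ℤ.- (+ 1 ℤ.* (+ 0 ℤ.+ neg c ℤ.* + 1) ℤ.+ + 1 ℤ.* s ℤ.* + 1)
      before = solve-∀
      after : ∀ s k → s ℤ.- (+ 1 ℤ.* neg k ℤ.+ neg (+ 1) ℤ.* s ℤ.* + 1) ≡ k ℤ.+ s ℤ.* + 2
      after = solve-∀

  identity-resp : ∀ {N N′ P P′} → N ≈ N′ → P ≈ P′ → Identity srim N P → Identity srim N′ P′
  identity-resp {N} {N′} {P} {P′} eN eP id n k k≤n = trans (⊛-cong {f = W (+ 1) srim (suc n)} ≈-refl (≈-sym eP) k)
    (trans (id n k k≤n) (⊛-cong {f = W -1ℤ srim (suc n)} ≈-refl eN k))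

  srNum-even : ∀ q → q % 2 ≡ 0 → 𝟙 ≈ srNum q
  srNum-even q e n with q % 2
  srNum-even q refl zero | .0 = refl
  srNum-even q refl (suc n) | .0 = refl

  srNum-odd : ∀ q → q % 2 ≡ 1 → N₁ ≈ srNum q
  srNum-odd q e n with q % 2
  srNum-odd q refl n | .1 = sym (poly-lin -1ℤ n)

  sr-identity : ∀ q → card ≡ q → Identity srim (srNum q) (srDen q)
  sr-identity q refl with counts
  ... | .0 , inj₁ refl , nc , fc = identity-resp (srNum-even card (trans (cong (_% 2) (card-parity 0 refl refl id₀)) ([m+kn]%n≡m%n 0 (srim 1) 2))) (≈-sym (poly-lin (neg (+ card)))) id₀
    where
    id₀ : Identity srim 𝟙 D
    id₀ = identity₀ nc fc
  ... | .1 , inj₂ refl , nc , fc = identity-resp (srNum-odd card (trans (cong (_% 2) (card-parity 1 refl refl id₁)) ([m+kn]%n≡m%n 1 (srim 1) 2))) (≈-sym (poly-lin (neg (+ card)))) id₁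
    where
    id₁ : Identity srim N₁ D
    id₁ = identity₁ nc fc

open import Data.Nat using (_*_)
open import Data.Integer using (-_)

theorem6p8 : (q : ℕ) (K L : FiniteField)
    → FiniteField.card K ≡ q
    → FiniteField.card L ≡ q * q
    → (ε : ℤ) → (ε ≡ + 1 ⊎ ε ≡ - (+ 1))
    → (ps : ℕ → List (List ℕ)) → (∀ n → Enumerates (IsPartition n) (ps n))
    → (sdim srim : ℕ → ℕ)
    → (∀ d → 1 ≤ d → HasCount (FiniteField.SelfDualIrr L q d) (sdim d))
    → (∀ d → 1 ≤ d → HasCount (FiniteField.SelfRecipIrr K d) (srim d))
    → RatPowEq ε (lhs ε ps sdim) (sdNum q) (sdDen q)
      × RatPowEq ε (lhs ε ps srim) (srNum q) (srDen q)
theorem6p8 q K L cardK cardL ε sign ps ps-enum sdim srim sdim-count srim-count =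
  ratPowEq ps ps-enum sign (sd-identity q K L cardK cardL sdim sdim-count) ,
  ratPowEq ps ps-enum sign (sr-identity K srim srim-count q cardK)
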